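{- The following identities of formal power series hold. (1) If $a_n$ is the number of maximally clustered permutations in $S_{n}$, then $$\sum_{n\ge 0}a_{n+1}x^n=\frac{2x}{ -1+4x-2x^2+\sqrt{1-4x}} .$$ (2) If $b_n$ is the number of freely-braided hexagon-avoiding permutations in $S_n$, then $$\sum_{n\ge 0}b_{n+1}x^n=\frac{ -x^6-2x^5+2x^4+x^3-3x^2+4x-1}{x^7-x^6-8x^5+x^4+3x^3-9x^2+6x-1} .$$ (3) If $m_n$ is the number of maximally-clustered hexagon-avoiding permutations in $S_n$, then $$\sum_{n\ge 0}m_{n+1}x^n=\frac{3x^5+x^4-5x^3+7x^2-5x+1}{ -3x^6+4x^5+8x^4-14x^3+15x^2-7x+1} .$$
   Context: All avoidance is classical (one-line notation) permutation pattern avoidance. A permutation is freely braided if it avoids $[4231],[3421],[4312],[4321]$; it is maximally clustered if it avoids $[3421],[4312],[4321]$. Hexagon-avoiding permutations are those avoiding $[46718235],[46781235],[56718234],[56781234]$. "Freely-braided hexagon-avoiding" (respectively "maximally-clustered hexagon-avoiding") means avoiding all patterns of both lists. Here $\sqrt{1-4x}$ is the formal power series with constant term $1$ whose square is $1-4x$, and quotients are taken in the field of formal Laurent series. -}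

module Defs where

open import Agda.Builtin.FromNat using (Number; fromNat)
open import Agda.Builtin.FromNeg using (Negative; fromNeg)
open import Algebra.Bundles using (CommutativeMonoid)
import Algebra.Properties.CommutativeSemigroup as CommutativeSemigroupProperties
open import Data.Fin.Base as Fin using (Fin)
open import Data.Fin.Permutation using (Permutation′; _⟨$⟩ʳ_)
open import Data.Integer.Base using (ℤ)
import Data.Integer.Literals as ℤ
open import Data.List.Base using (List; []; _∷_; _++_; length; lookup)
open import Data.List.Relation.Unary.All using (All)
open import Data.Nat.Base as ℕ using (ℕ; zero; suc; z≤n; s≤s)
import Data.Nat.Literals as ℕ
import Data.Nat.Properties as ℕ
open import Data.Product.Base using (Σ; ∃; _×_; _,_)
open import Data.Rational.Base as ℚ using (ℚ; 0ℚ; 1ℚ; ½)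
open import Data.Rational.Literals using (fromℤ)
import Data.Rational.Properties as ℚ
import Data.Rational.Solver as ℚ-Solver
open import Data.Unit.Base using (tt)
open import Data.Vec.Base using (Vec; []; _∷_; head)
open import Function.Base using (_∘_)
open import Function.Bundles using (Inverse; _⇔_)
open import Level using (0ℓ)
open import Relation.Binary.Bundles using (Setoid)
import Relation.Binary.Construct.On as On
open import Relation.Binary.PropositionalEquality
open import Relation.Nullary using (¬_)

instance
  ℕ-number : Number ℕ
  ℕ-number = ℕ.number

  ℤ-number : Number ℤ
  ℤ-number = ℤ.number

  ℤ-negative : Negative ℤ
  ℤ-negative = ℤ.negative

-- A pattern in one-line notation; only the relative order of the
-- entries matters.
Pattern : Set
Pattern = List ℕ

infix 4 _Contains_ _Avoids_

_Contains_ : ∀ {n} → Permutation′ n → Pattern → Set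
_Contains_ {n} π p =
  ∃ λ (e : Fin (length p) → Fin n) →
    (∀ i j → i Fin.< j → e i Fin.< e j) ×
    (∀ i j → lookup p i ℕ.< lookup p j ⇔ π ⟨$⟩ʳ e i Fin.< π ⟨$⟩ʳ e j)

_Avoids_ : ∀ {n} → Permutation′ n → List Pattern → Set
π Avoids ps = All (λ p → ¬ (π Contains p)) ps

-- Bijections carry their inverse and its laws, and avoidance proofs are
-- functions, so permutations are identified when they agree pointwise.
Avoiders : ℕ → List Pattern → Setoid 0ℓ 0ℓ
Avoiders n ps = On.setoid {B = Σ (Permutation′ n) (_Avoids ps)}
  (Fin n →-setoid Fin n) (λ (π , _) → π ⟨$⟩ʳ_)

infix 4 _IsSizeOf_

_IsSizeOf_ : ℕ → Setoid 0ℓ 0ℓ → Set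
k IsSizeOf S = Inverse (setoid (Fin k)) S

maximallyClusteredPatterns : List Pattern
maximallyClusteredPatterns =
    (3 ∷ 4 ∷ 2 ∷ 1 ∷ [])
  ∷ (4 ∷ 3 ∷ 1 ∷ 2 ∷ [])
  ∷ (4 ∷ 3 ∷ 2 ∷ 1 ∷ [])
  ∷ []

freelyBraidedPatterns : List Pattern
freelyBraidedPatterns =
    (4 ∷ 2 ∷ 3 ∷ 1 ∷ [])
  ∷ (3 ∷ 4 ∷ 2 ∷ 1 ∷ [])
  ∷ (4 ∷ 3 ∷ 1 ∷ 2 ∷ [])
  ∷ (4 ∷ 3 ∷ 2 ∷ 1 ∷ [])
  ∷ []

hexagonPatterns : List Pattern
hexagonPatterns =
    (4 ∷ 6 ∷ 7 ∷ 1 ∷ 8 ∷ 2 ∷ 3 ∷ 5 ∷ [])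
  ∷ (4 ∷ 6 ∷ 7 ∷ 8 ∷ 1 ∷ 2 ∷ 3 ∷ 5 ∷ [])
  ∷ (5 ∷ 6 ∷ 7 ∷ 1 ∷ 8 ∷ 2 ∷ 3 ∷ 4 ∷ [])
  ∷ (5 ∷ 6 ∷ 7 ∷ 8 ∷ 1 ∷ 2 ∷ 3 ∷ 4 ∷ [])
  ∷ []

PowerSeries : Set
PowerSeries = ℕ → ℚ

-- Coefficients in order of increasing degree.
poly : List ℤ → PowerSeries
poly []       n       = 0ℚ
poly (c ∷ cs) zero    = fromℤ c
poly (c ∷ cs) (suc n) = poly cs n

ogf : (ℕ → ℕ) → PowerSeries
ogf a n = fromℤ (ℤ.pos (a n))

const : ℚ → PowerSeries
const c zero    = c
const c (suc n) = 0ℚ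

tail : PowerSeries → PowerSeries
tail f = f ∘ suc

-- Multiplication by xᵏ.
shift : ℕ → PowerSeries → PowerSeries
shift zero    f n       = f n
shift (suc k) f zero    = 0ℚ
shift (suc k) f (suc n) = shift k f n

infixl 6 _+_
infixl 7 _*_

_+_ : PowerSeries → PowerSeries → PowerSeries
(f + g) n = f n ℚ.+ g n

-- Cauchy product: (f * g) n = Σ_{i ≤ n} f i · g (n - i).
_*_ : PowerSeries → PowerSeries → PowerSeries
(f * g) zero    = f 0 ℚ.* g 0
(f * g) (suc n) = f 0 ℚ.* g (suc n) ℚ.+ (tail f * g) n

module _ (u : PowerSeries) {{_ : ℚ.NonZero (u 0)}} where

  dot : ∀ {n} → PowerSeries → Vec ℚ n → ℚ
  dot f []       = 0ℚ
  dot f (v ∷ vs) = f 0 ℚ.* v ℚ.+ dot (tail f) vs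

  -- The coefficients vₙ, …, v₀ of 1/u, from
  -- u₀ vₙ₊₁ + (u₁ vₙ + ⋯ + uₙ₊₁ v₀) = 0.
  recips : ∀ n → Vec ℚ (suc n)
  recips zero    = ℚ.1/ u 0 ∷ []
  recips (suc n) = ℚ.- (ℚ.1/ u 0 ℚ.* dot (tail u) (recips n)) ∷ recips n

  recip : PowerSeries
  recip n = head (recips n)

-- √c is the square root with constant term 1 of a series c with constant
-- term 1.  sqrtApprox c n agrees with it up to degree n; raising n by one
-- adds e xⁿ⁺¹, which changes the coefficient of xⁿ⁺¹ in the square by 2e.
sqrtApprox : PowerSeries → ℕ → PowerSeries
sqrtApprox c zero    = const 1ℚ
sqrtApprox c (suc n) = s + shift (suc n) (const (½ ℚ.* (c (suc n) ℚ.- (s * s) (suc n))))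
  where
  s : PowerSeries
  s = sqrtApprox c n

infix 8 √_

√_ : PowerSeries → PowerSeries
(√ c) n = sqrtApprox c n n

-- x^- m · f represents the formal Laurent series x⁻ᵐ f; the
-- representation is not unique, hence _≈_ below.
infix 5 x^-_·_

record Laurent : Set where
  constructor x^-_·_
  field
    pole   : ℕ
    series : PowerSeries

infix 4 _≈_

_≈_ : Laurent → Laurent → Set
(x^- m · f) ≈ (x^- n · g) = shift n f ≗ shift m g

⟦_⟧ : PowerSeries → Laurent
⟦ f ⟧ = x^- 0 · f

1ᴸ : Laurent
1ᴸ = ⟦ const 1ℚ ⟧

infixl 7 _*ᴸ_ _/_

_*ᴸ_ : Laurent → Laurent → Laurent
(x^- m · f) *ᴸ (x^- n · g) = x^- (m ℕ.+ n) · (f * g)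

-- A Laurent series that is nonzero, with its first nonzero coefficient.
record NonZero (a : Laurent) : Set where
  open Laurent a
  field
    order   : ℕ
    below   : ∀ i → i ℕ.< order → series i ≡ 0ℚ
    leading : ℚ.NonZero (series order)

-- If f = xᵏ u with u₀ ≠ 0, then (x⁻ᵐ f)⁻¹ = x⁻ᵏ (xᵐ u⁻¹).
_⁻¹ : (a : Laurent) {{_ : NonZero a}} → Laurent
_⁻¹ (x^- m · f) {{a≢0}} =
  x^- order · shift m (recip (f ∘ (ℕ._+ order)) {{leading}})
  where open NonZero a≢0

_/_ : (a b : Laurent) {{_ : NonZero b}} → Laurent
a / b = a *ᴸ b ⁻¹

instance
  poly-nonZero : ∀ {c cs} {{_ : ℚ.NonZero (fromℤ c)}} → NonZero ⟦ poly (c ∷ cs) ⟧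
  poly-nonZero {{c≢0}} = record { order = 0; below = λ _ (); leading = c≢0 }

  -- -1 + 4x - 2x² + √(1 - 4x) = 2x + ⋯ has order 1.
  maximallyClusteredDenominator-nonZero :
    NonZero ⟦ poly (-1 ∷ 4 ∷ -2 ∷ []) + √ (poly (1 ∷ -4 ∷ [])) ⟧
  maximallyClusteredDenominator-nonZero = record
    { order   = 1
    ; below   = λ { zero _ → refl ; (suc _) (s≤s ()) }
    ; leading = _
    }

module PowerSeriesProperties where

  open CommutativeSemigroupProperties
    (CommutativeMonoid.commutativeSemigroup ℚ.+-0-commutativeMonoid)
    using (interchange)

  agree-* : ∀ n {f f′ g g′ : PowerSeries} →
            (∀ i → i ℕ.≤ n → f i ≡ f′ i) → (∀ i → i ℕ.≤ n → g i ≡ g′ i) →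
            (f * g) n ≡ (f′ * g′) n
  agree-* zero    p q = cong₂ ℚ._*_ (p 0 z≤n) (q 0 z≤n)
  agree-* (suc n) p q = cong₂ ℚ._+_
    (cong₂ ℚ._*_ (p 0 z≤n) (q (suc n) ℕ.≤-refl))
    (agree-* n (λ i i≤n → p (suc i) (s≤s i≤n)) (λ i i≤n → q i (ℕ.m≤n⇒m≤1+n i≤n)))

  *-cong : ∀ {f f′ g g′ : PowerSeries} → f ≗ f′ → g ≗ g′ → f * g ≗ f′ * g′
  *-cong p q n = agree-* n (λ i _ → p i) (λ i _ → q i)

  shift-cong : ∀ k {f g : PowerSeries} → f ≗ g → shift k f ≗ shift k g
  shift-cong zero    p n       = p n
  shift-cong (suc k) p zero    = refl
  shift-cong (suc k) p (suc n) = shift-cong k p n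

  shift-+ : ∀ j k f → shift (j ℕ.+ k) f ≗ shift j (shift k f)
  shift-+ zero    k f n       = refl
  shift-+ (suc j) k f zero    = refl
  shift-+ (suc j) k f (suc n) = shift-+ j k f n

  shift-below : ∀ k f n → n ℕ.< k → shift k f n ≡ 0ℚ
  shift-below (suc k) f zero    _         = refl
  shift-below (suc k) f (suc n) (s≤s n<k) = shift-below k f n n<k

  shift-at : ∀ k f → shift k f k ≡ f 0
  shift-at zero    f = refl
  shift-at (suc k) f = shift-at k f

  shift-drop : ∀ k f → (∀ i → i ℕ.< k → f i ≡ 0ℚ) → f ≗ shift k (f ∘ (ℕ._+ k))
  shift-drop zero    f z n       = cong f (sym (ℕ.+-identityʳ n))
  shift-drop (suc k) f z zero    = z 0 (s≤s z≤n)
  shift-drop (suc k) f z (suc n) = trans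
    (shift-drop k (tail f) (λ i i<k → z (suc i) (s≤s i<k)) n)
    (shift-cong k (λ i → cong f (sym (ℕ.+-suc i k))) n)

  shift-*ˡ : ∀ k f g → shift k f * g ≗ shift k (f * g)
  shift-*ˡ zero    f g n       = refl
  shift-*ˡ (suc k) f g zero    = ℚ.*-zeroˡ (g 0)
  shift-*ˡ (suc k) f g (suc n) = trans
    (cong₂ ℚ._+_ (ℚ.*-zeroˡ (g (suc n))) (shift-*ˡ k f g n)) (ℚ.+-identityˡ _)

  shift₁-*ʳ : ∀ f g → f * shift 1 g ≗ shift 1 (f * g)
  shift₁-*ʳ f g zero          = ℚ.*-zeroʳ (f 0)
  shift₁-*ʳ f g (suc zero)    = trans
    (cong (f 0 ℚ.* g 0 ℚ.+_) (shift₁-*ʳ (tail f) g 0)) (ℚ.+-identityʳ _)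
  shift₁-*ʳ f g (suc (suc n)) =
    cong (f 0 ℚ.* g (suc n) ℚ.+_) (shift₁-*ʳ (tail f) g (suc n))

  shift-*ʳ : ∀ k f g → f * shift k g ≗ shift k (f * g)
  shift-*ʳ zero    f g n = refl
  shift-*ʳ (suc k) f g n = begin
    (f * shift (suc k) g) n        ≡⟨ *-cong {f} (λ _ → refl) (shift-+ 1 k g) n ⟩
    (f * shift 1 (shift k g)) n    ≡⟨ shift₁-*ʳ f (shift k g) n ⟩
    shift 1 (f * shift k g) n      ≡⟨ shift-cong 1 (shift-*ʳ k f g) n ⟩
    shift 1 (shift k (f * g)) n    ≡⟨ shift-+ 1 k (f * g) n ⟨
    shift (suc k) (f * g) n        ∎
    where open ≡-Reasoning

  *-distribʳ-+ : ∀ f g h → (f + g) * h ≗ (f * h) + (g * h)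
  *-distribʳ-+ f g h zero    = ℚ.*-distribʳ-+ (h 0) (f 0) (g 0)
  *-distribʳ-+ f g h (suc n) = trans
    (cong ((f 0 ℚ.+ g 0) ℚ.* h (suc n) ℚ.+_) (*-distribʳ-+ (tail f) (tail g) h n))
    (trans (cong (ℚ._+ ((tail f * h) n ℚ.+ (tail g * h) n)) (ℚ.*-distribʳ-+ (h (suc n)) (f 0) (g 0)))
      (interchange (f 0 ℚ.* h (suc n)) (g 0 ℚ.* h (suc n)) ((tail f * h) n) ((tail g * h) n)))

  *-distribˡ-+ : ∀ f g h → f * (g + h) ≗ (f * g) + (f * h)
  *-distribˡ-+ f g h zero    = ℚ.*-distribˡ-+ (f 0) (g 0) (h 0)
  *-distribˡ-+ f g h (suc n) = trans
    (cong (f 0 ℚ.* (g (suc n) ℚ.+ h (suc n)) ℚ.+_) (*-distribˡ-+ (tail f) g h n))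
    (trans (cong (ℚ._+ ((tail f * g) n ℚ.+ (tail f * h) n)) (ℚ.*-distribˡ-+ (f 0) (g (suc n)) (h (suc n))))
      (interchange (f 0 ℚ.* g (suc n)) (f 0 ℚ.* h (suc n)) ((tail f * g) n) ((tail f * h) n)))

  module _ (u : PowerSeries) {{u₀≢0 : ℚ.NonZero (u 0)}} where

    dot-recips : ∀ f n → dot u f (recips u n) ≡ (f * recip u) n
    dot-recips f zero    = ℚ.+-identityʳ _
    dot-recips f (suc n) = cong (f 0 ℚ.* recip u (suc n) ℚ.+_) (dot-recips (tail f) n)

    recip-inverse : u * recip u ≗ const 1ℚ
    recip-inverse zero    = ℚ.*-inverseʳ (u 0)
    recip-inverse (suc n) = begin
      u 0 ℚ.* ℚ.- (r ℚ.* d) ℚ.+ (tail u * recip u) n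
        ≡⟨ cong (u 0 ℚ.* ℚ.- (r ℚ.* d) ℚ.+_) (dot-recips (tail u) n) ⟨
      u 0 ℚ.* ℚ.- (r ℚ.* d) ℚ.+ d
        ≡⟨ solve (suc (suc (suc zero))) (λ a b c → a :* (:- (b :* c)) :+ c := :- ((a :* b) :* c) :+ c) refl (u 0) r d ⟩
      ℚ.- ((u 0 ℚ.* r) ℚ.* d) ℚ.+ d
        ≡⟨ cong (λ t → ℚ.- (t ℚ.* d) ℚ.+ d) (ℚ.*-inverseʳ (u 0)) ⟩
      ℚ.- (1ℚ ℚ.* d) ℚ.+ d
        ≡⟨ cong (λ t → ℚ.- t ℚ.+ d) (ℚ.*-identityˡ d) ⟩
      ℚ.- d ℚ.+ d
        ≡⟨ ℚ.+-inverseˡ d ⟩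
      0ℚ ∎
      where
      open ≡-Reasoning
      open ℚ-Solver.+-*-Solver using (solve; _:=_; _:+_; _:*_; :-_; _:-_; con)
      r d : ℚ
      r = ℚ.1/ u 0
      d = dot u (tail u) (recips u n)

open PowerSeriesProperties

⁻¹-inverse : ∀ a {{_ : NonZero a}} → a *ᴸ a ⁻¹ ≈ 1ᴸ
⁻¹-inverse (x^- m · f) {{a≢0}} n = begin
  (f * shift m v) n                  ≡⟨ shift-*ʳ m f v n ⟩
  shift m (f * v) n                  ≡⟨ shift-cong m (*-cong {g = v} (shift-drop k f below) (λ _ → refl)) n ⟩
  shift m (shift k u * v) n          ≡⟨ shift-cong m (shift-*ˡ k u v) n ⟩
  shift m (shift k (u * v)) n        ≡⟨ shift-cong m (shift-cong k (recip-inverse u {{leading}})) n ⟩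
  shift m (shift k (const 1ℚ)) n     ≡⟨ shift-+ m k (const 1ℚ) n ⟨
  shift (m ℕ.+ k) (const 1ℚ) n       ∎
  where
  open ≡-Reasoning
  open NonZero a≢0 renaming (order to k)
  u v : PowerSeries
  u = f ∘ (ℕ._+ k)
  v = recip u {{leading}}

module _ (c : PowerSeries) (c₀≡1 : c 0 ≡ 1ℚ) where

  private
    s : ℕ → PowerSeries
    s = sqrtApprox c

    step : ∀ n i → i ℕ.≤ n → s (suc n) i ≡ s n i
    step n i i≤n = trans (cong (s n i ℚ.+_) (shift-below (suc n) _ i (s≤s i≤n))) (ℚ.+-identityʳ _)

    stable : ∀ {i n} → i ℕ.≤′ n → s n i ≡ (√ c) i
    stable             (ℕ.≤′-reflexive refl) = refl
    stable {i} {suc n} (ℕ.≤′-step i≤n)       = trans (step n i (ℕ.≤′⇒≤ i≤n)) (stable i≤n)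

    s-constant : ∀ n → s n 0 ≡ 1ℚ
    s-constant n = stable {0} {n} (ℕ.≤⇒≤′ z≤n)

  √-square : √ c * √ c ≗ c
  √-square zero    = sym c₀≡1
  √-square (suc n) = begin
    (√ c * √ c) (suc n)                       ≡⟨ agree-* (suc n) agree agree ⟩
    ((p + q) * (p + q)) (suc n)               ≡⟨ *-distribʳ-+ p q (p + q) (suc n) ⟩
    (p * (p + q)) (suc n) ℚ.+ (q * (p + q)) (suc n)
      ≡⟨ cong₂ ℚ._+_ (trans (*-distribˡ-+ p p q (suc n)) (cong (pp ℚ.+_) pq)) q[p+q] ⟩
    (pp ℚ.+ e) ℚ.+ e
      ≡⟨ solve (suc (suc zero)) (λ x y → (x :+ con ½ :* (y :- x)) :+ con ½ :* (y :- x) := y) refl pp (c (suc n)) ⟩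
    c (suc n)                                 ∎
    where
    open ≡-Reasoning
    open ℚ-Solver.+-*-Solver using (solve; _:=_; _:+_; _:*_; :-_; _:-_; con)
    p q : PowerSeries
    pp e : ℚ
    p  = s n
    pp = (p * p) (suc n)
    e  = ½ ℚ.* (c (suc n) ℚ.- pp)
    q  = shift (suc n) (const e)

    agree : ∀ i → i ℕ.≤ suc n → (√ c) i ≡ s (suc n) i
    agree i i≤ = sym (stable (ℕ.≤⇒≤′ i≤))

    pq : (p * q) (suc n) ≡ e
    pq = begin
      (p * q) (suc n)                          ≡⟨ shift-*ʳ (suc n) p (const e) (suc n) ⟩
      shift (suc n) (p * const e) (suc n)      ≡⟨ shift-at (suc n) (p * const e) ⟩
      p 0 ℚ.* e                                ≡⟨ cong (ℚ._* e) (s-constant n) ⟩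
      1ℚ ℚ.* e                                 ≡⟨ ℚ.*-identityˡ e ⟩
      e                                        ∎

    q[p+q] : (q * (p + q)) (suc n) ≡ e
    q[p+q] = begin
      (q * (p + q)) (suc n)                      ≡⟨ shift-*ˡ (suc n) (const e) (p + q) (suc n) ⟩
      shift (suc n) (const e * (p + q)) (suc n)  ≡⟨ shift-at (suc n) (const e * (p + q)) ⟩
      e ℚ.* (p 0 ℚ.+ 0ℚ)                         ≡⟨ cong (e ℚ.*_) (trans (ℚ.+-identityʳ _) (s-constant n)) ⟩
      e ℚ.* 1ℚ                                   ≡⟨ ℚ.*-identityʳ e ⟩
      e                                          ∎

{-# OPTIONS --safe #-}

-- Read a permutation π from left to right and record at k the letter
--   U if π k, π⁻¹ k > k,    E if π⁻¹ k < k < π k,    F if π k = k,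
--   D if π k, π⁻¹ k < k,    A if π k < k < π⁻¹ k.
-- At any time equally many positions and values are pending, i.e. still
-- wait for their partner; their number is the level.  A permutation is
-- maximally clustered iff both kinds of pending elements are served
-- first in, first out and fixed points occur at levels 0 and 1 only, so
-- maximally clustered permutations correspond to Motzkin paths with two
-- kinds of level steps at positive level (E, A) and another one at levels
-- 0 and 1 (F).  Such a permutation contains 4231 iff its word has FF at
-- level 1, and it contains a hexagon iff its word has U, DU, EA or AE at
-- level 3.  Hence (2) and (3) count the words of a finite automaton.  In
-- (1), let V l be the series of words from level l ≥ 1 and V 0 that of
-- nonempty words from level 0, divided by x.  The Catalan series
-- C = 1 + x C² = (1 - √(1 - 4x)) / 2x satisfies C V l = V l + V (l + 1).
module Submission where

open import Data.Bool.Base using (Bool; true; false; T; if_then_else_)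
open import Data.Bool.Properties using (T?; T-irrelevant)
open import Data.Empty using (⊥)
open import Data.Fin.Base as Fin using (Fin; zero; suc; toℕ; fromℕ<; inject₁; punchIn; punchOut)
open import Data.Fin.Patterns
open import Data.Fin.Permutation
  using (Permutation′; _⟨$⟩ʳ_; _⟨$⟩ˡ_; id; flip; insert; remove; inverseˡ; inverseʳ;
         insert-punchIn; punchIn-permute)
import Data.Fin.Properties as Fin
open import Data.Integer.Base as ℤ using (ℤ)
import Data.Integer.Properties as ℤ
import Data.Integer.Solver as ℤ-Solver
open import Data.List.Base as List using (List; []; _∷_; _++_)
open import Data.List.Relation.Unary.All using ([]; _∷_)
import Data.List.Relation.Unary.All.Properties as All
open import Data.Maybe.Base using (Maybe; just; nothing)
open import Data.Nat.Base as ℕ using (ℕ; zero; suc; z≤n; s≤s)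
import Data.Nat.Properties as ℕ
import Data.Nat.Solver as ℕ-Solver
open import Data.Product.Base using (Σ; ∃; _×_; _,_; proj₁; proj₂; swap)
open import Data.Rational.Base as ℚ using (ℚ; 0ℚ; 1ℚ; ½)
open import Data.Rational.Literals using (fromℤ)
import Data.Rational.Properties as ℚ
import Data.Rational.Solver as ℚ-Solver
import Data.Rational.Unnormalised.Base as ℚᵘ
import Data.Rational.Unnormalised.Properties as ℚᵘ
open import Data.Sum.Base as Sum using (_⊎_; inj₁; inj₂; [_,_]′)
open import Data.Sum.Function.Propositional using (_⊎-↔_)
open import Data.Unit.Base using (⊤; tt)
open import Data.Vec.Base as Vec using (Vec; []; _∷_)
open import Function.Base using (_∘_)
open import Function.Bundles using (Equivalence; Inverse; _↔_; mk⇔; mk↔ₛ′)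
open import Function.Properties.Inverse using (↔-trans)
open import Relation.Binary.Definitions using (Tri; tri<; tri≈; tri>)
open import Relation.Binary.PropositionalEquality
open import Relation.Nullary using (¬_; Dec; yes; no; contradiction)
open import Relation.Nullary.Decidable using (True; toWitness; _→-dec_; _×-dec_; _⊎-dec_)
open import Defs
open PowerSeriesProperties

-- The three patterns say exactly that the middle point of a decreasing triple is the middle of no
-- other triple (`Clustered`). A fixed point at level l has l larger values before it and l smaller
-- ones after it, hence l ≤ 1. The four forbidden words at level 3 match the four hexagon patterns:
-- U yields 56781234, EA yields 46781235, AE its inverse 56718234, and DU the self-inverse 46718235.
-- Deleting finished points leaves the level as the only coordinate that a letter refers to, but a
-- pattern may then straddle deleted and remaining points. Two devices repair this. To show that
-- accepted words avoid, the residues of a broken pattern (`HexagonE`, `HexagonD`, `HalfBraid`) are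
-- followed along the word; to show that avoiders are accepted, `Before` keeps the permutation from
-- before the last letter. In (1) the levels are unbounded, so no finite transfer matrix is
-- available; the relation with C is proved for all levels at once, one coefficient after another.

private variable
  N n l p v : ℕ

-- Deleting a point of a permutation

punchIn-below : ∀ (i : Fin (suc N)) k → k Fin.< i → toℕ (punchIn i k) ≡ toℕ k
punchIn-below (suc i) zero    _       = refl
punchIn-below (suc i) (suc k) (s≤s p) = cong suc (punchIn-below i k p)

punchIn-above : ∀ (i : Fin (suc N)) k → i Fin.≤ k → toℕ (punchIn i k) ≡ suc (toℕ k)
punchIn-above zero    k       _       = refl
punchIn-above (suc i) (suc k) (s≤s p) = cong suc (punchIn-above i k p)

punchIn-≥ : ∀ (i : Fin (suc N)) k → toℕ k ℕ.≤ toℕ (punchIn i k)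
punchIn-≥ zero    k       = ℕ.n≤1+n _
punchIn-≥ (suc i) zero    = z≤n
punchIn-≥ (suc i) (suc k) = s≤s (punchIn-≥ i k)

punchIn-≤ : ∀ (i : Fin (suc N)) k → toℕ (punchIn i k) ℕ.≤ suc (toℕ k)
punchIn-≤ zero    k       = ℕ.≤-refl
punchIn-≤ (suc i) zero    = z≤n
punchIn-≤ (suc i) (suc k) = s≤s (punchIn-≤ i k)

punchIn-mono-< : ∀ (i : Fin (suc N)) {k m} → k Fin.< m → punchIn i k Fin.< punchIn i m
punchIn-mono-< i {k} {m} k<m = ℕ.≰⇒> (ℕ.<⇒≱ k<m ∘ Fin.punchIn-cancel-≤ i m k)

punchIn-cancel-< : ∀ (i : Fin (suc N)) {k m} → punchIn i k Fin.< punchIn i m → k Fin.< m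
punchIn-cancel-< i {k} {m} k<m = ℕ.≰⇒> (ℕ.<⇒≱ k<m ∘ Fin.punchIn-mono-≤ i m k)

data View (i : Fin (suc N)) : Fin (suc N) → Set where
  hit  : View i i
  miss : ∀ k → View i (punchIn i k)

view : ∀ (i k : Fin (suc N)) → View i k
view i k with i Fin.≟ k
... | yes refl = hit
... | no  i≢k  = subst (View i) (Fin.punchIn-punchOut i≢k) (miss (punchOut i≢k))

-- A relation instead of the functions `remove` and `insert`: it is symmetric under `flip`, both
-- functions provide witnesses, and either permutation determines the other up to pointwise
-- equality.
record Delete (i j : Fin (suc N)) (σ : Permutation′ (suc N)) (σ′ : Permutation′ N) : Set where
  field
    at  : σ ⟨$⟩ʳ i ≡ j
    off : ∀ k → σ ⟨$⟩ʳ punchIn i k ≡ punchIn j (σ′ ⟨$⟩ʳ k)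

open Delete

permute-flip : ∀ (σ : Permutation′ N) {i j} → σ ⟨$⟩ʳ i ≡ j → σ ⟨$⟩ˡ j ≡ i
permute-flip σ refl = inverseˡ σ

flip-permute : ∀ (σ : Permutation′ N) {i j} → σ ⟨$⟩ˡ j ≡ i → σ ⟨$⟩ʳ i ≡ j
flip-permute σ refl = inverseʳ σ

permute-injective : ∀ (σ : Permutation′ N) {i j} → σ ⟨$⟩ʳ i ≡ σ ⟨$⟩ʳ j → i ≡ j
permute-injective σ p = trans (sym (inverseˡ σ)) (trans (cong (σ ⟨$⟩ˡ_) p) (inverseˡ σ))

Delete-flip : ∀ {i j} {σ : Permutation′ (suc N)} {σ′} →
              Delete i j σ σ′ → Delete j i (flip σ) (flip σ′)
Delete-flip {σ = σ} d .at = permute-flip σ (at d)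
Delete-flip {i = i} {j} {σ} {σ′} d .off k =
  permute-flip σ (trans (off d (σ′ ⟨$⟩ˡ k)) (cong (punchIn j) (inverseʳ σ′)))

Delete-remove : ∀ {i j} (σ : Permutation′ (suc N)) → σ ⟨$⟩ʳ i ≡ j → Delete i j σ (remove i σ)
Delete-remove {i = i} σ refl = record { at = refl ; off = punchIn-permute σ i }

Delete-insert : ∀ i j (σ : Permutation′ N) → Delete i j (insert i j σ) σ
Delete-insert i j σ = record { at = at-insert ; off = insert-punchIn i j σ }
  where
  at-insert : insert i j σ ⟨$⟩ʳ i ≡ j
  at-insert with i Fin.≟ i
  ... | yes _   = refl
  ... | no  i≢i = contradiction refl i≢i

module _ {i j} {σ ρ : Permutation′ (suc N)} {σ′ ρ′ : Permutation′ N}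
         (d : Delete i j σ σ′) (e : Delete i j ρ ρ′) where

  Delete-cong : σ′ ⟨$⟩ʳ_ ≗ ρ′ ⟨$⟩ʳ_ → σ ⟨$⟩ʳ_ ≗ ρ ⟨$⟩ʳ_
  Delete-cong p k with view i k
  ... | hit    = trans (at d) (sym (at e))
  ... | miss m = trans (off d m) (trans (cong (punchIn j) (p m)) (sym (off e m)))

  Delete-cancel : σ ⟨$⟩ʳ_ ≗ ρ ⟨$⟩ʳ_ → σ′ ⟨$⟩ʳ_ ≗ ρ′ ⟨$⟩ʳ_
  Delete-cancel p k = Fin.punchIn-injective j _ _
    (trans (sym (off d k)) (trans (p (punchIn i k)) (off e k)))

module _ {i j} {σ : Permutation′ (suc N)} {σ′ : Permutation′ N} (d : Delete i j σ σ′) where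

  value-mono : ∀ {k m} → σ′ ⟨$⟩ʳ k Fin.< σ′ ⟨$⟩ʳ m →
               σ ⟨$⟩ʳ punchIn i k Fin.< σ ⟨$⟩ʳ punchIn i m
  value-mono {k} {m} lt rewrite off d k | off d m = punchIn-mono-< j lt

  value-cancel : ∀ {k m} → σ ⟨$⟩ʳ punchIn i k Fin.< σ ⟨$⟩ʳ punchIn i m →
                 σ′ ⟨$⟩ʳ k Fin.< σ′ ⟨$⟩ʳ m
  value-cancel {k} {m} lt rewrite off d k | off d m = punchIn-cancel-< j lt

  value-≥ : ∀ k → toℕ (σ′ ⟨$⟩ʳ k) ℕ.≤ toℕ (σ ⟨$⟩ʳ punchIn i k)
  value-≥ k rewrite off d k = punchIn-≥ j _

  value-≤ : ∀ k → toℕ (σ ⟨$⟩ʳ punchIn i k) ℕ.≤ suc (toℕ (σ′ ⟨$⟩ʳ k))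
  value-≤ k rewrite off d k = punchIn-≤ j _

  value-above : ∀ k → toℕ j ℕ.≤ toℕ (σ′ ⟨$⟩ʳ k) →
                toℕ (σ ⟨$⟩ʳ punchIn i k) ≡ suc (toℕ (σ′ ⟨$⟩ʳ k))
  value-above k j≤ rewrite off d k = punchIn-above j _ j≤

  value-bound : ∀ k → v ℕ.≤ toℕ j → v ℕ.≤ toℕ (σ ⟨$⟩ʳ punchIn i k) → v ℕ.≤ toℕ (σ′ ⟨$⟩ʳ k)
  value-bound k v≤j v≤ with ℕ.<-≤-connex (toℕ (σ′ ⟨$⟩ʳ k)) (toℕ j)
  ... | inj₂ j≤ = ℕ.≤-trans v≤j j≤
  ... | inj₁ <j rewrite off d k | punchIn-below j _ <j = v≤

-- Pending positions

Above : ℕ → ℕ → Permutation′ N → Set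
Above p v σ = ∀ i → toℕ i ℕ.< p → v ℕ.≤ toℕ (σ ⟨$⟩ʳ i)

Increasing : ℕ → Permutation′ N → Set
Increasing p σ = ∀ i k → i Fin.< k → toℕ k ℕ.< p → σ ⟨$⟩ʳ i Fin.< σ ⟨$⟩ʳ k

-- Holding for `σ` and `flip σ` with p = v = l, this is the invariant of a run: the bound makes the
-- elements pending, the order is first in, first out. The two numbers are separate because they
-- differ halfway through a letter.
record Rising (p v : ℕ) (σ : Permutation′ N) : Set where
  constructor rising
  field
    above      : Above p v σ
    increasing : Increasing p σ

open Rising

Rising-weaken : ∀ {p p′ v v′} {σ : Permutation′ N} → p′ ℕ.≤ p → v′ ℕ.≤ v →
                Rising p v σ → Rising p′ v′ σ
Rising-weaken p′≤p v′≤v (rising a c) = rising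
  (λ i i<p → ℕ.≤-trans v′≤v (a i (ℕ.<-≤-trans i<p p′≤p)))
  (λ i k i<k k<p → c i k i<k (ℕ.<-≤-trans k<p p′≤p))

module _ {i j} {σ : Permutation′ (suc N)} {σ′ : Permutation′ N} (d : Delete i j σ σ′) where

  Increasing-keep : p ℕ.≤ toℕ i → Increasing p σ′ → Increasing p σ
  Increasing-keep p≤i c k m k<m m<p with view i k | view i m
  ... | _       | hit     = contradiction p≤i (ℕ.<⇒≱ m<p)
  ... | hit     | miss m′ = contradiction p≤i (ℕ.<⇒≱ (ℕ.<-trans k<m m<p))
  ... | miss k′ | miss m′ = value-mono d
    (c k′ m′ (punchIn-cancel-< i k<m) (ℕ.≤-<-trans (punchIn-≥ i m′) m<p))

  Rising-keep : p ℕ.≤ toℕ i → Rising p v σ′ → Rising p v σ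
  Rising-keep {p} {v} p≤i (rising a c) = rising a′ (Increasing-keep p≤i c)
    where
    a′ : Above p v σ
    a′ k k<p with view i k
    ... | hit     = contradiction p≤i (ℕ.<⇒≱ k<p)
    ... | miss k′ = ℕ.≤-trans (a k′ (ℕ.≤-<-trans (punchIn-≥ i k′) k<p)) (value-≥ d k′)

  -- Since `j` is at most `v`, inserting the value `j` pushes every value that is at least `v` up by
  -- one.
  Rising-raise : p ℕ.≤ toℕ i → toℕ j ℕ.≤ v → Rising p v σ′ → Rising p (suc v) σ
  Rising-raise {p} {v} p≤i j≤v (rising a c) = rising a′ (Increasing-keep p≤i c)
    where
    a′ : Above p (suc v) σ
    a′ k k<p with view i k
    ... | hit     = contradiction p≤i (ℕ.<⇒≱ k<p)
    ... | miss k′ rewrite value-above d k′ (ℕ.≤-trans j≤v (a k′ (ℕ.≤-<-trans (punchIn-≥ i k′) k<p)))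
      = s≤s (a k′ (ℕ.≤-<-trans (punchIn-≥ i k′) k<p))

-- The values from `v` on make room for the new one, so the new first position carries the least of
-- the pending positions' values.
Rising-front : ∀ {j} {σ : Permutation′ (suc N)} {σ′} → Delete zero j σ σ′ → toℕ j ≡ v →
               Rising p v σ′ → Rising (suc p) v σ
Rising-front {v = v} {p} {j} {σ} {σ′} d refl (rising a c) = rising a′ c′
  where
  late : ∀ k → toℕ k ℕ.< p → v ℕ.< toℕ (σ ⟨$⟩ʳ suc k)
  late k k<p rewrite value-above d k (a k k<p) = s≤s (a k k<p)
  a′ : Above (suc p) v σ
  a′ zero    _         rewrite at d = ℕ.≤-refl
  a′ (suc k) (s≤s k<p) = ℕ.<⇒≤ (late k k<p)
  c′ : Increasing (suc p) σ
  c′ zero    (suc m) _         (s≤s m<p) rewrite at d = late m m<p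
  c′ (suc k) (suc m) (s≤s k<m) (s≤s m<p) = value-mono d (c k m k<m m<p)

-- Runs

data Step : Set where
  U E A D F : Step

-- Points are deleted as soon as both coordinates have been scanned, so the
-- l pending positions and the l pending values are always the first ones,
-- and the next letter concerns position and value l.  First in, first out
-- means that E and D delete the point at position 0, and that A and D
-- delete the point of value 0.
data Run : ℕ → Permutation′ N → Vec Step n → Set where
  end : {σ : Permutation′ 0} → Run 0 σ []
  up : ∀ {σ : Permutation′ N} {w : Vec Step n} →
       Run (suc l) σ w → Run l σ (U ∷ w)
  exc : ∀ {j} {σ : Permutation′ (suc N)} {σ′} {w : Vec Step n} →
        Delete zero j σ σ′ → toℕ j ≡ suc l →
        Run (suc l) σ′ w → Run (suc l) σ (E ∷ w)
  anti : ∀ {i} {σ : Permutation′ (suc N)} {σ′} {w : Vec Step n} →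
         Delete i zero σ σ′ → toℕ i ≡ suc l →
         Run (suc l) σ′ w → Run (suc l) σ (A ∷ w)
  down : ∀ {j i} {σ : Permutation′ (suc (suc N))} {σ′ σ″} {w : Vec Step n} →
         Delete zero j σ σ′ → toℕ j ≡ suc l →
         Delete i zero σ′ σ″ → toℕ i ≡ l →
         Run l σ″ w → Run (suc l) σ (D ∷ w)
  fix : ∀ {i} {σ : Permutation′ (suc N)} {σ′} {w : Vec Step n} →
        Delete i i σ σ′ → toℕ i ≡ l → l ℕ.≤ 1 →
        Run l σ′ w → Run l σ (F ∷ w)

module _ {i j l} {σ : Permutation′ (suc (suc N))} {σ′ σ″}
         (d : Delete zero j σ σ′) (j≡ : toℕ j ≡ suc l)
         (e : Delete i zero σ′ σ″) (i≡ : toℕ i ≡ l) where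

  -- Between its two deletions a descent has l pending positions but still l + 1 pending values.
  down-middle : Rising l l σ″ × Rising l l (flip σ″) →
                Rising l (suc l) σ′ × Rising (suc l) l (flip σ′)
  down-middle (r , s) = Rising-raise e (ℕ.≤-reflexive (sym i≡)) z≤n r ,
                        Rising-front (Delete-flip e) i≡ s

  down-rising : Rising l l σ″ × Rising l l (flip σ″) →
                Rising (suc l) (suc l) σ × Rising (suc l) (suc l) (flip σ)
  down-rising rs with r , s ← down-middle rs =
    Rising-front d j≡ r , Rising-raise (Delete-flip d) (ℕ.≤-reflexive (sym j≡)) z≤n s

exc-rising : ∀ {j} {σ : Permutation′ (suc N)} {σ′} → Delete zero j σ σ′ → toℕ j ≡ suc l →
             Rising (suc l) (suc l) σ′ × Rising (suc l) (suc l) (flip σ′) →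
             Rising (suc (suc l)) (suc l) σ × Rising (suc l) (suc (suc l)) (flip σ)
exc-rising d j≡ (r , s) =
  Rising-front d j≡ r , Rising-raise (Delete-flip d) (ℕ.≤-reflexive (sym j≡)) z≤n s

-- Established from the end of the run, where the permutation is empty; each letter then reinserts
-- its points.
run-rising : ∀ {σ : Permutation′ N} {w : Vec Step n} → Run l σ w →
             Rising l l σ × Rising l l (flip σ)
run-rising end = rising (λ ()) (λ ()) , rising (λ ()) (λ ())
run-rising {l = l} (up r) with x , y ← run-rising r =
  Rising-weaken (ℕ.n≤1+n l) (ℕ.n≤1+n l) x , Rising-weaken (ℕ.n≤1+n l) (ℕ.n≤1+n l) y
run-rising (exc d j≡ r) with x , y ← exc-rising d j≡ (run-rising r) =
  Rising-weaken (ℕ.n≤1+n _) ℕ.≤-refl x , Rising-weaken ℕ.≤-refl (ℕ.n≤1+n _) y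
run-rising (anti d i≡ r) with y , x ← exc-rising (Delete-flip d) i≡ (swap (run-rising r)) =
  Rising-weaken ℕ.≤-refl (ℕ.n≤1+n _) x , Rising-weaken (ℕ.n≤1+n _) ℕ.≤-refl y
run-rising (down d j≡ e i≡ r) = down-rising d j≡ e i≡ (run-rising r)
run-rising (fix d i≡ _ r) with x , y ← run-rising r =
  Rising-keep d (ℕ.≤-reflexive (sym i≡)) x ,
  Rising-keep (Delete-flip d) (ℕ.≤-reflexive (sym i≡)) y

-- Maximally clustered permutations

Inv : Permutation′ N → Fin N → Fin N → Set
Inv σ i j = i Fin.< j × σ ⟨$⟩ʳ j Fin.< σ ⟨$⟩ʳ i

-- For a middle point `j`, two larger predecessors form 3421 or 4321, and two smaller successors
-- form 4312 or 4321.
OneBefore OneAfter Clustered : Permutation′ N → Set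
OneBefore σ = ∀ i i′ j k → Inv σ i j → Inv σ i′ j → Inv σ j k → i ≡ i′
OneAfter  σ = ∀ i j k k′ → Inv σ i j → Inv σ j k → Inv σ j k′ → k ≡ k′
Clustered σ = OneBefore σ × OneAfter σ

Inv-flip : ∀ (σ : Permutation′ N) {i j} → Inv (flip σ) i j → Inv σ (σ ⟨$⟩ˡ j) (σ ⟨$⟩ˡ i)
Inv-flip σ (i<j , lt) = lt , subst₂ Fin._<_ (sym (inverseʳ σ)) (sym (inverseʳ σ)) i<j

-- Inversion reverses decreasing triples; it exchanges 3421 with 4312 and fixes 4321.
OneAfter-flip : ∀ {σ : Permutation′ N} → OneAfter σ → OneBefore (flip σ)
OneAfter-flip {σ = σ} a i i′ j k ij i′j jk = permute-injective (flip σ)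
  (a _ _ _ _ (Inv-flip σ jk) (Inv-flip σ ij) (Inv-flip σ i′j))

OneBefore-flip : ∀ {σ : Permutation′ N} → OneBefore σ → OneAfter (flip σ)
OneBefore-flip {σ = σ} b i j k k′ ij jk jk′ = permute-injective (flip σ)
  (b _ _ _ _ (Inv-flip σ jk) (Inv-flip σ jk′) (Inv-flip σ ij))

Clustered-flip : ∀ {σ : Permutation′ N} → Clustered σ → Clustered (flip σ)
Clustered-flip {σ = σ} (b , a) = OneAfter-flip {σ = σ} a , OneBefore-flip {σ = σ} b

module _ {i j} {σ : Permutation′ (suc N)} {σ′ : Permutation′ N} (d : Delete i j σ σ′) where

  Inv-off : ∀ {k m} → Inv σ′ k m → Inv σ (punchIn i k) (punchIn i m)
  Inv-off (k<m , lt) = punchIn-mono-< i k<m , value-mono d lt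

  Inv-cancel : ∀ {k m} → Inv σ (punchIn i k) (punchIn i m) → Inv σ′ k m
  Inv-cancel (k<m , lt) = punchIn-cancel-< i k<m , value-cancel d lt

  Clustered-delete : Clustered σ → Clustered σ′
  Clustered-delete (b , a) =
    (λ k k′ m o x y z → Fin.punchIn-injective i _ _
      (b _ _ _ _ (Inv-off x) (Inv-off y) (Inv-off z))) ,
    (λ k m o o′ x y z → Fin.punchIn-injective i _ _
      (a _ _ _ _ (Inv-off x) (Inv-off y) (Inv-off z)))

-- The values below `v` occur from left to right in increasing order, so none of them has a smaller
-- value behind it.
noInv-low : ∀ {σ : Permutation′ N} → Increasing v (flip σ) →
            ∀ {j k} → toℕ (σ ⟨$⟩ʳ j) ℕ.< v → ¬ Inv σ j k
noInv-low {σ = σ} c {j} {k} j<v (j<k , lt) =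
  ℕ.<-asym j<k (subst₂ Fin._<_ (inverseˡ σ) (inverseˡ σ) (c _ _ lt j<v))

module _ {v j} {σ : Permutation′ (suc N)} {σ′ : Permutation′ N}
         (d : Delete zero j σ σ′) (j≡ : toℕ j ≡ v) (c : Increasing v (flip σ)) where

  noInv-front : ∀ {m k} → Inv σ zero m → ¬ Inv σ m k
  noInv-front (_ , lt) = noInv-low {σ = σ} c (ℕ.<-≤-trans lt (ℕ.≤-reflexive (trans (cong toℕ (at d)) j≡)))

  -- A point at position 0 could only be the first of a decreasing triple, and `noInv-front`
  -- excludes that too, so no new triple arises.
  Clustered-front : Clustered σ′ → Clustered σ
  Clustered-front (b , a) = b′ , a′
    where
    b′ : OneBefore σ
    b′ zero    _        _       _       x y z = contradiction z (noInv-front x)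
    b′ (suc _) zero     _       _       x y z = contradiction z (noInv-front y)
    b′ (suc i) (suc i′) (suc j) (suc k) x y z =
      cong suc (b i i′ j k (Inv-cancel d x) (Inv-cancel d y) (Inv-cancel d z))
    b′ (suc _) (suc _)  (suc _) zero    x y (() , _)
    a′ : OneAfter σ
    a′ zero    _       _       _        x y z = contradiction y (noInv-front x)
    a′ (suc i) (suc j) (suc k) (suc k′) x y z =
      cong suc (a i j k k′ (Inv-cancel d x) (Inv-cancel d y) (Inv-cancel d z))
    a′ (suc _) (suc _) zero    _        x (() , _) z
    a′ (suc _) (suc _) (suc _) zero     x y (() , _)

below-1 : ∀ {i k : Fin N} → toℕ i ℕ.≤ 1 → k Fin.< i → toℕ k ≡ 0
below-1 i≤1 k<i = ℕ.n≤0⇒n≡0 (ℕ.s≤s⁻¹ (ℕ.<-≤-trans k<i i≤1))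

not-below-1 : ∀ {i j k : Fin N} → toℕ i ℕ.≤ 1 → k Fin.< i → ¬ j Fin.< k
not-below-1 i≤1 k<i j<k rewrite below-1 i≤1 k<i with () ← j<k

module _ {i} {σ : Permutation′ (suc N)} {σ′ : Permutation′ N}
         (d : Delete i i σ σ′) (i≤1 : toℕ i ℕ.≤ 1) where

  -- A fixed point at most 1 has at most one position before it and at most one value below it. As a
  -- middle point it has a unique predecessor; as first or last point of a triple it would need two
  -- values below or two positions before.
  fix-before : OneBefore σ′ → OneBefore σ
  fix-before b k k′ m o x y z with view i m
  fix-before b k k′ _ o x y z | hit =
    Fin.toℕ-injective (trans (below-1 i≤1 (proj₁ x)) (sym (below-1 i≤1 (proj₁ y))))
  fix-before b k k′ _ o x y z | miss m with view i k | view i k′ | view i o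
  ... | hit    | _       | _      =
    contradiction (proj₂ z) (not-below-1 i≤1 (subst (σ ⟨$⟩ʳ punchIn i m Fin.<_) (at d) (proj₂ x)))
  ... | miss _ | hit     | _      =
    contradiction (proj₂ z) (not-below-1 i≤1 (subst (σ ⟨$⟩ʳ punchIn i m Fin.<_) (at d) (proj₂ y)))
  ... | miss _ | miss _  | hit    = contradiction (proj₁ x) (not-below-1 i≤1 (proj₁ z))
  ... | miss k | miss k′ | miss o =
    cong (punchIn i) (b k k′ m o (Inv-cancel d x) (Inv-cancel d y) (Inv-cancel d z))

Clustered-fix : ∀ {i} {σ : Permutation′ (suc N)} {σ′} → Delete i i σ σ′ → toℕ i ℕ.≤ 1 →
                Clustered σ′ → Clustered σ
Clustered-fix {σ = σ} {σ′} d i≤1 (b , a) =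
  fix-before d i≤1 b ,
  OneBefore-flip {σ = flip σ} (fix-before (Delete-flip d) i≤1 (OneAfter-flip {σ = σ′} a))

run-clustered : ∀ {σ : Permutation′ N} {w : Vec Step n} → Run l σ w → Clustered σ
run-clustered end = (λ ()) , (λ ())
run-clustered (up r) = run-clustered r
run-clustered (exc d j≡ r) =
  Clustered-front d j≡ (increasing (proj₂ (run-rising (exc d j≡ r)))) (run-clustered r)
run-clustered (anti {σ = σ} {σ′} d i≡ r) = Clustered-flip {σ = flip σ}
  (Clustered-front (Delete-flip d) i≡ (increasing (proj₁ (run-rising (anti d i≡ r))))
    (Clustered-flip {σ = σ′} (run-clustered r)))
run-clustered (down {σ = σ} {σ′} {σ″} d j≡ e i≡ r) =
  Clustered-front d j≡ (increasing (proj₂ (run-rising (down d j≡ e i≡ r))))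
    (Clustered-flip {σ = flip σ′}
      (Clustered-front (Delete-flip e) i≡ (increasing (proj₁ (down-middle d j≡ e i≡ (run-rising r))))
        (Clustered-flip {σ = σ″} (run-clustered r))))
run-clustered (fix d i≡ l≤1 r) =
  Clustered-fix d (subst (ℕ._≤ 1) (sym i≡) l≤1) (run-clustered r)

-- Every maximally clustered permutation has a run

-- Only the bounds of `Rising` are carried while parsing; the order of service follows from
-- `Clustered` by `oldest`.
Pending : ℕ → Permutation′ N → Set
Pending l σ = Above l l σ × Above l l (flip σ)

module _ {i j} {σ : Permutation′ (suc N)} {σ′ : Permutation′ N} (d : Delete i j σ σ′) where

  Above-delete : ∀ {p p′ v} → (∀ k → toℕ k ℕ.< p′ → toℕ (punchIn i k) ℕ.< p) → v ℕ.≤ toℕ j →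
                 Above p v σ → Above p′ v σ′
  Above-delete p′<p v≤j a k k<p′ = value-bound d k v≤j (a _ (p′<p k k<p′))

  Above-lower : ∀ {p p′ v} → (∀ k → toℕ k ℕ.< p′ → toℕ (punchIn i k) ℕ.< p) →
                Above p (suc v) σ → Above p′ v σ′
  Above-lower p′<p a k k<p′ = ℕ.s≤s⁻¹ (ℕ.≤-trans (a _ (p′<p k k<p′)) (value-≤ d k))

keep-< : ∀ (i : Fin (suc N)) → p ℕ.≤ toℕ i → ∀ k → toℕ k ℕ.< p → toℕ (punchIn i k) ℕ.< p
keep-< i p≤i k k<p rewrite punchIn-below i k (ℕ.<-≤-trans k<p p≤i) = k<p

Above-extend : ∀ {σ : Permutation′ N} (c : Fin N) → Above (toℕ c) v σ → v ℕ.≤ toℕ (σ ⟨$⟩ʳ c) →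
               Above (suc (toℕ c)) v σ
Above-extend c a v≤ i i≤c with i Fin.≟ c
... | yes refl = v≤
... | no  i≢c  = a i (ℕ.≤∧≢⇒< (ℕ.s≤s⁻¹ i≤c) (i≢c ∘ Fin.toℕ-injective))

Above-strict : ∀ {σ : Permutation′ N} (c : Fin N) → p ℕ.≤ toℕ (σ ⟨$⟩ˡ c) →
               Above p (toℕ c) σ → Above p (suc (toℕ c)) σ
Above-strict {σ = σ} c p≤ a i i<p = ℕ.≤∧≢⇒< (a i i<p) λ c≡ →
  ℕ.<⇒≱ i<p (subst ((_ ℕ.≤_) ∘ toℕ) (permute-flip σ (sym (Fin.toℕ-injective c≡))) p≤)

module _ {σ : Permutation′ (suc N)} (c : Fin (suc N)) (cl : Clustered σ)
         (pσ : Pending (toℕ c) σ) where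

  private
    at< : ∀ {m} → m ℕ.< toℕ c → Fin (suc N)
    at< m<c = fromℕ< (ℕ.<-trans m<c (Fin.toℕ<n c))

    at<-toℕ : ∀ {m} (m<c : m ℕ.< toℕ c) → toℕ (at< m<c) ≡ m
    at<-toℕ m<c = Fin.toℕ-fromℕ< _

    at<-< : ∀ {m} (m<c : m ℕ.< toℕ c) → at< m<c Fin.< c
    at<-< m<c = subst (ℕ._< toℕ c) (sym (at<-toℕ m<c)) m<c

    at<-≢ : ∀ {m m′} (m<c : m ℕ.< toℕ c) (m′<c : m′ ℕ.< toℕ c) → m ≢ m′ → at< m<c ≢ at< m′<c
    at<-≢ m<c m′<c m≢m′ eq =
      m≢m′ (trans (sym (at<-toℕ m<c)) (trans (cong toℕ eq) (at<-toℕ m′<c)))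

  -- Above level 1, the pending positions 0 and 1 are two larger predecessors of the fixed point,
  -- and the pending value 0 is a smaller successor.
  fixed-low : σ ⟨$⟩ʳ c ≡ c → toℕ c ℕ.≤ 1
  fixed-low σc≡c = ℕ.≮⇒≥ λ 1<c →
    let 0<c = ℕ.<-trans (s≤s z≤n) 1<c
        before : ∀ {m} (m<c : m ℕ.< toℕ c) → Inv σ (at< m<c) c
        before m<c = at<-< m<c , ℕ.≤∧≢⇒<
          (subst (Fin._≤ σ ⟨$⟩ʳ at< m<c) (sym σc≡c) (proj₁ pσ _ (at<-< m<c)))
          (λ eq → Fin.<⇒≢ (at<-< m<c)
            (sym (permute-injective σ (Fin.toℕ-injective eq))))
        after : Inv σ c (σ ⟨$⟩ˡ at< 0<c)
        after = ℕ.≤∧≢⇒< (proj₂ pσ _ (at<-< 0<c))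
                  (λ eq → Fin.<⇒≢ (at<-< 0<c) (trans (sym (flip-permute σ (sym (Fin.toℕ-injective eq)))) σc≡c)) ,
                subst₂ Fin._<_ (sym (inverseʳ σ)) (sym σc≡c) (at<-< 0<c)
    in at<-≢ 0<c 1<c (λ ()) (proj₁ cl _ _ _ _ (before 0<c) (before 1<c) after)

  -- The pending position that takes the value c is the oldest one:
  -- otherwise it has the first position before it and two pending
  -- values after it.
  oldest : toℕ (σ ⟨$⟩ˡ c) ℕ.< toℕ c → σ ⟨$⟩ʳ zero ≡ c
  oldest x<c with σ ⟨$⟩ˡ c in eq
  ... | zero  = flip-permute σ eq
  ... | suc x = contradiction
      (proj₂ cl zero (suc x) _ _ before (after 0<c) (after 1<c))
      (at<-≢ 0<c 1<c (λ ()) ∘ permute-injective (flip σ))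
    where
    1<c : 1 ℕ.< toℕ c
    1<c = ℕ.≤-trans (s≤s (s≤s z≤n)) x<c
    0<c : 0 ℕ.< toℕ c
    0<c = ℕ.<-trans (s≤s z≤n) 1<c
    σx≡c : σ ⟨$⟩ʳ suc x ≡ c
    σx≡c = flip-permute σ eq
    before : Inv σ zero (suc x)
    before = s≤s z≤n , ℕ.≤∧≢⇒<
      (subst (Fin._≤ σ ⟨$⟩ʳ zero) (sym σx≡c) (proj₁ pσ zero 0<c))
      (λ e → Fin.0≢1+n (sym (permute-injective σ (Fin.toℕ-injective e))))
    after : ∀ {m} (m<c : m ℕ.< toℕ c) → Inv σ (suc x) (σ ⟨$⟩ˡ at< m<c)
    after m<c = ℕ.<-≤-trans x<c (proj₂ pσ _ (at<-< m<c)) ,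
                subst₂ Fin._<_ (sym (inverseʳ σ)) (sym σx≡c) (at<-< m<c)

module _ {σ : Permutation′ (suc N)} (c : Fin (suc N)) (cl : Clustered σ)
         (pσ : Pending (toℕ c) σ) where

  exc-step : toℕ (σ ⟨$⟩ˡ c) ℕ.< toℕ c → toℕ c ℕ.< toℕ (σ ⟨$⟩ʳ c) →
             ∃ λ σ′ → Delete zero c σ σ′ × Pending (toℕ c) σ′
  exc-step x<c c<y = remove zero σ , d ,
    Above-delete d (λ _ → s≤s) ℕ.≤-refl (Above-extend {σ = σ} c (proj₁ pσ) (ℕ.<⇒≤ c<y)) ,
    Above-lower (Delete-flip d) (keep-< c ℕ.≤-refl)
      (Above-strict {σ = flip σ} c (ℕ.<⇒≤ c<y) (proj₂ pσ))
    where
    d : Delete zero c σ (remove zero σ)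
    d = Delete-remove σ (oldest {σ = σ} c cl pσ x<c)

  fix-step : σ ⟨$⟩ʳ c ≡ c → ∃ λ σ′ → Delete c c σ σ′ × Pending (toℕ c) σ′
  fix-step eq = remove c σ , d ,
    Above-delete d (keep-< c ℕ.≤-refl) ℕ.≤-refl (proj₁ pσ) ,
    Above-delete (Delete-flip d) (keep-< c ℕ.≤-refl) ℕ.≤-refl (proj₂ pσ)
    where
    d : Delete c c σ (remove c σ)
    d = Delete-remove σ eq

  up-step : toℕ c ℕ.< toℕ (σ ⟨$⟩ˡ c) → toℕ c ℕ.< toℕ (σ ⟨$⟩ʳ c) → Pending (suc (toℕ c)) σ
  up-step c<x c<y =
    Above-extend {σ = σ} c (Above-strict {σ = σ} c (ℕ.<⇒≤ c<x) (proj₁ pσ)) c<y ,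
    Above-extend {σ = flip σ} c (Above-strict {σ = flip σ} c (ℕ.<⇒≤ c<y) (proj₂ pσ)) c<x

down-step : ∀ {σ : Permutation′ (suc (suc N))} c → Clustered σ → Pending (suc (toℕ c)) σ →
            toℕ (σ ⟨$⟩ˡ suc c) ℕ.< suc (toℕ c) → toℕ (σ ⟨$⟩ʳ suc c) ℕ.< suc (toℕ c) →
            ∃ λ σ′ → ∃ λ σ″ →
              Delete zero (suc c) σ σ′ × Delete c zero σ′ σ″ × Pending (toℕ c) σ″
down-step {σ = σ} c cl pσ x<c y<c = σ′ , remove c σ′ , d , e ,
  Above-lower e (keep-< c ℕ.≤-refl) (Above-delete d (λ _ → s≤s) ℕ.≤-refl (proj₁ pσ)) ,
  Above-delete (Delete-flip e) (λ _ → s≤s) ℕ.≤-refl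
    (Above-lower (Delete-flip d) (keep-< (suc c) ℕ.≤-refl) (proj₂ pσ))
  where
  σ′ : Permutation′ _
  σ′ = remove zero σ
  d : Delete zero (suc c) σ σ′
  d = Delete-remove σ (oldest {σ = σ} (suc c) cl pσ x<c)
  punchIn≡0 : ∀ k → zero ≡ punchIn (suc c) k → k ≡ zero
  punchIn≡0 zero _ = refl
  -- `oldest` for the inverse puts the value 0 at position `suc c`, which becomes `c` once position
  -- 0 is deleted.
  e : Delete c zero σ′ (remove c σ′)
  e = Delete-remove σ′ (punchIn≡0 _ (trans
    (sym (flip-permute σ (oldest {σ = flip σ} (suc c) (Clustered-flip {σ = σ} cl) (swap pσ) y<c)))
    (off d c)))

-- The number of letters left is N - l: U raises l, the letters E, A and F lower N by one, and D
-- lowers N by two and l by one.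
Parses : ℕ → ℕ → Set
Parses n l = ∀ {N} (σ : Permutation′ N) → N ≡ n ℕ.+ l → Pending l σ → Clustered σ →
             ∃ λ (w : Vec Step n) → Run l σ w

module _ (n : ℕ) (ih : ∀ l → Parses n l) where

  parse-up : ∀ {σ : Permutation′ (suc N)} (c : Fin (suc N)) → N ≡ n ℕ.+ toℕ c → Clustered σ → Pending (suc (toℕ c)) σ →
             ∃ λ (w : Vec Step (suc n)) → Run (toℕ c) σ w
  parse-up {σ = σ} c N≡ cl pσ =
    let w , r = ih (suc (toℕ c)) σ (trans (cong suc N≡) (sym (ℕ.+-suc n _))) pσ cl
    in U ∷ w , up r

  parse-fix : ∀ {σ : Permutation′ (suc N)} c → N ≡ n ℕ.+ toℕ c → Clustered σ → toℕ c ℕ.≤ 1 →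
              (∃ λ σ′ → Delete c c σ σ′ × Pending (toℕ c) σ′) →
              ∃ λ (w : Vec Step (suc n)) → Run (toℕ c) σ w
  parse-fix c N≡ cl c≤1 (σ′ , d , pσ′) =
    let w , r = ih (toℕ c) σ′ N≡ pσ′ (Clustered-delete d cl)
    in F ∷ w , fix d refl c≤1 r

  parse-exc : ∀ {σ : Permutation′ (suc (suc N))} c → suc N ≡ n ℕ.+ suc (toℕ c) → Clustered σ →
              (∃ λ σ′ → Delete zero (suc c) σ σ′ × Pending (suc (toℕ c)) σ′) →
              ∃ λ (w : Vec Step (suc n)) → Run (suc (toℕ c)) σ w
  parse-exc c N≡ cl (σ′ , d , pσ′) =
    let w , r = ih (suc (toℕ c)) σ′ N≡ pσ′ (Clustered-delete d cl)
    in E ∷ w , exc d refl r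

  parse-anti : ∀ {σ : Permutation′ (suc (suc N))} c → suc N ≡ n ℕ.+ suc (toℕ c) → Clustered σ →
               (∃ λ τ → Delete zero (suc c) (flip σ) τ × Pending (suc (toℕ c)) τ) →
               ∃ λ (w : Vec Step (suc n)) → Run (suc (toℕ c)) σ w
  parse-anti {σ = σ} c N≡ cl (τ , d , pτ) =
    let w , r = ih (suc (toℕ c)) (flip τ) N≡ (swap pτ) (Clustered-delete (Delete-flip d) cl)
    in A ∷ w , anti (Delete-flip d) refl r

  parse-down : ∀ {σ : Permutation′ (suc (suc N))} c → suc N ≡ n ℕ.+ suc (toℕ c) → Clustered σ →
               (∃ λ σ′ → ∃ λ σ″ →
                 Delete zero (suc c) σ σ′ × Delete c zero σ′ σ″ × Pending (toℕ c) σ″) →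
               ∃ λ (w : Vec Step (suc n)) → Run (suc (toℕ c)) σ w
  parse-down c N≡ cl (σ′ , σ″ , d , e , pσ″) =
    let w , r = ih (toℕ c) σ″ (ℕ.suc-injective (trans N≡ (ℕ.+-suc n _))) pσ″
                  (Clustered-delete e (Clustered-delete d cl))
    in D ∷ w , down d refl e refl r

  parse-step : ∀ (σ : Permutation′ (suc N)) c → N ≡ n ℕ.+ toℕ c → Pending (toℕ c) σ → Clustered σ →
               Tri (σ ⟨$⟩ʳ c Fin.< c) (σ ⟨$⟩ʳ c ≡ c) (c Fin.< σ ⟨$⟩ʳ c) →
               Tri (σ ⟨$⟩ˡ c Fin.< c) (σ ⟨$⟩ˡ c ≡ c) (c Fin.< σ ⟨$⟩ˡ c) →
               ∃ λ (w : Vec Step (suc n)) → Run (toℕ c) σ w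
  parse-step σ c N≡ pσ cl (tri≈ _ y≡c _) _ =
    parse-fix c N≡ cl (fixed-low {σ = σ} c cl pσ y≡c) (fix-step {σ = σ} c cl pσ y≡c)
  parse-step σ c N≡ pσ cl (tri< _ y≢c _) (tri≈ _ x≡c _) = contradiction (flip-permute σ x≡c) y≢c
  parse-step σ c N≡ pσ cl (tri> _ y≢c _) (tri≈ _ x≡c _) = contradiction (flip-permute σ x≡c) y≢c
  parse-step σ c N≡ pσ cl (tri> _ _ c<y) (tri> _ _ c<x) =
    parse-up c N≡ cl (up-step {σ = σ} c cl pσ c<x c<y)
  parse-step {suc N} σ (suc c) N≡ pσ cl (tri> _ _ c<y) (tri< x<c _ _) =
    parse-exc c N≡ cl (exc-step {σ = σ} (suc c) cl pσ x<c c<y)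
  parse-step {suc N} σ (suc c) N≡ pσ cl (tri< y<c _ _) (tri> _ _ c<x) =
    parse-anti c N≡ cl (exc-step {σ = flip σ} (suc c) (Clustered-flip {σ = σ} cl) (swap pσ) y<c c<x)
  parse-step {suc N} σ (suc c) N≡ pσ cl (tri< y<c _ _) (tri< x<c _ _) =
    parse-down c N≡ cl (down-step {σ = σ} c cl pσ x<c y<c)

parse : ∀ n l → Parses n l
parse zero    zero    σ refl pσ cl = [] , end
parse zero    (suc l) σ refl pσ cl =
  contradiction (proj₁ pσ zero (s≤s z≤n)) (ℕ.<⇒≱ (Fin.toℕ<n (σ ⟨$⟩ʳ zero)))
parse (suc n) l {suc N} σ refl pσ cl = subst (λ l → ∃ λ w → Run l σ w) c≡l
  (parse-step n (parse n) σ c (cong (n ℕ.+_) (sym c≡l)) (subst (λ l → Pending l σ) (sym c≡l) pσ) cl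
    (Fin.<-cmp _ _) (Fin.<-cmp _ _))
  where
  c : Fin (suc N)
  c = fromℕ< (s≤s (ℕ.m≤n+m l n))
  c≡l : toℕ c ≡ l
  c≡l = Fin.toℕ-fromℕ< _

-- A run is determined by its permutation, and conversely

run-size : ∀ {σ : Permutation′ N} {w : Vec Step n} → Run l σ w → N ≡ n ℕ.+ l
run-size end = refl
run-size {n = suc n} {l} (up r) = trans (run-size r) (ℕ.+-suc n l)
run-size (exc _ _ r) = cong suc (run-size r)
run-size (anti _ _ r) = cong suc (run-size r)
run-size {n = suc n} {suc l} (down _ _ _ _ r) =
  cong suc (trans (cong suc (run-size r)) (sym (ℕ.+-suc n l)))
run-size (fix _ _ _ r) = cong suc (run-size r)

same : ∀ {i j : Fin N} {m} → toℕ i ≡ m → toℕ j ≡ m → i ≡ j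
same p q = Fin.toℕ-injective (trans p (sym q))

run-unique : ∀ {σ ρ : Permutation′ N} {w : Vec Step n} → Run l σ w → Run l ρ w →
             σ ⟨$⟩ʳ_ ≗ ρ ⟨$⟩ʳ_
run-unique end end ()
run-unique (up r) (up s) = run-unique r s
run-unique (exc d p r) (exc e q s) with refl ← same p q = Delete-cong d e (run-unique r s)
run-unique (anti d p r) (anti e q s) with refl ← same p q = Delete-cong d e (run-unique r s)
run-unique (down d p d′ p′ r) (down e q e′ q′ s) with refl ← same p q | refl ← same p′ q′ =
  Delete-cong d e (Delete-cong d′ e′ (run-unique r s))
run-unique (fix d p _ r) (fix e q _ s) with refl ← same p q = Delete-cong d e (run-unique r s)

letter : Bool → Bool → Bool → Step
letter true  true  _     = U
letter true  false _     = E
letter false true  _     = A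
letter false false true  = D
letter false false false = F

<ᵇ-true : ∀ {m n} → m ℕ.< n → (m ℕ.<ᵇ n) ≡ true
<ᵇ-true {m} {n} m<n with m ℕ.<ᵇ n | ℕ.<⇒<ᵇ m<n
... | true | _ = refl

<ᵇ-false : ∀ {m n} → n ℕ.≤ m → (m ℕ.<ᵇ n) ≡ false
<ᵇ-false {m} {n} n≤m with m ℕ.<ᵇ n in eq
... | false = refl
... | true  = contradiction (ℕ.<ᵇ⇒< m n (subst T (sym eq) _)) (ℕ.≤⇒≯ n≤m)

firstStep : Permutation′ N → Fin N → Step
firstStep σ c = letter (toℕ c ℕ.<ᵇ toℕ (σ ⟨$⟩ʳ c)) (toℕ c ℕ.<ᵇ toℕ (σ ⟨$⟩ˡ c))
                   (toℕ (σ ⟨$⟩ʳ c) ℕ.<ᵇ toℕ c)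

firstStep-cong : ∀ {σ ρ : Permutation′ N} c → σ ⟨$⟩ʳ_ ≗ ρ ⟨$⟩ʳ_ → firstStep σ c ≡ firstStep ρ c
firstStep-cong {σ = σ} {ρ} c p
  rewrite p c | permute-flip σ (trans (p (ρ ⟨$⟩ˡ c)) (inverseʳ ρ)) = refl

-- Position `l` of `σ′` is still pending, so its value is at least `suc l`. In `σ` this is position
-- `j`, and reinserting the value `j` moves its value past `j`.
exc-values : ∀ {j} {σ : Permutation′ (suc N)} {σ′} → Delete zero j σ σ′ → toℕ j ≡ suc l →
             Above (suc l) (suc l) σ′ → toℕ j ℕ.< toℕ (σ ⟨$⟩ʳ j) × σ ⟨$⟩ˡ j ≡ zero
exc-values {l = l} {suc j} {σ} {σ′} d j≡ a = lt , permute-flip σ (at d)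
  where
  bound : toℕ (suc j) ℕ.≤ toℕ (σ′ ⟨$⟩ʳ j)
  bound = subst (ℕ._≤ toℕ (σ′ ⟨$⟩ʳ j)) (sym j≡) (a j (ℕ.≤-reflexive j≡))
  lt : suc (toℕ j) ℕ.< toℕ (σ ⟨$⟩ʳ suc j)
  lt rewrite value-above d j bound = s≤s bound

down-value : ∀ {j i} {σ : Permutation′ (suc (suc N))} {σ′} {l} →
             Delete zero j σ σ′ → toℕ j ≡ suc l → σ′ ⟨$⟩ʳ i ≡ zero → toℕ i ≡ l →
             σ ⟨$⟩ʳ j ≡ zero
down-value {j = suc j} d j≡ eq i≡ with refl ← same (ℕ.suc-injective j≡) i≡ =
  trans (off d j) (cong (punchIn (suc j)) eq)

-- This recovers a letter from the permutation alone, which makes words unique. The inequalities are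
-- the bounds of `run-rising` for the rest of the run.
run-first : ∀ {s} {σ : Permutation′ N} {w : Vec Step n} {c} → toℕ c ≡ l →
            Run l σ (s ∷ w) → s ≡ firstStep σ c
run-first {c = c} c≡ (up r) with refl ← c≡
  rewrite <ᵇ-true (above (proj₁ (run-rising r)) c ℕ.≤-refl)
        | <ᵇ-true (above (proj₂ (run-rising r)) c ℕ.≤-refl) = refl
run-first {c = c} c≡ (exc d j≡ r) with refl ← same c≡ j≡
  with lt , eq ← exc-values d j≡ (above (proj₁ (run-rising r)))
  rewrite <ᵇ-true lt | eq = refl
run-first {c = c} c≡ (anti d i≡ r) with refl ← same c≡ i≡
  with lt , eq ← exc-values (Delete-flip d) i≡ (above (proj₂ (run-rising r)))
  rewrite eq | <ᵇ-true lt = refl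
run-first {σ = σ} {c = c} c≡ (down {j = suc j} d j≡ e i≡ r) with refl ← same c≡ j≡
  rewrite permute-flip σ (at d) | down-value d j≡ (at e) i≡ = refl
run-first {σ = σ} {c = c} c≡ (fix d i≡ _ r) with refl ← same c≡ i≡
  rewrite at d | permute-flip σ (at d) | <ᵇ-false (ℕ.≤-refl {toℕ c}) = refl

run-deterministic : ∀ {σ ρ : Permutation′ N} {w w′ : Vec Step n} →
                    σ ⟨$⟩ʳ_ ≗ ρ ⟨$⟩ʳ_ → Run l σ w → Run l ρ w′ → w ≡ w′
run-deterministic {w = []} {[]} _ _ _ = refl
run-deterministic {n = suc n} {l} {σ} {ρ} {s ∷ _} {s′ ∷ _} p r r′ = go p r r′ s≡s′
  where
  l<N : l ℕ.< _
  l<N = subst (l ℕ.<_) (sym (run-size r)) (s≤s (ℕ.m≤n+m l n))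
  c : Fin _
  c = fromℕ< l<N
  s≡s′ : s ≡ s′
  s≡s′ = trans (run-first (Fin.toℕ-fromℕ< l<N) r)
    (trans (firstStep-cong {σ = σ} {ρ} c p) (sym (run-first (Fin.toℕ-fromℕ< l<N) r′)))
  -- With the equality of the letters as an argument, matching on `refl` disposes of all pairs of
  -- different constructors.
  go : ∀ {l N s s′} {σ ρ : Permutation′ N} {w w′ : Vec Step n} → σ ⟨$⟩ʳ_ ≗ ρ ⟨$⟩ʳ_ →
       Run l σ (s ∷ w) → Run l ρ (s′ ∷ w′) → s ≡ s′ → s ∷ w ≡ s′ ∷ w′
  go p (up r) (up r′) refl = cong (U ∷_) (run-deterministic p r r′)
  go p (exc d q r) (exc e q′ r′) refl with refl ← same q q′ =
    cong (E ∷_) (run-deterministic (Delete-cancel d e p) r r′)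
  go p (anti d q r) (anti e q′ r′) refl with refl ← same q q′ =
    cong (A ∷_) (run-deterministic (Delete-cancel d e p) r r′)
  go p (down d q f u r) (down e q′ g u′ r′) refl with refl ← same q q′ | refl ← same u u′ =
    cong (D ∷_) (run-deterministic (Delete-cancel f g (Delete-cancel d e p)) r r′)
  go p (fix d q _ r) (fix e q′ _ r′) refl with refl ← same q q′ =
    cong (F ∷_) (run-deterministic (Delete-cancel d e p) r r′)

-- Occurrences of partial patterns

-- Only labels of different rank are compared, so that a tie leaves the
-- relative order of two points open.
record Occurrence {m} (ρ ν : Fin m → ℕ) (σ : Permutation′ N) : Set where
  field
    point : Fin m → Fin N
    pos   : ∀ x y → T (ρ x ℕ.<ᵇ ρ y) → point x Fin.< point y
    val   : ∀ x y → T (ν x ℕ.<ᵇ ν y) → σ ⟨$⟩ʳ point x Fin.< σ ⟨$⟩ʳ point y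

open Occurrence

Refines : ∀ {m m′} → (Fin m → Fin m′) → (Fin m → ℕ) → (Fin m′ → ℕ) → Set
Refines f ρ ρ′ = ∀ x y → T (ρ x ℕ.<ᵇ ρ y) → T (ρ′ (f x) ℕ.<ᵇ ρ′ (f y))

refines? : ∀ {m m′} (f : Fin m → Fin m′) ρ ρ′ → Dec (Refines f ρ ρ′)
refines? f ρ ρ′ = Fin.all? λ x → Fin.all? λ y →
  T? (ρ x ℕ.<ᵇ ρ y) →-dec T? (ρ′ (f x) ℕ.<ᵇ ρ′ (f y))

module _ {m m′} {ρ ν : Fin m → ℕ} {ρ′ ν′ : Fin m′ → ℕ} {σ : Permutation′ N} where

  -- Both refinement conditions compare finitely many numbers, so closed instances are decided by
  -- evaluation.
  relabel : ∀ (f : Fin m → Fin m′) {_ : True (refines? f ρ ρ′)} {_ : True (refines? f ν ν′)} →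
            Occurrence ρ′ ν′ σ → Occurrence ρ ν σ
  relabel f {p} {q} o = record
    { point = point o ∘ f
    ; pos   = λ x y t → pos o (f x) (f y) (toWitness p x y t)
    ; val   = λ x y t → val o (f x) (f y) (toWitness q x y t)
    }

module _ {m} {ρ ν : Fin m → ℕ} where

  Occurrence-flip : ∀ {σ : Permutation′ N} → Occurrence ρ ν σ → Occurrence ν ρ (flip σ)
  Occurrence-flip {σ = σ} o = record
    { point = λ x → σ ⟨$⟩ʳ point o x
    ; pos   = val o
    ; val   = λ x y t → subst₂ Fin._<_ (sym (inverseˡ σ)) (sym (inverseˡ σ)) (pos o x y t)
    }

  module _ {i j} {σ : Permutation′ (suc N)} {σ′ : Permutation′ N} (d : Delete i j σ σ′) where

    Occurrence-insert : Occurrence ρ ν σ′ → Occurrence ρ ν σ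
    Occurrence-insert o = record
      { point = punchIn i ∘ point o
      ; pos   = λ x y t → punchIn-mono-< i (pos o x y t)
      ; val   = λ x y t → value-mono d (val o x y t)
      }

    module _ (o : Occurrence ρ ν σ) (i≢ : ∀ x → i ≢ point o x) where

      point-delete : ∀ x → punchIn i (punchOut (i≢ x)) ≡ point o x
      point-delete x = Fin.punchIn-punchOut (i≢ x)

      Occurrence-delete : Occurrence ρ ν σ′
      Occurrence-delete = record
        { point = λ x → punchOut (i≢ x)
        ; pos   = λ x y t → punchIn-cancel-< i
            (subst₂ Fin._<_ (sym (point-delete x)) (sym (point-delete y)) (pos o x y t))
        ; val   = λ x y t → value-cancel d (subst₂ (λ x y → σ ⟨$⟩ʳ x Fin.< σ ⟨$⟩ʳ y)
            (sym (point-delete x)) (sym (point-delete y)) (val o x y t))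
        }

Chain : ∀ {m} → (Fin (suc m) → Fin N) → Set
Chain e = ∀ k → e (inject₁ k) Fin.< e (suc k)

Chain-mono : ∀ {m} (e : Fin (suc m) → Fin N) → Chain e → ∀ x y → x Fin.< y → e x Fin.< e y
Chain-mono {m = suc m} e c zero    (suc zero)    _ = c zero
Chain-mono {m = suc m} e c zero    (suc (suc y)) _ =
  ℕ.<-trans (c zero) (Chain-mono (e ∘ suc) (c ∘ suc) zero (suc y) (s≤s z≤n))
Chain-mono {m = suc m} e c (suc x) (suc y) (s≤s x<y) = Chain-mono (e ∘ suc) (c ∘ suc) x y x<y

-- g lists the labels by increasing value, and h is its inverse.
module _ {m} (e : Fin (suc m) → Fin N) (g h : Fin (suc m) → Fin (suc m))
         {g∘h : True (Fin.all? (λ x → g (h x) Fin.≟ x))} {σ : Permutation′ N} where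

  sorted-occurrence : Chain e → Chain (λ x → σ ⟨$⟩ʳ e (g x)) →
                      Occurrence toℕ (toℕ ∘ h) σ
  sorted-occurrence c c′ = record
    { point = e
    ; pos   = λ x y t → Chain-mono e c x y (ℕ.<ᵇ⇒< _ _ t)
    ; val   = λ x y t → subst₂ (λ x y → σ ⟨$⟩ʳ e x Fin.< σ ⟨$⟩ʳ e y)
        (toWitness g∘h x) (toWitness g∘h y) (Chain-mono (λ x → σ ⟨$⟩ʳ e (g x)) c′ (h x) (h y) (ℕ.<ᵇ⇒< _ _ t))
    }

distinct? : (p : Pattern) → Dec (∀ x y → List.lookup p x ≡ List.lookup p y → x ≡ y)
distinct? p = Fin.all? λ x → Fin.all? λ y → (List.lookup p x ℕ.≟ List.lookup p y) →-dec (x Fin.≟ y)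

module _ (p : Pattern) {σ : Permutation′ N} where

  contains⇒occurrence : σ Contains p → Occurrence toℕ (List.lookup p) σ
  contains⇒occurrence (e , mono , iso) = record
    { point = e
    ; pos   = λ x y t → mono x y (ℕ.<ᵇ⇒< _ _ t)
    ; val   = λ x y t → Equivalence.to (iso x y) (ℕ.<ᵇ⇒< _ _ t)
    }

  -- `_Contains_` demands an equivalence; its converse half is trichotomy, as distinct entries have
  -- no ties.
  occurrence⇒contains : {distinct : True (distinct? p)} →
                        Occurrence toℕ (List.lookup p) σ → σ Contains p
  occurrence⇒contains {distinct} o = point o , (λ x y → pos o x y ∘ ℕ.<⇒<ᵇ) , λ x y →
    mk⇔ (val o x y ∘ ℕ.<⇒<ᵇ) (back x y)
    where
    back : ∀ x y → σ ⟨$⟩ʳ point o x Fin.< σ ⟨$⟩ʳ point o y → List.lookup p x ℕ.< List.lookup p y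
    back x y lt with ℕ.<-cmp (List.lookup p x) (List.lookup p y)
    ... | tri< l _ _ = l
    ... | tri≈ _ e _ = contradiction lt
      (ℕ.<-irrefl (cong (λ x → toℕ (σ ⟨$⟩ʳ point o x)) (toWitness distinct x y e)))
    ... | tri> _ _ g = contradiction lt (ℕ.<-asym (val o y x (ℕ.<⇒<ᵇ g)))

-- Avoidance of the maximally clustered patterns

module _ {σ : Permutation′ N} where

  private
    points : (a b c d : Fin N) → Fin 4 → Fin N
    points a b c d = Vec.lookup (a ∷ b ∷ c ∷ d ∷ [])

    chain : ∀ {a b c d : Fin N} → a Fin.< b → b Fin.< c → c Fin.< d → Chain (points a b c d)
    chain p q r 0F = p
    chain p q r 1F = q
    chain p q r 2F = r

    labels : (a b c d : Fin 4) → Fin 4 → Fin 4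
    labels a b c d = Vec.lookup (a ∷ b ∷ c ∷ d ∷ [])

    value-chain : ∀ {e : Fin 4 → Fin N} {a b c d} → σ ⟨$⟩ʳ e a Fin.< σ ⟨$⟩ʳ e b →
                  σ ⟨$⟩ʳ e b Fin.< σ ⟨$⟩ʳ e c → σ ⟨$⟩ʳ e c Fin.< σ ⟨$⟩ʳ e d →
                  Chain (λ x → σ ⟨$⟩ʳ e (labels a b c d x))
    value-chain p q r 0F = p
    value-chain p q r 1F = q
    value-chain p q r 2F = r

  3421-occurs : ∀ {a b c d} → a Fin.< b → b Fin.< c → c Fin.< d →
                σ ⟨$⟩ʳ d Fin.< σ ⟨$⟩ʳ c → σ ⟨$⟩ʳ c Fin.< σ ⟨$⟩ʳ a → σ ⟨$⟩ʳ a Fin.< σ ⟨$⟩ʳ b →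
                σ Contains (3 ∷ 4 ∷ 2 ∷ 1 ∷ [])
  -- Relabelling by the identity only turns the ranks 0 to 3 into the entries 1 to 4.
  3421-occurs p q r p′ q′ r′ = occurrence⇒contains (3 ∷ 4 ∷ 2 ∷ 1 ∷ []) (relabel (λ x → x)
    (sorted-occurrence (points _ _ _ _) (labels 3F 2F 0F 1F) (labels 2F 3F 1F 0F) {σ = σ}
      (chain p q r) (value-chain {points _ _ _ _} {3F} {2F} {0F} {1F} p′ q′ r′)))

  4312-occurs : ∀ {a b c d} → a Fin.< b → b Fin.< c → c Fin.< d →
                σ ⟨$⟩ʳ c Fin.< σ ⟨$⟩ʳ d → σ ⟨$⟩ʳ d Fin.< σ ⟨$⟩ʳ b → σ ⟨$⟩ʳ b Fin.< σ ⟨$⟩ʳ a →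
                σ Contains (4 ∷ 3 ∷ 1 ∷ 2 ∷ [])
  4312-occurs p q r p′ q′ r′ = occurrence⇒contains (4 ∷ 3 ∷ 1 ∷ 2 ∷ []) (relabel (λ x → x)
    (sorted-occurrence (points _ _ _ _) (labels 2F 3F 1F 0F) (labels 3F 2F 0F 1F) {σ = σ}
      (chain p q r) (value-chain {points _ _ _ _} {2F} {3F} {1F} {0F} p′ q′ r′)))

  4321-occurs : ∀ {a b c d} → a Fin.< b → b Fin.< c → c Fin.< d →
                σ ⟨$⟩ʳ d Fin.< σ ⟨$⟩ʳ c → σ ⟨$⟩ʳ c Fin.< σ ⟨$⟩ʳ b → σ ⟨$⟩ʳ b Fin.< σ ⟨$⟩ʳ a →
                σ Contains (4 ∷ 3 ∷ 2 ∷ 1 ∷ [])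
  4321-occurs p q r p′ q′ r′ = occurrence⇒contains (4 ∷ 3 ∷ 2 ∷ 1 ∷ []) (relabel (λ x → x)
    (sorted-occurrence (points _ _ _ _) (labels 3F 2F 1F 0F) (labels 3F 2F 1F 0F) {σ = σ}
      (chain p q r) (value-chain {points _ _ _ _} {3F} {2F} {1F} {0F} p′ q′ r′)))

  4231-occurs : ∀ {a b c d} → a Fin.< b → b Fin.< c → c Fin.< d →
                σ ⟨$⟩ʳ d Fin.< σ ⟨$⟩ʳ b → σ ⟨$⟩ʳ b Fin.< σ ⟨$⟩ʳ c → σ ⟨$⟩ʳ c Fin.< σ ⟨$⟩ʳ a →
                σ Contains (4 ∷ 2 ∷ 3 ∷ 1 ∷ [])
  4231-occurs p q r p′ q′ r′ = occurrence⇒contains (4 ∷ 2 ∷ 3 ∷ 1 ∷ []) (relabel (λ x → x)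
    (sorted-occurrence (points _ _ _ _) (labels 3F 1F 2F 0F) (labels 3F 1F 2F 0F) {σ = σ}
      (chain p q r) (value-chain {points _ _ _ _} {3F} {1F} {2F} {0F} p′ q′ r′)))

  avoids⇒clustered : σ Avoids maximallyClusteredPatterns → Clustered σ
  avoids⇒clustered (¬3421 ∷ ¬4312 ∷ ¬4321 ∷ []) = before , after
    where
    before′ : ∀ {i i′ j k} → i Fin.< i′ → Inv σ i j → Inv σ i′ j → ¬ Inv σ j k
    before′ {i} {i′} i<i′ (_ , σj<σi) (i′<j , σj<σi′) (j<k , σk<σj)
      with Fin.<-cmp (σ ⟨$⟩ʳ i) (σ ⟨$⟩ʳ i′)
    ... | tri< lt _ _ = ¬3421 (3421-occurs i<i′ i′<j j<k σk<σj σj<σi lt)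
    ... | tri≈ _ eq _ = Fin.<⇒≢ i<i′ (permute-injective σ eq)
    ... | tri> _ _ gt = ¬4321 (4321-occurs i<i′ i′<j j<k σk<σj σj<σi′ gt)
    before : OneBefore σ
    before i i′ j k x y z with Fin.<-cmp i i′
    ... | tri< lt _ _ = contradiction z (before′ lt x y)
    ... | tri≈ _ eq _ = eq
    ... | tri> _ _ gt = contradiction z (before′ gt y x)
    after′ : ∀ {i j k k′} → k Fin.< k′ → Inv σ i j → Inv σ j k → ¬ Inv σ j k′
    after′ {i} {j} {k} {k′} k<k′ (i<j , σj<σi) (j<k , σk<σj) (_ , σk′<σj)
      with Fin.<-cmp (σ ⟨$⟩ʳ k) (σ ⟨$⟩ʳ k′)
    ... | tri< lt _ _ = ¬4312 (4312-occurs i<j j<k k<k′ lt σk′<σj σj<σi)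
    ... | tri≈ _ eq _ = Fin.<⇒≢ k<k′ (permute-injective σ eq)
    ... | tri> _ _ gt = ¬4321 (4321-occurs i<j j<k k<k′ gt σk<σj σj<σi)
    after : OneAfter σ
    after i j k k′ x y z with Fin.<-cmp k k′
    ... | tri< lt _ _ = contradiction z (after′ lt x y)
    ... | tri≈ _ eq _ = eq
    ... | tri> _ _ gt = contradiction y (after′ gt x z)

  clustered⇒avoids : Clustered σ → σ Avoids maximallyClusteredPatterns
  clustered⇒avoids (before , after) = ¬3421 ∷ ¬4312 ∷ ¬4321 ∷ []
    where
    inversion : ∀ {ν} (o : Occurrence toℕ ν σ) x y {_ : T (toℕ x ℕ.<ᵇ toℕ y)} {_ : T (ν y ℕ.<ᵇ ν x)} →
                Inv σ (point o x) (point o y)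
    inversion o x y {t} {u} = pos o x y t , val o y x u
    ¬3421 : ¬ σ Contains (3 ∷ 4 ∷ 2 ∷ 1 ∷ [])
    ¬3421 c = Fin.<⇒≢ (pos o 0F 1F _)
      (before _ _ _ _ (inversion o 0F 2F) (inversion o 1F 2F) (inversion o 2F 3F))
      where o = contains⇒occurrence _ c
    ¬4312 : ¬ σ Contains (4 ∷ 3 ∷ 1 ∷ 2 ∷ [])
    ¬4312 c = Fin.<⇒≢ (pos o 2F 3F _)
      (after _ _ _ _ (inversion o 0F 1F) (inversion o 1F 2F) (inversion o 1F 3F))
      where o = contains⇒occurrence _ c
    ¬4321 : ¬ σ Contains (4 ∷ 3 ∷ 2 ∷ 1 ∷ [])
    ¬4321 c = Fin.<⇒≢ (pos o 0F 1F _)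
      (before _ _ _ _ (inversion o 0F 2F) (inversion o 1F 2F) (inversion o 2F 3F))
      where o = contains⇒occurrence _ c

-- Hexagons

-- Labels 0-3 are the upper points a₁ … a₄ and labels 4-7 the lower
-- points b₁ … b₄.  The four hexagon patterns are the four ways to break
-- the ties, which are a₄, b₁ in position and a₁, b₄ in value.
hexPos hexVal : Fin 8 → ℕ
hexPos = Vec.lookup (0 ∷ 1 ∷ 2 ∷ 3 ∷ 3 ∷ 4 ∷ 5 ∷ 6 ∷ [])
hexVal = Vec.lookup (3 ∷ 4 ∷ 5 ∷ 6 ∷ 0 ∷ 1 ∷ 2 ∷ 3 ∷ [])

Hexagon : Permutation′ N → Set
Hexagon = Occurrence hexPos hexVal

swap-a₄b₁ : Fin 8 → Fin 8
swap-a₄b₁ = Vec.lookup (0F ∷ 1F ∷ 2F ∷ 4F ∷ 3F ∷ 5F ∷ 6F ∷ 7F ∷ [])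

swap-ab : Fin 8 → Fin 8
swap-ab = Vec.lookup (4F ∷ 5F ∷ 6F ∷ 7F ∷ 0F ∷ 1F ∷ 2F ∷ 3F ∷ [])

Hexagon-flip : ∀ {σ : Permutation′ N} → Hexagon σ → Hexagon (flip σ)
Hexagon-flip o = relabel swap-ab (Occurrence-flip o)

-- Breaking a tie: the new ranks ask for nothing beyond the old ones except that `u` come before
-- `v`.
Breaks : ∀ {m} (u v : Fin m) (ρ ρ′ : Fin m → ℕ) → Set
Breaks u v ρ ρ′ = ∀ x y → T (ρ′ x ℕ.<ᵇ ρ′ y) → T (ρ x ℕ.<ᵇ ρ y) ⊎ (x ≡ u × y ≡ v)

breaks? : ∀ {m} (u v : Fin m) (ρ ρ′ : Fin m → ℕ) → Dec (Breaks u v ρ ρ′)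
breaks? u v ρ ρ′ = Fin.all? λ x → Fin.all? λ y → T? (ρ′ x ℕ.<ᵇ ρ′ y) →-dec
  (T? (ρ x ℕ.<ᵇ ρ y) ⊎-dec ((x Fin.≟ u) ×-dec (y Fin.≟ v)))

module _ {m} {ρ ν : Fin m → ℕ} {σ : Permutation′ N} (u v : Fin m) where

  break-pos : ∀ ρ′ {_ : True (breaks? u v ρ ρ′)} (o : Occurrence ρ ν σ) →
              point o u Fin.< point o v → Occurrence ρ′ ν σ
  break-pos ρ′ {b} o u<v = record
    { point = point o
    ; pos   = λ x y t → [ pos o x y , (λ { (refl , refl) → u<v }) ]′ (toWitness b x y t)
    ; val   = val o
    }

  break-val : ∀ ν′ {_ : True (breaks? u v ν ν′)} (o : Occurrence ρ ν σ) →
              σ ⟨$⟩ʳ point o u Fin.< σ ⟨$⟩ʳ point o v → Occurrence ρ ν′ σ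
  break-val ν′ {b} o u<v = record
    { point = point o
    ; pos   = pos o
    ; val   = λ x y t → [ val o x y , (λ { (refl , refl) → u<v }) ]′ (toWitness b x y t)
    }

module _ {σ : Permutation′ N} where

  -- Comparing each of the two tied pairs gives the four patterns. The points of a tied pair cannot
  -- coincide because their other coordinate separates them.
  avoids⇒¬Hexagon : σ Avoids hexagonPatterns → ¬ Hexagon σ
  avoids⇒¬Hexagon (¬a ∷ ¬b ∷ ¬c ∷ ¬d ∷ []) o
    with Fin.<-cmp (point o 3F) (point o 4F) | Fin.<-cmp (σ ⟨$⟩ʳ point o 7F) (σ ⟨$⟩ʳ point o 0F)
  ... | tri≈ _ e _ | _ = Fin.<⇒≢ (val o 4F 3F _) (cong (σ ⟨$⟩ʳ_) (sym e))
  ... | _ | tri≈ _ e _ = Fin.<⇒≢ (pos o 0F 7F _) (sym (permute-injective σ e))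
  ... | tri> _ _ p | tri> _ _ v = ¬a (occurrence⇒contains _ (relabel swap-a₄b₁
          (break-val 0F 7F (List.lookup (4 ∷ 6 ∷ 7 ∷ 1 ∷ 8 ∷ 2 ∷ 3 ∷ 5 ∷ []) ∘ swap-a₄b₁)
            (break-pos 4F 3F (toℕ ∘ swap-a₄b₁) o p) v)))
  ... | tri< p _ _ | tri> _ _ v = ¬b (occurrence⇒contains _
          (break-val 0F 7F (List.lookup (4 ∷ 6 ∷ 7 ∷ 8 ∷ 1 ∷ 2 ∷ 3 ∷ 5 ∷ []))
            (break-pos 3F 4F toℕ o p) v))
  ... | tri> _ _ p | tri< v _ _ = ¬c (occurrence⇒contains _ (relabel swap-a₄b₁
          (break-val 7F 0F (List.lookup (5 ∷ 6 ∷ 7 ∷ 1 ∷ 8 ∷ 2 ∷ 3 ∷ 4 ∷ []) ∘ swap-a₄b₁)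
            (break-pos 4F 3F (toℕ ∘ swap-a₄b₁) o p) v)))
  ... | tri< p _ _ | tri< v _ _ = ¬d (occurrence⇒contains _
          (break-val 7F 0F (List.lookup (5 ∷ 6 ∷ 7 ∷ 8 ∷ 1 ∷ 2 ∷ 3 ∷ 4 ∷ []))
            (break-pos 3F 4F toℕ o p) v))

  ¬Hexagon⇒avoids : ¬ Hexagon σ → σ Avoids hexagonPatterns
  ¬Hexagon⇒avoids ¬h =
    (λ c → ¬h (relabel swap-a₄b₁ (contains⇒occurrence _ c))) ∷
    (λ c → ¬h (relabel (λ x → x) (contains⇒occurrence _ c))) ∷
    (λ c → ¬h (relabel swap-a₄b₁ (contains⇒occurrence _ c))) ∷
    (λ c → ¬h (relabel (λ x → x) (contains⇒occurrence _ c))) ∷ []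

-- Hexagons from pending points

module _ {σ : Permutation′ (4 ℕ.+ N)} (r : Rising 4 4 σ) (s : Rising 4 4 (flip σ)) where

  private
    e : Fin 8 → Fin (4 ℕ.+ N)
    e = Vec.lookup (0F ∷ 1F ∷ 2F ∷ 3F ∷ (σ ⟨$⟩ˡ 0F) ∷ (σ ⟨$⟩ˡ 1F) ∷ (σ ⟨$⟩ˡ 2F) ∷ (σ ⟨$⟩ˡ 3F) ∷ [])

    low : ∀ {x y} → x Fin.< y → σ ⟨$⟩ʳ (σ ⟨$⟩ˡ x) Fin.< σ ⟨$⟩ʳ (σ ⟨$⟩ˡ y)
    low = subst₂ Fin._<_ (sym (inverseʳ σ)) (sym (inverseʳ σ))

  -- The four pending positions are a₁ to a₄ and the four pending values belong to b₁ to b₄: the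
  -- pattern 56781234.
  Hexagon-level4 : Hexagon σ
  Hexagon-level4 = relabel (λ x → x) (sorted-occurrence e swap-ab swap-ab {σ = σ}
    (λ { 0F → s≤s z≤n ; 1F → s≤s (s≤s z≤n) ; 2F → s≤s (s≤s (s≤s z≤n))
       ; 3F → above s 0F (s≤s z≤n)
       ; 4F → increasing s 0F 1F (s≤s z≤n) (s≤s (s≤s z≤n))
       ; 5F → increasing s 1F 2F (s≤s (s≤s z≤n)) (s≤s (s≤s (s≤s z≤n)))
       ; 6F → increasing s 2F 3F (s≤s (s≤s (s≤s z≤n))) ℕ.≤-refl })
    (λ { 0F → low {0F} {1F} (s≤s z≤n) ; 1F → low {1F} {2F} (s≤s (s≤s z≤n))
       ; 2F → low {2F} {3F} (s≤s (s≤s (s≤s z≤n)))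
       ; 3F → subst (Fin._< σ ⟨$⟩ʳ 0F) (sym (inverseʳ σ)) (above r 0F (s≤s z≤n))
       ; 4F → increasing r 0F 1F (s≤s z≤n) (s≤s (s≤s z≤n))
       ; 5F → increasing r 1F 2F (s≤s (s≤s z≤n)) (s≤s (s≤s (s≤s z≤n)))
       ; 6F → increasing r 2F 3F (s≤s (s≤s (s≤s z≤n))) ℕ.≤-refl }))

module _ {σ : Permutation′ (5 ℕ.+ N)} {σ′ σ″} {i}
         (d : Delete zero 3F σ σ′) (e : Delete i zero σ′ σ″)
         (r : Rising 3 3 σ″) (s : Rising 3 3 (flip σ″)) where

  private
    up′ low′ : Fin (3 ℕ.+ N) → Fin (5 ℕ.+ N)
    up′  k = suc (punchIn i k)
    low′ k = suc (punchIn i (σ″ ⟨$⟩ˡ k))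

    mono : ∀ {k m} → σ″ ⟨$⟩ʳ k Fin.< σ″ ⟨$⟩ʳ m → σ ⟨$⟩ʳ up′ k Fin.< σ ⟨$⟩ʳ up′ m
    mono lt = value-mono d (value-mono e lt)

    low-value : ∀ k → σ ⟨$⟩ʳ low′ k ≡ punchIn 3F (suc k)
    low-value k = trans (off d _) (cong (punchIn 3F) (trans (off e _) (cong suc (inverseʳ σ″))))

    up-value : ∀ k → toℕ k ℕ.< 3 → 4 ℕ.< toℕ (σ ⟨$⟩ʳ up′ k)
    up-value k k<3 rewrite off d (punchIn i k) | off e k
      = subst (4 ℕ.<_) (sym (punchIn-above 3F _ (ℕ.m≤n⇒m≤1+n (above r k k<3)))) (s≤s (s≤s (above r k k<3)))

    b₁-value : σ ⟨$⟩ʳ suc i ≡ zero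
    b₁-value = trans (off d i) (cong (punchIn 3F) (at e))

    by-value : Fin 8 → Fin (5 ℕ.+ N)
    by-value = Vec.lookup (suc i ∷ low′ 0F ∷ low′ 1F ∷ zero ∷ low′ 2F ∷ up′ 0F ∷ up′ 1F ∷ up′ 2F ∷ [])

    value-chain : Chain (λ x → σ ⟨$⟩ʳ by-value x)
    value-chain 0F = subst₂ Fin._<_ (sym b₁-value) (sym (low-value 0F)) (s≤s z≤n)
    value-chain 1F = subst₂ Fin._<_ (sym (low-value 0F)) (sym (low-value 1F)) (s≤s (s≤s z≤n))
    value-chain 2F = subst₂ Fin._<_ (sym (low-value 1F)) (sym (at d)) ℕ.≤-refl
    value-chain 3F = subst₂ Fin._<_ (sym (at d)) (sym (low-value 2F)) ℕ.≤-refl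
    value-chain 4F = subst (Fin._< σ ⟨$⟩ʳ up′ 0F) (sym (low-value 2F)) (up-value 0F (s≤s z≤n))
    value-chain 5F = mono (increasing r 0F 1F (s≤s z≤n) (s≤s (s≤s z≤n)))
    value-chain 6F = mono (increasing r 1F 2F (s≤s (s≤s z≤n)) ℕ.≤-refl)

    low-mono : ∀ {k m} → k Fin.< m → toℕ m ℕ.< 3 → low′ k Fin.< low′ m
    low-mono k<m m<3 = s≤s (punchIn-mono-< i (increasing s _ _ k<m m<3))

    low-first : toℕ i ℕ.≤ 3 → 5 ℕ.≤ toℕ (low′ 0F)
    low-first i≤3 rewrite punchIn-above i (σ″ ⟨$⟩ˡ 0F) (ℕ.≤-trans i≤3 (above s 0F (s≤s z≤n)))
      = s≤s (s≤s (above s 0F (s≤s z≤n)))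

  -- The excedance is a₁, the anti-excedance is b₁, and the pending elements of `σ″` supply the
  -- other six points: 46781235.
  Hexagon-EA : i ≡ 3F → Hexagon σ
  Hexagon-EA refl = relabel (λ x → x) (sorted-occurrence
    (Vec.lookup (zero ∷ up′ 0F ∷ up′ 1F ∷ up′ 2F ∷ suc i ∷ low′ 0F ∷ low′ 1F ∷ low′ 2F ∷ []))
    (Vec.lookup (4F ∷ 5F ∷ 6F ∷ 0F ∷ 7F ∷ 1F ∷ 2F ∷ 3F ∷ []))
    (Vec.lookup (3F ∷ 5F ∷ 6F ∷ 7F ∷ 0F ∷ 1F ∷ 2F ∷ 4F ∷ [])) {σ = σ}
    (λ { 0F → s≤s z≤n ; 1F → s≤s (s≤s z≤n) ; 2F → s≤s (s≤s (s≤s z≤n)) ; 3F → ℕ.≤-refl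
       ; 4F → low-first ℕ.≤-refl
       ; 5F → low-mono {0F} {1F} (s≤s z≤n) (s≤s (s≤s z≤n))
       ; 6F → low-mono {1F} {2F} (s≤s (s≤s z≤n)) ℕ.≤-refl })
    (λ { 0F → value-chain 0F ; 1F → value-chain 1F ; 2F → value-chain 2F ; 3F → value-chain 3F
       ; 4F → value-chain 4F ; 5F → value-chain 5F ; 6F → value-chain 6F }))

  -- The descent supplies a₁ and b₁. The following U brings the level back to 3, and the new pending
  -- position is a₄, now behind b₁: 46718235.
  Hexagon-DU : i ≡ 2F → Hexagon σ
  Hexagon-DU refl = relabel swap-a₄b₁ (sorted-occurrence
    (Vec.lookup (zero ∷ up′ 0F ∷ up′ 1F ∷ suc i ∷ up′ 2F ∷ low′ 0F ∷ low′ 1F ∷ low′ 2F ∷ []))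
    (Vec.lookup (3F ∷ 5F ∷ 6F ∷ 0F ∷ 7F ∷ 1F ∷ 2F ∷ 4F ∷ []))
    (Vec.lookup (3F ∷ 5F ∷ 6F ∷ 0F ∷ 7F ∷ 1F ∷ 2F ∷ 4F ∷ [])) {σ = σ}
    (λ { 0F → s≤s z≤n ; 1F → s≤s (s≤s z≤n) ; 2F → s≤s (s≤s (s≤s z≤n)) ; 3F → ℕ.≤-refl
       ; 4F → low-first (s≤s (s≤s z≤n))
       ; 5F → low-mono {0F} {1F} (s≤s z≤n) (s≤s (s≤s z≤n))
       ; 6F → low-mono {1F} {2F} (s≤s (s≤s z≤n)) ℕ.≤-refl })
    (λ { 0F → value-chain 0F ; 1F → value-chain 1F ; 2F → value-chain 2F ; 3F → value-chain 3F
       ; 4F → value-chain 4F ; 5F → value-chain 5F ; 6F → value-chain 6F }))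

-- Deleting points from a hexagon

punchIn-bound : ∀ (i : Fin (suc N)) k → v ℕ.≤ toℕ i → v ℕ.≤ toℕ (punchIn i k) → v ℕ.≤ toℕ k
punchIn-bound i k v≤i v≤ with ℕ.<-≤-connex (toℕ k) (toℕ i)
... | inj₂ i≤k = ℕ.≤-trans v≤i i≤k
... | inj₁ k<i = subst (_ ℕ.≤_) (punchIn-below i k k<i) v≤

-- A hexagon that has lost a₁ to an excedance from level 3.
record HexagonE (σ : Permutation′ N) : Set where
  field
    rest : Occurrence (hexPos ∘ suc) (hexVal ∘ suc) σ
    b₃<3 : toℕ (σ ⟨$⟩ʳ point rest 5F) ℕ.< 3
    b₄≥3 : 3 ℕ.≤ toℕ (σ ⟨$⟩ʳ point rest 6F)

-- A hexagon that has lost a₁ and b₁ to a descent from level 3.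
record HexagonD (σ : Permutation′ N) : Set where
  field
    rest : Occurrence (hexPos ∘ suc ∘ punchIn 3F) (hexVal ∘ suc ∘ punchIn 3F) σ
    a₃<2 : toℕ (point rest 1F) ℕ.< 2
    a₄≥2 : 2 ℕ.≤ toℕ (point rest 2F)
    b₃<2 : toℕ (σ ⟨$⟩ʳ point rest 4F) ℕ.< 2
    b₄≥2 : 2 ℕ.≤ toℕ (σ ⟨$⟩ʳ point rest 5F)

open HexagonE
open HexagonD

HexagonD-flip : ∀ {σ : Permutation′ N} → HexagonD σ → HexagonD (flip σ)
HexagonD-flip {σ = σ} h = record
  { rest = relabel (Vec.lookup (3F ∷ 4F ∷ 5F ∷ 0F ∷ 1F ∷ 2F ∷ [])) (Occurrence-flip (rest h))
  ; a₃<2 = b₃<2 h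
  ; a₄≥2 = b₄≥2 h
  ; b₃<2 = subst (λ x → toℕ x ℕ.< 2) (sym (inverseˡ σ)) (a₃<2 h)
  ; b₄≥2 = subst (λ x → 2 ℕ.≤ toℕ x) (sym (inverseˡ σ)) (a₄≥2 h)
  }

after-zero : ∀ {i k : Fin (suc N)} → i Fin.< k → zero ≢ k
after-zero i<k refl with () ← i<k

third : ∀ {i j k : Fin N} → i Fin.< j → j Fin.< k → 2 ℕ.≤ toℕ k
third i<j j<k = ℕ.≤-trans (s≤s (ℕ.≤-trans (s≤s z≤n) i<j)) j<k

module _ {j} {σ : Permutation′ (suc N)} {σ′} (d : Delete zero j σ σ′) where

  private
    value-≥′ : ∀ {k m} → punchIn zero k ≡ m → toℕ (σ′ ⟨$⟩ʳ k) ℕ.≤ toℕ (σ ⟨$⟩ʳ m)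
    value-≥′ refl = value-≥ d _

    value-bound′ : ∀ {k m v} → punchIn zero k ≡ m → v ℕ.≤ toℕ j → v ℕ.≤ toℕ (σ ⟨$⟩ʳ m) →
                   v ℕ.≤ toℕ (σ′ ⟨$⟩ʳ k)
    value-bound′ refl = value-bound d _

  -- Only a₁ can be at position 0. Its value `j` exceeds those of b₁, b₂ and b₃, so `j` ≤ 3 forces
  -- `j` = 3; this value separates b₃ from b₄, which is what the bounds of `HexagonE` record.
  Hexagon-exc : toℕ j ℕ.≤ 3 → Hexagon σ → Hexagon σ′ ⊎ (toℕ j ≡ 3 × HexagonE σ′)
  Hexagon-exc j≤3 o with zero Fin.≟ point o zero
  ... | no 0≢a₁ = inj₁ (Occurrence-delete d o λ
          { zero → 0≢a₁ ; (suc y) → after-zero (pos o zero (suc y) (later y)) })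
    where
    later : ∀ y → T (0 ℕ.<ᵇ hexPos (suc y))
    later = toWitness {a? = Fin.all? λ y → T? (0 ℕ.<ᵇ hexPos (suc y))} _
  ... | yes 0≡a₁ = inj₂ (j≡3 , record
          { rest = Occurrence-delete d o′ 0≢
          ; b₃<3 = ℕ.≤-<-trans (value-≥′ (point-delete d o′ 0≢ 5F))
                     (ℕ.<-≤-trans b₃<j j≤3)
          ; b₄≥3 = value-bound′ (point-delete d o′ 0≢ 6F) (ℕ.≤-reflexive (sym j≡3))
                     (ℕ.≤-trans (s≤s b₃≥2) (val o 6F 7F _))
          })
    where
    o′ : Occurrence (hexPos ∘ suc) (hexVal ∘ suc) σ
    o′ = relabel suc o
    later : ∀ y → T (0 ℕ.<ᵇ hexPos (suc y))
    later = toWitness {a? = Fin.all? λ y → T? (0 ℕ.<ᵇ hexPos (suc y))} _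
    0≢ : ∀ y → zero ≢ point o (suc y)
    0≢ y = after-zero (pos o zero (suc y) (later y))
    b₃<j : σ ⟨$⟩ʳ point o 6F Fin.< j
    b₃<j = subst (σ ⟨$⟩ʳ point o 6F Fin.<_) (trans (cong (σ ⟨$⟩ʳ_) (sym 0≡a₁)) (at d)) (val o 6F 0F _)
    b₃≥2 : 2 ℕ.≤ toℕ (σ ⟨$⟩ʳ point o 6F)
    b₃≥2 = third (val o 4F 5F _) (val o 5F 6F _)
    j≡3 : toℕ j ≡ 3
    j≡3 = ℕ.≤-antisym j≤3 (ℕ.≤-trans (s≤s b₃≥2) b₃<j)

  -- The deleted point has value 3, while a₂, the only label that could be at position 0, exceeds b₄
  -- ≥ 3.
  HexagonE-exc : toℕ j ≡ 3 → HexagonE σ → HexagonE σ′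
  HexagonE-exc j≡3 h = record
    { rest = Occurrence-delete d o 0≢
    ; b₃<3 = ℕ.≤-<-trans (value-≥′ (point-delete d o 0≢ 5F)) (b₃<3 h)
    ; b₄≥3 = value-bound′ (point-delete d o 0≢ 6F) (ℕ.≤-reflexive (sym j≡3)) (b₄≥3 h)
    }
    where
    o : Occurrence (hexPos ∘ suc) (hexVal ∘ suc) σ
    o = rest h
    later : ∀ y → T (1 ℕ.<ᵇ hexPos (suc (suc y)))
    later = toWitness {a? = Fin.all? λ y → T? (1 ℕ.<ᵇ hexPos (suc (suc y)))} _
    0≢ : ∀ y → zero ≢ point o y
    0≢ zero    e = ℕ.<⇒≱ (val o 6F 0F _) (ℕ.≤-trans
      (ℕ.≤-reflexive (trans (cong (λ x → toℕ (σ ⟨$⟩ʳ x)) (sym e)) (trans (cong toℕ (at d)) j≡3))) (b₄≥3 h))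
    0≢ (suc y) = after-zero (pos o zero (suc y) (later y))

  -- Preceding a₃ < 2, the point a₂ is at position 0 and has the value 2, yet it must exceed b₄ ≥ 2.
  HexagonD-exc : toℕ j ≡ 2 → ¬ HexagonD σ
  HexagonD-exc j≡2 h = ℕ.<⇒≱ (val (rest h) 5F 0F _)
    (ℕ.≤-trans (ℕ.≤-reflexive (trans (cong (λ x → toℕ (σ ⟨$⟩ʳ x)) a₂≡0) (trans (cong toℕ (at d)) j≡2)))
      (b₄≥2 h))
    where
    a₂≡0 : point (rest h) 0F ≡ zero
    a₂≡0 = Fin.toℕ-injective (ℕ.n≤0⇒n≡0 (ℕ.s≤s⁻¹ (ℕ.≤-trans (pos (rest h) 0F 1F _) (ℕ.s≤s⁻¹ (a₃<2 h)))))

-- As b₁ < b₂ < b₃ < 3 in value, b₁ has value 0 and is the point deleted; its position 2 separates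
-- a₃ from a₄.
HexagonE-down : ∀ {i} {σ : Permutation′ (suc N)} {σ′} → Delete i zero σ σ′ → toℕ i ≡ 2 →
                HexagonE σ → HexagonD σ′
HexagonE-down {i = i} {σ} {σ′} d i≡2 h = record
  { rest = Occurrence-delete d o′ i≢
  ; a₃<2 = ℕ.≤-<-trans (punchIn-≥ i _) (subst (λ k → toℕ k ℕ.< 2) (sym (point-delete d o′ i≢ 1F))
             (ℕ.<-≤-trans (pos o 1F 3F _) (ℕ.≤-reflexive (trans (cong toℕ b₁≡i) i≡2))))
  ; a₄≥2 = punchIn-bound i _ (ℕ.≤-reflexive (sym i≡2)) (subst (λ x → 2 ℕ.≤ toℕ x)
             (sym (point-delete d o′ i≢ 2F)) (third (pos o 0F 1F _) (pos o 1F 2F _)))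
  ; b₃<2 = ℕ.s≤s⁻¹ (subst (ℕ._< 3) (lower 4F) (b₃<3 h))
  ; b₄≥2 = ℕ.s≤s⁻¹ (subst (3 ℕ.≤_) (lower 5F) (b₄≥3 h))
  }
  where
  o : Occurrence (hexPos ∘ suc) (hexVal ∘ suc) σ
  o = rest h
  o′ : Occurrence (hexPos ∘ suc ∘ punchIn 3F) (hexVal ∘ suc ∘ punchIn 3F) σ
  o′ = relabel (punchIn 3F) o
  b₁≡0 : σ ⟨$⟩ʳ point o 3F ≡ zero
  b₁≡0 = Fin.toℕ-injective (ℕ.n≤0⇒n≡0 (ℕ.s≤s⁻¹
    (ℕ.≤-trans (val o 3F 4F _) (ℕ.s≤s⁻¹ (ℕ.≤-trans (val o 4F 5F _) (ℕ.s≤s⁻¹ (b₃<3 h)))))))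
  b₁≡i : point o 3F ≡ i
  b₁≡i = permute-injective σ (trans b₁≡0 (sym (at d)))
  higher : ∀ y → T (0 ℕ.<ᵇ hexVal (suc (punchIn 3F y)))
  higher = toWitness {a? = Fin.all? λ y → T? (0 ℕ.<ᵇ hexVal (suc (punchIn 3F y)))} _
  i≢ : ∀ y → i ≢ point o′ y
  i≢ y refl with () ← subst (σ ⟨$⟩ʳ point o 3F Fin.<_) (at d) (val o 3F (punchIn 3F y) (higher y))
  lower : ∀ y → toℕ (σ ⟨$⟩ʳ point o′ y) ≡ suc (toℕ (σ′ ⟨$⟩ʳ punchOut (i≢ y)))
  lower y = trans (cong (λ x → toℕ (σ ⟨$⟩ʳ x)) (sym (point-delete d o′ i≢ y))) (value-above d _ z≤n)

Hexagon-low : ∀ {j} {σ : Permutation′ (suc N)} {σ′} → Delete zero j σ σ′ → toℕ j ℕ.≤ 2 →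
              Hexagon σ → Hexagon σ′
Hexagon-low d j≤2 h with Hexagon-exc d (ℕ.m≤n⇒m≤1+n j≤2) h
... | inj₁ h′      = h′
... | inj₂ (e , _) = contradiction (subst (ℕ._≤ 2) e j≤2) λ { (s≤s (s≤s ())) }

-- Every upper point lies above b₁ and b₂, and every lower point lies behind a₁ and a₂; a fixed
-- point at most 1 does neither.
Hexagon-fix : ∀ {i} {σ : Permutation′ (suc N)} {σ′} → Delete i i σ σ′ → toℕ i ℕ.≤ 1 →
              Hexagon σ → Hexagon σ′
Hexagon-fix {i = i} {σ} d i≤1 o = Occurrence-delete d o (λ x → far x ∘ sym)
  where
  upper : ∀ x → T (1 ℕ.<ᵇ hexVal x) → point o x ≢ i
  upper x t e = ℕ.<⇒≱ (third (val o 4F 5F _) (val o 5F x t))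
    (subst (λ k → toℕ k ℕ.≤ 1) (trans (sym (at d)) (cong (σ ⟨$⟩ʳ_) (sym e))) i≤1)
  lower : ∀ x → T (1 ℕ.<ᵇ hexPos x) → point o x ≢ i
  lower x t e = ℕ.<⇒≱ (third (pos o 0F 1F _) (pos o 1F x t))
    (subst (λ k → toℕ k ℕ.≤ 1) (sym e) i≤1)
  far : ∀ x → point o x ≢ i
  far 0F = upper 0F _
  far 1F = upper 1F _
  far 2F = upper 2F _
  far 3F = upper 3F _
  far 4F = lower 4F _
  far 5F = lower 5F _
  far 6F = lower 6F _
  far 7F = lower 7F _

-- Occurrences of 4231

braidPos braidVal : Fin 4 → ℕ
braidPos = toℕ
braidVal = List.lookup (4 ∷ 2 ∷ 3 ∷ 1 ∷ [])

Braid : Permutation′ N → Set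
Braid = Occurrence braidPos braidVal

Braid-flip : ∀ {σ : Permutation′ N} → Braid σ → Braid (flip σ)
Braid-flip o = relabel (Vec.lookup (3F ∷ 1F ∷ 2F ∷ 0F ∷ [])) (Occurrence-flip o)

-- What is left of 4231 when the first of its two middle points is deleted.
HalfBraid : Permutation′ N → Set
HalfBraid σ = ∃ λ a → ∃ λ c → ∃ λ z →
  toℕ a ≡ 0 × toℕ (σ ⟨$⟩ʳ z) ≡ 0 × Inv σ a c × Inv σ c z

HalfBraid-flip : ∀ {σ : Permutation′ N} → HalfBraid σ → HalfBraid (flip σ)
HalfBraid-flip {σ = σ} (a , c , z , a≡0 , z≡0 , ac , cz) =
  _ , _ , _ , z≡0 , trans (cong toℕ (inverseˡ σ)) a≡0 ,
  Inv-flip (flip σ) cz , Inv-flip (flip σ) ac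

module _ {j} {σ : Permutation′ (suc N)} {σ′} (d : Delete zero j σ σ′)
         (c : Increasing (toℕ j) (flip σ)) where

  -- The front point could only be the 4, but the values below `j` occur in increasing order,
  -- whereas the 3 precedes the 1.
  Braid-exc : Braid σ → Braid σ′
  Braid-exc o = Occurrence-delete d o λ
    { 0F e → noInv-low {σ = σ} c
        (subst (σ ⟨$⟩ʳ point o 2F Fin.<_) (trans (cong (σ ⟨$⟩ʳ_) (sym e)) (at d)) (val o 2F 0F _))
        (pos o 2F 3F _ , val o 3F 2F _)
    ; 1F → after-zero (pos o 0F 1F _)
    ; 2F → after-zero (pos o 0F 2F _)
    ; 3F → after-zero (pos o 0F 3F _) }

  -- The front point is the first point of the triple, and the same order argument applies to the
  -- other two.
  HalfBraid-exc : ¬ HalfBraid σ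
  HalfBraid-exc (zero , b , z , refl , _ , (_ , lt) , bz) =
    noInv-low {σ = σ} c (subst (σ ⟨$⟩ʳ b Fin.<_) (at d) lt) bz

-- The 4 has two values below it, the 3 and the 1 have two positions before them, so a fixed point
-- at most 1 can only be the 2. It is then at 1, so the 4 is at position 0 and the 1 has value 0.
Braid-fix : ∀ {i} {σ : Permutation′ (suc N)} {σ′} → Delete i i σ σ′ → toℕ i ℕ.≤ 1 →
            Braid σ → Braid σ′ ⊎ (toℕ i ≡ 1 × HalfBraid σ′)
Braid-fix {i = i} {σ} {σ′} d i≤1 o with i Fin.≟ point o 1F
... | no i≢b = inj₁ (Occurrence-delete d o λ
        { 0F e → ℕ.<⇒≱ (third (val o 3F 1F _) (val o 1F 0F _))
            (subst (λ k → toℕ k ℕ.≤ 1) (trans (sym (at d)) (cong (σ ⟨$⟩ʳ_) e)) i≤1)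
        ; 1F → i≢b
        ; 2F e → late (third (pos o 0F 1F _) (pos o 1F 2F _)) e
        ; 3F e → late (third (pos o 0F 1F _) (pos o 1F 3F _)) e })
  where
  late : ∀ {k} → 2 ℕ.≤ toℕ k → i ≢ k
  late 2≤k refl = ℕ.<⇒≱ 2≤k i≤1
... | yes refl = inj₂ (ℕ.≤-antisym i≤1 (ℕ.≤-trans (s≤s z≤n) (pos o 0F 1F _)) ,
        half (view i (point o 0F)) (view i (point o 2F)) (view i (point o 3F))
          (pos o 0F 1F _) (subst (σ ⟨$⟩ʳ point o 3F Fin.<_) (at d) (val o 3F 1F _))
          (pos o 0F 2F _ , val o 2F 0F _) (pos o 2F 3F _ , val o 3F 2F _)
          (Fin.<⇒≢ (pos o 1F 2F _)))
  where
  half : ∀ {a c z} → View i a → View i c → View i z → a Fin.< i → σ ⟨$⟩ʳ z Fin.< i →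
         Inv σ a c → Inv σ c z → i ≢ c → HalfBraid σ′
  half hit      _        _        a<i _   _ _ _   = contradiction a<i (ℕ.<-irrefl refl)
  half _        hit      _        _   _   _ _ i≢c = contradiction refl i≢c
  half _        _        hit      _   z<i _ _ _   =
    contradiction z<i (ℕ.<-irrefl (cong toℕ (at d)))
  half (miss a) (miss c) (miss z) a<i z<i ac cz _ =
    a , c , z , ℕ.n≤0⇒n≡0 (ℕ.s≤s⁻¹ (ℕ.≤-trans (s≤s (punchIn-≥ i a)) (ℕ.≤-trans a<i i≤1))) ,
    ℕ.n≤0⇒n≡0 (ℕ.s≤s⁻¹ (ℕ.≤-trans (s≤s (value-≥ d z)) (ℕ.≤-trans z<i i≤1))) ,
    Inv-cancel d ac , Inv-cancel d cz

-- Automata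

module Automaton {Q : Set} (δ : Q → Step → Maybe Q) (final : Q → Bool) where

  Accepts : Q → Vec Step n → Set
  Next : Maybe Q → Vec Step n → Set
  Accepts q []      = T (final q)
  Accepts q (s ∷ w) = Next (δ q s) w
  Next nothing  w = ⊥
  Next (just q) w = Accepts q w

  count : Q → ℕ → ℕ
  next : Maybe Q → ℕ → ℕ
  count q zero    = if final q then 1 else 0
  count q (suc n) = next (δ q U) n ℕ.+ (next (δ q E) n ℕ.+ (next (δ q A) n ℕ.+
                      (next (δ q D) n ℕ.+ next (δ q F) n)))
  next nothing  n = 0
  next (just q) n = count q n

  Accepts-irrelevant : ∀ q (w : Vec Step n) (a b : Accepts q w) → a ≡ b
  Next-irrelevant : ∀ m (w : Vec Step n) (a b : Next m w) → a ≡ b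
  Accepts-irrelevant q []      = T-irrelevant
  Accepts-irrelevant q (s ∷ w) = Next-irrelevant (δ q s) w
  Next-irrelevant (just q) w = Accepts-irrelevant q w

  private
    first-letter : ∀ q →
      ((∃ (Next {n} (δ q U))) ⊎ (∃ (Next {n} (δ q E))) ⊎ (∃ (Next {n} (δ q A))) ⊎
       (∃ (Next {n} (δ q D))) ⊎ (∃ (Next {n} (δ q F)))) ↔ ∃ (Accepts {suc n} q)
    first-letter q = mk↔ₛ′
      (λ { (inj₁ (w , a)) → U ∷ w , a
         ; (inj₂ (inj₁ (w , a))) → E ∷ w , a
         ; (inj₂ (inj₂ (inj₁ (w , a)))) → A ∷ w , a
         ; (inj₂ (inj₂ (inj₂ (inj₁ (w , a))))) → D ∷ w , a
         ; (inj₂ (inj₂ (inj₂ (inj₂ (w , a))))) → F ∷ w , a })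
      (λ { (U ∷ w , a) → inj₁ (w , a)
         ; (E ∷ w , a) → inj₂ (inj₁ (w , a))
         ; (A ∷ w , a) → inj₂ (inj₂ (inj₁ (w , a)))
         ; (D ∷ w , a) → inj₂ (inj₂ (inj₂ (inj₁ (w , a))))
         ; (F ∷ w , a) → inj₂ (inj₂ (inj₂ (inj₂ (w , a)))) })
      (λ { (U ∷ w , a) → refl ; (E ∷ w , a) → refl ; (A ∷ w , a) → refl
         ; (D ∷ w , a) → refl ; (F ∷ w , a) → refl })
      (λ { (inj₁ (w , a)) → refl
         ; (inj₂ (inj₁ (w , a))) → refl
         ; (inj₂ (inj₂ (inj₁ (w , a)))) → refl
         ; (inj₂ (inj₂ (inj₂ (inj₁ (w , a))))) → refl
         ; (inj₂ (inj₂ (inj₂ (inj₂ (w , a))))) → refl })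

    empty-word : ∀ b → Fin (if b then 1 else 0) ↔ Σ (Vec Step 0) (λ { [] → T b })
    empty-word true  = mk↔ₛ′ (λ _ → [] , tt) (λ _ → zero) (λ { ([] , tt) → refl }) (λ { zero → refl })
    empty-word false = mk↔ₛ′ (λ ()) (λ { ([] , ()) }) (λ { ([] , ()) }) (λ ())

  count-↔ : ∀ q n → Fin (count q n) ↔ ∃ (Accepts {n} q)
  next-↔ : ∀ m n → Fin (next m n) ↔ ∃ (Next {n} m)
  count-↔ q zero    = ↔-trans (empty-word (final q))
    (mk↔ₛ′ (λ { ([] , a) → [] , a }) (λ { ([] , a) → [] , a })
      (λ { ([] , a) → refl }) (λ { ([] , a) → refl }))
  count-↔ q (suc n) =
    ↔-trans (sum (next-↔ (δ q U) n) (sum (next-↔ (δ q E) n) (sum (next-↔ (δ q A) n)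
      (sum (next-↔ (δ q D) n) (next-↔ (δ q F) n))))) (first-letter q)
    where
    sum : ∀ {a b} {X Y : Set} → Fin a ↔ X → Fin b ↔ Y → Fin (a ℕ.+ b) ↔ (X ⊎ Y)
    sum f g = ↔-trans Fin.+↔⊎ (f ⊎-↔ g)
  next-↔ nothing  n = mk↔ₛ′ (λ ()) (λ ()) (λ ()) (λ ())
  next-↔ (just q) n = count-↔ q n

-- Runs of maximally clustered permutations

levelδ : ℕ → Step → Maybe ℕ
levelδ l             U = just (suc l)
levelδ zero          E = nothing
levelδ (suc l)       E = just (suc l)
levelδ zero          A = nothing
levelδ (suc l)       A = just (suc l)
levelδ zero          D = nothing
levelδ (suc l)       D = just l
levelδ zero          F = just 0
levelδ (suc zero)    F = just 1
levelδ (suc (suc l)) F = nothing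

module Level = Automaton levelδ (ℕ._≡ᵇ 0)

run⇒level : ∀ {σ : Permutation′ N} {w : Vec Step n} → Run l σ w → Level.Accepts l w
run⇒level end = tt
run⇒level (up r) = run⇒level r
run⇒level (exc _ _ r) = run⇒level r
run⇒level (anti _ _ r) = run⇒level r
run⇒level (down _ _ _ _ r) = run⇒level r
run⇒level (fix _ _ z≤n r) = run⇒level r
run⇒level (fix _ _ (s≤s z≤n) r) = run⇒level r

-- The size stays existential so that inserting points needs no casts; `run-size` recovers it
-- afterwards.
Realised : ℕ → Vec Step n → Set
Realised l w = ∃ λ N → Σ (Permutation′ N) λ σ → Run l σ w

private
  room : ∀ {σ : Permutation′ N} {w : Vec Step n} → Run l σ w → l ℕ.< suc N
  room r = s≤s (ℕ.≤-trans (ℕ.m≤n+m _ _) (ℕ.≤-reflexive (sym (run-size r))))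

  realise-E : ∀ {w : Vec Step n} → Realised (suc l) w → Realised (suc l) (E ∷ w)
  realise-E (_ , σ , r) = _ , _ ,
    exc (Delete-insert zero (fromℕ< (room r)) σ) (Fin.toℕ-fromℕ< (room r)) r

  realise-A : ∀ {w : Vec Step n} → Realised (suc l) w → Realised (suc l) (A ∷ w)
  realise-A (_ , σ , r) = _ , _ ,
    anti (Delete-insert (fromℕ< (room r)) zero σ) (Fin.toℕ-fromℕ< (room r)) r

  realise-D : ∀ {w : Vec Step n} → Realised l w → Realised (suc l) (D ∷ w)
  realise-D (_ , σ , r) = _ , _ ,
    down (Delete-insert zero (fromℕ< (s≤s (room r))) (insert (fromℕ< (room r)) zero σ))
         (Fin.toℕ-fromℕ< (s≤s (room r)))
         (Delete-insert (fromℕ< (room r)) zero σ) (Fin.toℕ-fromℕ< (room r)) r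

  realise-F : ∀ {w : Vec Step n} → l ℕ.≤ 1 → Realised l w → Realised l (F ∷ w)
  realise-F l≤1 (_ , σ , r) = _ , _ ,
    fix (Delete-insert (fromℕ< (room r)) (fromℕ< (room r)) σ) (Fin.toℕ-fromℕ< (room r)) l≤1 r

realise : ∀ l (w : Vec Step n) → Level.Accepts l w → Realised l w
realise zero          []      _ = 0 , id , end
realise l             (U ∷ w) a = let N , σ , r = realise (suc l) w a in N , σ , up r
realise (suc l)       (E ∷ w) a = realise-E (realise (suc l) w a)
realise (suc l)       (A ∷ w) a = realise-A (realise (suc l) w a)
realise (suc l)       (D ∷ w) a = realise-D (realise l w a)
realise zero          (F ∷ w) a = realise-F z≤n (realise 0 w a)
realise (suc zero)    (F ∷ w) a = realise-F (s≤s z≤n) (realise 1 w a)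

-- Runs of hexagon-avoiding permutations

-- The number is the level.  1F is level 1 after a fixed point, 2D is
-- level 2 after a descent from level 3, and 3E, 3A are level 3 after an
-- excedance or anti-excedance at that level.
data State : Set where
  s0 s1 s1F s2 s2D s3 s3E s3A : State

level : State → ℕ
level s0  = 0
level s1  = 1
level s1F = 1
level s2  = 2
level s2D = 2
level s3  = 3
level s3E = 3
level s3A = 3

-- The Boolean says whether 4231 is avoided as well.
hexagonδ : Bool → State → Step → Maybe State
hexagonδ _     s0  U = just s1
hexagonδ _     s0  F = just s0
hexagonδ _     s1  U = just s2
hexagonδ _     s1  E = just s1
hexagonδ _     s1  A = just s1
hexagonδ _     s1  D = just s0
hexagonδ _     s1  F = just s1F
hexagonδ _     s1F U = just s2
hexagonδ _     s1F E = just s1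
hexagonδ _     s1F A = just s1
hexagonδ _     s1F D = just s0
hexagonδ false s1F F = just s1F
hexagonδ _     s2  U = just s3
hexagonδ _     s2  E = just s2
hexagonδ _     s2  A = just s2
hexagonδ _     s2  D = just s1
hexagonδ _     s2D E = just s2
hexagonδ _     s2D A = just s2
hexagonδ _     s2D D = just s1
hexagonδ _     s3  E = just s3E
hexagonδ _     s3  A = just s3A
hexagonδ _     s3  D = just s2D
hexagonδ _     s3E E = just s3E
hexagonδ _     s3E D = just s2D
hexagonδ _     s3A A = just s3A
hexagonδ _     s3A D = just s2D
hexagonδ _     _   _ = nothing

module Hexagonal (b : Bool) = Automaton (hexagonδ b) (λ q → level q ℕ.≡ᵇ 0)

accepts⇒level : ∀ b q (w : Vec Step n) → Hexagonal.Accepts b q w → Level.Accepts (level q) w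
accepts⇒level b s0  []      a = a
accepts⇒level b s0  (U ∷ w) a = accepts⇒level b s1 w a
accepts⇒level b s0  (F ∷ w) a = accepts⇒level b s0 w a
accepts⇒level b s1  (U ∷ w) a = accepts⇒level b s2 w a
accepts⇒level b s1  (E ∷ w) a = accepts⇒level b s1 w a
accepts⇒level b s1  (A ∷ w) a = accepts⇒level b s1 w a
accepts⇒level b s1  (D ∷ w) a = accepts⇒level b s0 w a
accepts⇒level b s1  (F ∷ w) a = accepts⇒level b s1F w a
accepts⇒level b s1F (U ∷ w) a = accepts⇒level b s2 w a
accepts⇒level b s1F (E ∷ w) a = accepts⇒level b s1 w a
accepts⇒level b s1F (A ∷ w) a = accepts⇒level b s1 w a
accepts⇒level b s1F (D ∷ w) a = accepts⇒level b s0 w a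
accepts⇒level false s1F (F ∷ w) a = accepts⇒level false s1F w a
accepts⇒level b s2  (U ∷ w) a = accepts⇒level b s3 w a
accepts⇒level b s2  (E ∷ w) a = accepts⇒level b s2 w a
accepts⇒level b s2  (A ∷ w) a = accepts⇒level b s2 w a
accepts⇒level b s2  (D ∷ w) a = accepts⇒level b s1 w a
accepts⇒level b s2D (E ∷ w) a = accepts⇒level b s2 w a
accepts⇒level b s2D (A ∷ w) a = accepts⇒level b s2 w a
accepts⇒level b s2D (D ∷ w) a = accepts⇒level b s1 w a
accepts⇒level b s3  (E ∷ w) a = accepts⇒level b s3E w a
accepts⇒level b s3  (A ∷ w) a = accepts⇒level b s3A w a
accepts⇒level b s3  (D ∷ w) a = accepts⇒level b s2D w a
accepts⇒level b s3E (E ∷ w) a = accepts⇒level b s3E w a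
accepts⇒level b s3E (D ∷ w) a = accepts⇒level b s2D w a
accepts⇒level b s3A (A ∷ w) a = accepts⇒level b s3A w a
accepts⇒level b s3A (D ∷ w) a = accepts⇒level b s2D w a

-- Accepted runs contain no hexagon and no 4231

-- The two points of a descent can be deleted in either order. State `s3A` needs the other order,
-- because its residue lives in the inverse.
commute-down : ∀ {j i} {σ : Permutation′ (suc (suc N))} {σ′ σ″} →
               Delete zero j σ σ′ → toℕ j ≡ suc l → Delete i zero σ′ σ″ → toℕ i ≡ l →
               ∃ λ τ → Delete j zero σ τ × Delete zero i τ σ″
commute-down {j = suc j} {i} {σ} {σ′} {σ″} d j≡ e i≡ with refl ← same (ℕ.suc-injective j≡) i≡ =
  τ , f , record
    { at  = Fin.suc-injective (trans (sym (off f zero)) (at d))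
    ; off = λ k → Fin.suc-injective (begin
        suc (τ ⟨$⟩ʳ suc k)                     ≡⟨ off f (suc k) ⟨
        σ ⟨$⟩ʳ suc (punchIn j k)               ≡⟨ off d (punchIn j k) ⟩
        punchIn (suc j) (σ′ ⟨$⟩ʳ punchIn j k)  ≡⟨ cong (punchIn (suc j)) (off e k) ⟩
        suc (punchIn j (σ″ ⟨$⟩ʳ k))            ∎)
    }
  where
  open ≡-Reasoning
  τ : Permutation′ _
  τ = remove (suc j) σ
  f : Delete (suc j) zero σ τ
  f = Delete-remove σ (down-value d j≡ (at e) i≡)

-- A state also forbids what is left of a hexagon that lost points to the letters leading to it.
-- `HexagonD` needs no inverse version, by `HexagonD-flip`.
BadHexagon : State → Permutation′ N → Set
BadHexagon s2D σ = Hexagon σ ⊎ HexagonD σ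
BadHexagon s3E σ = Hexagon σ ⊎ HexagonE σ
BadHexagon s3A σ = Hexagon σ ⊎ HexagonE (flip σ)
BadHexagon _   σ = Hexagon σ

at-most : ∀ {i : Fin N} {m k} {_ : T (m ℕ.≤ᵇ k)} → toℕ i ≡ m → toℕ i ℕ.≤ k
at-most {m = m} {k} {t} refl = ℕ.≤ᵇ⇒≤ m k t

private
  anti-low : ∀ {i} {σ : Permutation′ (suc N)} {σ′} → Delete i zero σ σ′ → toℕ i ℕ.≤ 2 →
             Hexagon σ → Hexagon σ′
  anti-low d i≤2 h = Hexagon-flip (Hexagon-low (Delete-flip d) i≤2 (Hexagon-flip h))

  down-3 : ∀ {j i} {σ : Permutation′ (suc (suc N))} {σ′ σ″} →
           Delete zero j σ σ′ → toℕ j ≡ 3 → Delete i zero σ′ σ″ → toℕ i ≡ 2 →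
           Hexagon σ → Hexagon σ″ ⊎ HexagonD σ″
  down-3 d j≡ e i≡ h = Sum.map (anti-low e (at-most i≡)) (HexagonE-down e i≡ ∘ proj₂)
    (Hexagon-exc d (at-most j≡) h)

  exc-3 : ∀ {j} {σ : Permutation′ (suc N)} {σ′} → Delete zero j σ σ′ → toℕ j ≡ 3 →
          Hexagon σ ⊎ HexagonE σ → Hexagon σ′ ⊎ HexagonE σ′
  exc-3 d j≡ (inj₁ h) = Sum.map₂ proj₂ (Hexagon-exc d (at-most j≡) h)
  exc-3 d j≡ (inj₂ h) = inj₂ (HexagonE-exc d j≡ h)

  anti-3 : ∀ {i} {σ : Permutation′ (suc N)} {σ′} → Delete i zero σ σ′ → toℕ i ≡ 3 →
           Hexagon σ ⊎ HexagonE (flip σ) → Hexagon σ′ ⊎ HexagonE (flip σ′)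
  anti-3 d i≡ h = Sum.map₁ Hexagon-flip (exc-3 (Delete-flip d) i≡ (Sum.map₁ Hexagon-flip h))

-- A hexagon is pushed along the word until it would lie in the empty permutation, or breaks. Its
-- residue survives at level 3 up to the descent; then `s2D` has no U, and `HexagonD-exc` refutes
-- the residue at each letter that `s2D` has.
accepts⇒¬Hexagon : ∀ b q {σ : Permutation′ N} {w : Vec Step n} → Hexagonal.Accepts b q w →
                   Run (level q) σ w → ¬ BadHexagon q σ
accepts⇒¬Hexagon b s0  a end h with () ← point h 0F
accepts⇒¬Hexagon b s0  a (up r) h = accepts⇒¬Hexagon b s1 a r h
accepts⇒¬Hexagon b s0  a (fix d i≡ _ r) h = accepts⇒¬Hexagon b s0 a r (Hexagon-fix d (at-most i≡) h)
accepts⇒¬Hexagon b s1  a (up r) h = accepts⇒¬Hexagon b s2 a r h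
accepts⇒¬Hexagon b s1  a (exc d j≡ r) h = accepts⇒¬Hexagon b s1 a r (Hexagon-low d (at-most j≡) h)
accepts⇒¬Hexagon b s1  a (anti d i≡ r) h = accepts⇒¬Hexagon b s1 a r (anti-low d (at-most i≡) h)
accepts⇒¬Hexagon b s1  a (down d j≡ e i≡ r) h = accepts⇒¬Hexagon b s0 a r
  (anti-low e (at-most i≡) (Hexagon-low d (at-most j≡) h))
accepts⇒¬Hexagon b s1  a (fix d i≡ _ r) h = accepts⇒¬Hexagon b s1F a r (Hexagon-fix d (at-most i≡) h)
accepts⇒¬Hexagon b s1F a (up r) h = accepts⇒¬Hexagon b s2 a r h
accepts⇒¬Hexagon b s1F a (exc d j≡ r) h = accepts⇒¬Hexagon b s1 a r (Hexagon-low d (at-most j≡) h)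
accepts⇒¬Hexagon b s1F a (anti d i≡ r) h = accepts⇒¬Hexagon b s1 a r (anti-low d (at-most i≡) h)
accepts⇒¬Hexagon b s1F a (down d j≡ e i≡ r) h = accepts⇒¬Hexagon b s0 a r
  (anti-low e (at-most i≡) (Hexagon-low d (at-most j≡) h))
accepts⇒¬Hexagon false s1F a (fix d i≡ _ r) h =
  accepts⇒¬Hexagon false s1F a r (Hexagon-fix d (at-most i≡) h)
accepts⇒¬Hexagon b s2  a (up r) h = accepts⇒¬Hexagon b s3 a r h
accepts⇒¬Hexagon b s2  a (exc d j≡ r) h = accepts⇒¬Hexagon b s2 a r (Hexagon-low d (at-most j≡) h)
accepts⇒¬Hexagon b s2  a (anti d i≡ r) h = accepts⇒¬Hexagon b s2 a r (anti-low d (at-most i≡) h)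
accepts⇒¬Hexagon b s2  a (down d j≡ e i≡ r) h = accepts⇒¬Hexagon b s1 a r
  (anti-low e (at-most i≡) (Hexagon-low d (at-most j≡) h))
accepts⇒¬Hexagon b s2D a (exc d j≡ r) (inj₁ h) =
  accepts⇒¬Hexagon b s2 a r (Hexagon-low d (at-most j≡) h)
accepts⇒¬Hexagon b s2D a (exc d j≡ r) (inj₂ h) = HexagonD-exc d j≡ h
accepts⇒¬Hexagon b s2D a (anti d i≡ r) (inj₁ h) =
  accepts⇒¬Hexagon b s2 a r (anti-low d (at-most i≡) h)
accepts⇒¬Hexagon b s2D a (anti d i≡ r) (inj₂ h) =
  HexagonD-exc (Delete-flip d) i≡ (HexagonD-flip h)
accepts⇒¬Hexagon b s2D a (down d j≡ e i≡ r) (inj₁ h) = accepts⇒¬Hexagon b s1 a r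
  (anti-low e (at-most i≡) (Hexagon-low d (at-most j≡) h))
accepts⇒¬Hexagon b s2D a (down d j≡ e i≡ r) (inj₂ h) = HexagonD-exc d j≡ h
accepts⇒¬Hexagon b s3  a (exc d j≡ r) h = accepts⇒¬Hexagon b s3E a r (exc-3 d j≡ (inj₁ h))
accepts⇒¬Hexagon b s3  a (anti d i≡ r) h = accepts⇒¬Hexagon b s3A a r (anti-3 d i≡ (inj₁ h))
accepts⇒¬Hexagon b s3  a (down d j≡ e i≡ r) h = accepts⇒¬Hexagon b s2D a r (down-3 d j≡ e i≡ h)
accepts⇒¬Hexagon b s3E a (exc d j≡ r) h = accepts⇒¬Hexagon b s3E a r (exc-3 d j≡ h)
accepts⇒¬Hexagon b s3E a (down d j≡ e i≡ r) (inj₁ h) =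
  accepts⇒¬Hexagon b s2D a r (down-3 d j≡ e i≡ h)
accepts⇒¬Hexagon b s3E a (down d j≡ e i≡ r) (inj₂ h) =
  accepts⇒¬Hexagon b s2D a r (inj₂ (HexagonE-down e i≡ (HexagonE-exc d j≡ h)))
accepts⇒¬Hexagon b s3A a (anti d i≡ r) h = accepts⇒¬Hexagon b s3A a r (anti-3 d i≡ h)
accepts⇒¬Hexagon b s3A a (down d j≡ e i≡ r) (inj₁ h) =
  accepts⇒¬Hexagon b s2D a r (down-3 d j≡ e i≡ h)
accepts⇒¬Hexagon b s3A a (down d j≡ e i≡ r) (inj₂ h)
  with τ , f , g ← commute-down d j≡ e i≡ =
  accepts⇒¬Hexagon b s2D a r (inj₂ (HexagonD-flip
    (HexagonE-down (Delete-flip g) i≡ (HexagonE-exc (Delete-flip f) j≡ h))))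

-- From `s1F` a half braid can only be carried on by U, since E, A and D refute it; hence `s0` and
-- `s1` exclude whole braids only.
BadBraid : State → Permutation′ N → Set
BadBraid s0 σ = Braid σ
BadBraid s1 σ = Braid σ
BadBraid _  σ = Braid σ ⊎ HalfBraid σ

private
  good-exc : ∀ {j} {σ : Permutation′ (suc N)} {σ′} → Delete zero j σ σ′ → toℕ j ≡ l →
             Increasing l (flip σ) → ¬ Braid σ′ → ¬ (Braid σ ⊎ HalfBraid σ)
  good-exc d refl c ¬b (inj₁ h) = ¬b (Braid-exc d c h)
  good-exc d refl c ¬b (inj₂ h) = HalfBraid-exc d c h

  good-E : ∀ {j} {σ : Permutation′ (suc N)} {σ′} {w : Vec Step n} →
           Delete zero j σ σ′ → toℕ j ≡ suc l → Run (suc l) σ′ w →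
           ¬ Braid σ′ → ¬ (Braid σ ⊎ HalfBraid σ)
  good-E d j≡ r = good-exc d j≡ (increasing (proj₂ (run-rising (exc d j≡ r))))

  good-A : ∀ {i} {σ : Permutation′ (suc N)} {σ′} {w : Vec Step n} →
           Delete i zero σ σ′ → toℕ i ≡ suc l → Run (suc l) σ′ w →
           ¬ Braid σ′ → ¬ (Braid σ ⊎ HalfBraid σ)
  good-A {σ = σ} d i≡ r ¬b h =
    good-exc (Delete-flip d) i≡ (increasing (proj₁ (run-rising (anti d i≡ r))))
      (¬b ∘ Braid-flip) (Sum.map Braid-flip (HalfBraid-flip {σ = σ}) h)

  good-D : ∀ {j i} {σ : Permutation′ (suc (suc N))} {σ′ σ″} {w : Vec Step n} →
           Delete zero j σ σ′ → toℕ j ≡ suc l → Delete i zero σ′ σ″ → toℕ i ≡ l →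
           Run l σ″ w → ¬ Braid σ″ → ¬ (Braid σ ⊎ HalfBraid σ)
  good-D d j≡ e i≡ r ¬b = good-exc d j≡ (increasing (proj₂ (run-rising (down d j≡ e i≡ r)))) λ h →
    good-exc (Delete-flip e) i≡ (increasing (proj₁ (down-middle d j≡ e i≡ (run-rising r))))
      (¬b ∘ Braid-flip) (inj₁ (Braid-flip h))

accepts⇒¬Braid : ∀ q {σ : Permutation′ N} {w : Vec Step n} → Hexagonal.Accepts true q w →
                 Run (level q) σ w → ¬ BadBraid q σ
accepts⇒¬4231 : ∀ q {σ : Permutation′ N} {w : Vec Step n} → Hexagonal.Accepts true q w →
        Run (level q) σ w → ¬ Braid σ
accepts⇒¬Braid s0  a end h with () ← point h 0F
accepts⇒¬Braid s0  a (up r) h = accepts⇒¬Braid s1 a r h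
accepts⇒¬Braid s0  a (fix d i≡ _ r) h with Braid-fix d (at-most i≡) h
... | inj₁ h′      = accepts⇒¬Braid s0 a r h′
... | inj₂ (e , _) = contradiction (trans (sym e) i≡) λ ()
accepts⇒¬Braid s1  a (up r) h = accepts⇒¬Braid s2 a r (inj₁ h)
accepts⇒¬Braid s1  a (exc d j≡ r) h = good-E d j≡ r (accepts⇒¬4231 s1 a r) (inj₁ h)
accepts⇒¬Braid s1  a (anti d i≡ r) h = good-A d i≡ r (accepts⇒¬4231 s1 a r) (inj₁ h)
accepts⇒¬Braid s1  a (down d j≡ e i≡ r) h = good-D d j≡ e i≡ r (accepts⇒¬4231 s0 a r) (inj₁ h)
accepts⇒¬Braid s1  a (fix d i≡ _ r) h =
  accepts⇒¬Braid s1F a r (Sum.map₂ proj₂ (Braid-fix d (at-most i≡) h))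
accepts⇒¬Braid s1F a (up r) = accepts⇒¬Braid s2 a r
accepts⇒¬Braid s1F a (exc d j≡ r) = good-E d j≡ r (accepts⇒¬4231 s1 a r)
accepts⇒¬Braid s1F a (anti d i≡ r) = good-A d i≡ r (accepts⇒¬4231 s1 a r)
accepts⇒¬Braid s1F a (down d j≡ e i≡ r) = good-D d j≡ e i≡ r (accepts⇒¬4231 s0 a r)
accepts⇒¬Braid s2  a (up r) = accepts⇒¬Braid s3 a r
accepts⇒¬Braid s2  a (exc d j≡ r) = good-E d j≡ r (accepts⇒¬4231 s2 a r)
accepts⇒¬Braid s2  a (anti d i≡ r) = good-A d i≡ r (accepts⇒¬4231 s2 a r)
accepts⇒¬Braid s2  a (down d j≡ e i≡ r) = good-D d j≡ e i≡ r (accepts⇒¬4231 s1 a r)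
accepts⇒¬Braid s2D a (exc d j≡ r) = good-E d j≡ r (accepts⇒¬4231 s2 a r)
accepts⇒¬Braid s2D a (anti d i≡ r) = good-A d i≡ r (accepts⇒¬4231 s2 a r)
accepts⇒¬Braid s2D a (down d j≡ e i≡ r) = good-D d j≡ e i≡ r (accepts⇒¬4231 s1 a r)
accepts⇒¬Braid s3  a (exc d j≡ r) = good-E d j≡ r (accepts⇒¬4231 s3E a r)
accepts⇒¬Braid s3  a (anti d i≡ r) = good-A d i≡ r (accepts⇒¬4231 s3A a r)
accepts⇒¬Braid s3  a (down d j≡ e i≡ r) = good-D d j≡ e i≡ r (accepts⇒¬4231 s2D a r)
accepts⇒¬Braid s3E a (exc d j≡ r) = good-E d j≡ r (accepts⇒¬4231 s3E a r)
accepts⇒¬Braid s3E a (down d j≡ e i≡ r) = good-D d j≡ e i≡ r (accepts⇒¬4231 s2D a r)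
accepts⇒¬Braid s3A a (anti d i≡ r) = good-A d i≡ r (accepts⇒¬4231 s3A a r)
accepts⇒¬Braid s3A a (down d j≡ e i≡ r) = good-D d j≡ e i≡ r (accepts⇒¬4231 s2D a r)
accepts⇒¬4231 s0  a r h = accepts⇒¬Braid s0 a r h
accepts⇒¬4231 s1  a r h = accepts⇒¬Braid s1 a r h
accepts⇒¬4231 s1F a r h = accepts⇒¬Braid s1F a r (inj₁ h)
accepts⇒¬4231 s2  a r h = accepts⇒¬Braid s2 a r (inj₁ h)
accepts⇒¬4231 s2D a r h = accepts⇒¬Braid s2D a r (inj₁ h)
accepts⇒¬4231 s3  a r h = accepts⇒¬Braid s3 a r (inj₁ h)
accepts⇒¬4231 s3E a r h = accepts⇒¬Braid s3E a r (inj₁ h)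
accepts⇒¬4231 s3A a r h = accepts⇒¬Braid s3A a r (inj₁ h)

-- Runs without hexagon or 4231 are accepted

run-level4 : ∀ {σ : Permutation′ N} {w : Vec Step n} → Run 4 σ w → Hexagon σ
-- Once N has the form 4 + n, the literals `0F` to `3F` denote points.
run-level4 {n = n} r with refl ← trans (run-size r) (ℕ.+-comm n 4)
  with x , y ← run-rising r = Hexagon-level4 x y

module _ {j i} {σ : Permutation′ (suc (suc N))} {σ′ σ″}
         (d : Delete zero j σ σ′) (j≡ : toℕ j ≡ 3) (e : Delete i zero σ′ σ″)
         (N≡ : N ≡ n ℕ.+ 3) (rs : Rising 3 3 σ″ × Rising 3 3 (flip σ″)) where

  pending-EA : toℕ i ≡ 3 → Hexagon σ
  pending-EA i≡ with refl ← trans N≡ (ℕ.+-comm n 3) with refl ← same {j = 3F} j≡ refl =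
    Hexagon-EA d e (proj₁ rs) (proj₂ rs) (same i≡ refl)

  pending-DU : toℕ i ≡ 2 → Hexagon σ
  pending-DU i≡ with refl ← trans N≡ (ℕ.+-comm n 3) with refl ← same {j = 3F} j≡ refl =
    Hexagon-DU d e (proj₁ rs) (proj₂ rs) (same i≡ refl)

-- The pending position 0 is the 4, the fixed points 1 and 2 are the 2 and the 3, and the pending
-- value 0 is the 1.
Braid-FF : ∀ {σ : Permutation′ (3 ℕ.+ N)} {σ′ σ″} → Delete 1F 1F σ σ′ → Delete 1F 1F σ′ σ″ →
           Rising 1 1 σ″ → Rising 1 1 (flip σ″) → Braid σ
Braid-FF {σ = σ} {σ′} {σ″} d e x y =
  contains⇒occurrence (4 ∷ 2 ∷ 3 ∷ 1 ∷ []) (4231-occurs {σ = σ} {0F} {1F} {2F} {z}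
    (s≤s z≤n) (s≤s (s≤s z≤n)) 2<z
    (subst₂ Fin._<_ (sym σz≡0) (sym (at d)) (s≤s z≤n))
    (subst₂ Fin._<_ (sym (at d)) (sym σ2≡2) (s≤s (s≤s z≤n)))
    (subst (Fin._< σ ⟨$⟩ʳ 0F) (sym σ2≡2) 2<σ0))
  where
  z : Fin _
  z = punchIn 1F (punchIn 1F (σ″ ⟨$⟩ˡ 0F))
  2<punchIn² : ∀ (k : Fin (suc _)) → 1 ℕ.≤ toℕ k → 2 ℕ.< toℕ (punchIn 1F (punchIn 1F k))
  2<punchIn² (suc k) _ = s≤s (s≤s (s≤s z≤n))
  2<z : 2 ℕ.< toℕ z
  2<z = 2<punchIn² _ (above y 0F (s≤s z≤n))
  σz≡0 : σ ⟨$⟩ʳ z ≡ 0F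
  σz≡0 = trans (off d _) (cong (punchIn 1F) (trans (off e _) (cong (punchIn 1F) (inverseʳ σ″))))
  σ2≡2 : σ ⟨$⟩ʳ 2F ≡ 2F
  σ2≡2 = trans (off d 1F) (cong (punchIn 1F) (at e))
  2<σ0 : 2 ℕ.< toℕ (σ ⟨$⟩ʳ 0F)
  2<σ0 = subst (λ k → 2 ℕ.< toℕ k) (sym (trans (off d 0F) (cong (punchIn 1F) (off e 0F))))
    (2<punchIn² _ (above x 0F (s≤s z≤n)))

run-FF : ∀ {i k} {σ : Permutation′ (suc (suc N))} {σ′ σ″} {w : Vec Step n} →
         Delete i i σ σ′ → toℕ i ≡ 1 → Delete k k σ′ σ″ → toℕ k ≡ 1 → Run 1 σ″ w → Braid σ
run-FF {n = n} d i≡ e k≡ r with refl ← trans (run-size r) (ℕ.+-comm n 1)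
  with refl ← same {j = 1F} i≡ refl | refl ← same {j = 1F} k≡ refl
  with x , y ← run-rising r = Braid-FF d e x y

-- The forbidden words DU, EA, AE and FF have two letters, so at the second one the pattern is found
-- in the permutation `τ` from before the first.
Before : Bool → State → Permutation′ N → Set
Before b s1F σ = T b → ∃ λ τ → ∃ λ i → Delete i i τ σ × toℕ i ≡ 1 × ¬ Braid τ
Before b s2D σ = ∃ λ τ → ∃ λ τ′ → ∃ λ j → ∃ λ i →
  Delete zero j τ τ′ × toℕ j ≡ 3 × Delete i zero τ′ σ × toℕ i ≡ 2 × ¬ Hexagon τ
Before b s3E σ = ∃ λ τ → ∃ λ j → Delete zero j τ σ × toℕ j ≡ 3 × ¬ Hexagon τ
Before b s3A σ = ∃ λ τ → ∃ λ i → Delete i zero τ σ × toℕ i ≡ 3 × ¬ Hexagon τ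
Before b _   σ = ⊤

private
  ¬insert : ∀ {m} {ρ ν : Fin m → ℕ} {i j} {σ : Permutation′ (suc N)} {σ′} → Delete i j σ σ′ →
            ¬ Occurrence ρ ν σ → ¬ Occurrence ρ ν σ′
  ¬insert d ¬o = ¬o ∘ Occurrence-insert d

run⇒accepts : ∀ b q {σ : Permutation′ N} {w : Vec Step n} → Run (level q) σ w → ¬ Hexagon σ →
              (T b → ¬ Braid σ) → Before b q σ → Hexagonal.Accepts b q w
run⇒accepts b s0  end h k p = tt
run⇒accepts b s0  (up r) h k p = run⇒accepts b s1 r h k tt
run⇒accepts b s0  (fix d _ _ r) h k p = run⇒accepts b s0 r (¬insert d h) (¬insert d ∘ k) tt
run⇒accepts b s1  (up r) h k p = run⇒accepts b s2 r h k tt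
run⇒accepts b s1  (exc d _ r) h k p = run⇒accepts b s1 r (¬insert d h) (¬insert d ∘ k) tt
run⇒accepts b s1  (anti d _ r) h k p = run⇒accepts b s1 r (¬insert d h) (¬insert d ∘ k) tt
run⇒accepts b s1  (down d _ e _ r) h k p =
  run⇒accepts b s0 r (¬insert e (¬insert d h)) (¬insert e ∘ ¬insert d ∘ k) tt
run⇒accepts b s1  (fix d i≡ _ r) h k p =
  run⇒accepts b s1F r (¬insert d h) (¬insert d ∘ k) (λ t → _ , _ , d , i≡ , k t)
run⇒accepts b s1F (up r) h k p = run⇒accepts b s2 r h k tt
run⇒accepts b s1F (exc d _ r) h k p = run⇒accepts b s1 r (¬insert d h) (¬insert d ∘ k) tt
run⇒accepts b s1F (anti d _ r) h k p = run⇒accepts b s1 r (¬insert d h) (¬insert d ∘ k) tt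
run⇒accepts b s1F (down d _ e _ r) h k p =
  run⇒accepts b s0 r (¬insert e (¬insert d h)) (¬insert e ∘ ¬insert d ∘ k) tt
run⇒accepts false s1F (fix d i≡ _ r) h k p =
  run⇒accepts false s1F r (¬insert d h) (¬insert d ∘ k) (λ ())
run⇒accepts true  s1F (fix d i≡ _ r) h k p with _ , _ , d′ , i′≡ , ¬b ← p tt =
  contradiction (run-FF d′ i′≡ d i≡ r) ¬b
run⇒accepts b s2  (up r) h k p = run⇒accepts b s3 r h k tt
run⇒accepts b s2  (exc d _ r) h k p = run⇒accepts b s2 r (¬insert d h) (¬insert d ∘ k) tt
run⇒accepts b s2  (anti d _ r) h k p = run⇒accepts b s2 r (¬insert d h) (¬insert d ∘ k) tt
run⇒accepts b s2  (down d _ e _ r) h k p =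
  run⇒accepts b s1 r (¬insert e (¬insert d h)) (¬insert e ∘ ¬insert d ∘ k) tt
run⇒accepts b s2  (fix _ _ (s≤s ()) _) h k p
run⇒accepts b s2D (up r) h k (_ , _ , _ , _ , d , j≡ , e , i≡ , ¬h) =
  contradiction (pending-DU d j≡ e (run-size r) (run-rising r) i≡) ¬h
run⇒accepts b s2D (exc d _ r) h k p = run⇒accepts b s2 r (¬insert d h) (¬insert d ∘ k) tt
run⇒accepts b s2D (anti d _ r) h k p = run⇒accepts b s2 r (¬insert d h) (¬insert d ∘ k) tt
run⇒accepts b s2D (down d _ e _ r) h k p =
  run⇒accepts b s1 r (¬insert e (¬insert d h)) (¬insert e ∘ ¬insert d ∘ k) tt
run⇒accepts b s2D (fix _ _ (s≤s ()) _) h k p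
run⇒accepts b s3  (up r) h k p = contradiction (run-level4 r) h
run⇒accepts b s3  (exc d j≡ r) h k p =
  run⇒accepts b s3E r (¬insert d h) (¬insert d ∘ k) (_ , _ , d , j≡ , h)
run⇒accepts b s3  (anti d i≡ r) h k p =
  run⇒accepts b s3A r (¬insert d h) (¬insert d ∘ k) (_ , _ , d , i≡ , h)
run⇒accepts b s3  (down d j≡ e i≡ r) h k p =
  run⇒accepts b s2D r (¬insert e (¬insert d h)) (¬insert e ∘ ¬insert d ∘ k)
    (_ , _ , _ , _ , d , j≡ , e , i≡ , h)
run⇒accepts b s3  (fix _ _ (s≤s ()) _) h k p
run⇒accepts b s3E (up r) h k p = contradiction (run-level4 r) h
run⇒accepts b s3E (exc d j≡ r) h k p =
  run⇒accepts b s3E r (¬insert d h) (¬insert d ∘ k) (_ , _ , d , j≡ , h)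
run⇒accepts b s3E (anti d i≡ r) h k (_ , _ , d′ , j≡ , ¬h) =
  contradiction (pending-EA d′ j≡ d (run-size r) (run-rising r) i≡) ¬h
run⇒accepts b s3E (down d j≡ e i≡ r) h k p =
  run⇒accepts b s2D r (¬insert e (¬insert d h)) (¬insert e ∘ ¬insert d ∘ k)
    (_ , _ , _ , _ , d , j≡ , e , i≡ , h)
run⇒accepts b s3E (fix _ _ (s≤s ()) _) h k p
run⇒accepts b s3A (up r) h k p = contradiction (run-level4 r) h
run⇒accepts b s3A (exc d j≡ r) h k (_ , _ , d′ , i≡ , ¬h) =
  contradiction (Hexagon-flip (pending-EA (Delete-flip d′) i≡ (Delete-flip d)
    (run-size r) (swap (run-rising r)) j≡)) ¬h
run⇒accepts b s3A (anti d i≡ r) h k p =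
  run⇒accepts b s3A r (¬insert d h) (¬insert d ∘ k) (_ , _ , d , i≡ , h)
run⇒accepts b s3A (down d j≡ e i≡ r) h k p =
  run⇒accepts b s2D r (¬insert e (¬insert d h)) (¬insert e ∘ ¬insert d ∘ k)
    (_ , _ , _ , _ , d , j≡ , e , i≡ , h)
run⇒accepts b s3A (fix _ _ (s≤s ()) _) h k p

-- Linear recurrences for the hexagonal counts

convolve : List ℤ → (ℕ → ℤ) → ℕ → ℤ
convolve []       f n       = ℤ.0ℤ
convolve (c ∷ cs) f zero    = c ℤ.* f 0
convolve (c ∷ cs) f (suc n) = c ℤ.* f (suc n) ℤ.+ convolve cs f n

convolve-cong : ∀ cs {f g} → f ≗ g → convolve cs f ≗ convolve cs g
convolve-cong []       p n       = refl
convolve-cong (c ∷ cs) p zero    = cong (c ℤ.*_) (p 0)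
convolve-cong (c ∷ cs) p (suc n) = cong₂ ℤ._+_ (cong (c ℤ.*_) (p (suc n))) (convolve-cong cs p n)

-- Coefficients of the counts from s0, s1, s1F, s2, s2D, s3 and s3E; the
-- counts from s3A and s3E agree.
record Form : Set where
  constructor form
  field
    f₀ f₁ f₁F f₂ f₂D f₃ f₃E : ℤ

module _ (b : Bool) where
  open Hexagonal b

  eval : Form → ℕ → ℤ
  eval (form f₀ f₁ f₁F f₂ f₂D f₃ f₃E) n =
    f₀ ℤ.* ℤ.+ count s0 n ℤ.+ f₁ ℤ.* ℤ.+ count s1 n ℤ.+ f₁F ℤ.* ℤ.+ count s1F n ℤ.+
    f₂ ℤ.* ℤ.+ count s2 n ℤ.+ f₂D ℤ.* ℤ.+ count s2D n ℤ.+ f₃ ℤ.* ℤ.+ count s3 n ℤ.+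
    f₃E ℤ.* ℤ.+ count s3E n

  count-3A : ∀ n → count s3A n ≡ count s3E n
  count-3A zero    = refl
  count-3A (suc n) rewrite count-3A n = refl

zeroForm : Form
zeroForm = form ℤ.0ℤ ℤ.0ℤ ℤ.0ℤ ℤ.0ℤ ℤ.0ℤ ℤ.0ℤ ℤ.0ℤ

infixl 6 _⊕_
infixr 7 _⊙_

_⊕_ : Form → Form → Form
form a₀ a₁ a₂ a₃ a₄ a₅ a₆ ⊕ form b₀ b₁ b₂ b₃ b₄ b₅ b₆ =
  form (a₀ ℤ.+ b₀) (a₁ ℤ.+ b₁) (a₂ ℤ.+ b₂) (a₃ ℤ.+ b₃) (a₄ ℤ.+ b₄) (a₅ ℤ.+ b₅) (a₆ ℤ.+ b₆)

_⊙_ : ℤ → Form → Form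
c ⊙ form a₀ a₁ a₂ a₃ a₄ a₅ a₆ =
  form (c ℤ.* a₀) (c ℤ.* a₁) (c ℤ.* a₂) (c ℤ.* a₃) (c ℤ.* a₄) (c ℤ.* a₅) (c ℤ.* a₆)

2ℤ : ℤ
2ℤ = ℤ.+ 2

-- The counts from s1 and s1F agree when 4231 is allowed.
pull : Bool → Form → Form
pull true (form f₀ f₁ f₁F f₂ f₂D f₃ f₃E) = form
  (f₀ ℤ.+ f₁ ℤ.+ f₁F) (f₀ ℤ.+ 2ℤ ℤ.* f₁ ℤ.+ 2ℤ ℤ.* f₁F ℤ.+ f₂ ℤ.+ f₂D) f₁
  (f₁ ℤ.+ f₁F ℤ.+ 2ℤ ℤ.* f₂ ℤ.+ 2ℤ ℤ.* f₂D) (f₃ ℤ.+ f₃E) f₂ (2ℤ ℤ.* f₃ ℤ.+ f₃E)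
pull false (form f₀ f₁ f₁F f₂ f₂D f₃ f₃E) = form
  (f₀ ℤ.+ f₁ ℤ.+ f₁F) (f₀ ℤ.+ ℤ.+ 3 ℤ.* f₁ ℤ.+ ℤ.+ 3 ℤ.* f₁F ℤ.+ f₂ ℤ.+ f₂D) ℤ.0ℤ
  (f₁ ℤ.+ f₁F ℤ.+ 2ℤ ℤ.* f₂ ℤ.+ 2ℤ ℤ.* f₂D) (f₃ ℤ.+ f₃E) f₂ (2ℤ ℤ.* f₃ ℤ.+ f₃E)

module _ where
  open ℤ-Solver.+-*-Solver using (solve; _:=_; _:+_; _:*_; con)

  eval-⊕ : ∀ b f g n → eval b (f ⊕ g) n ≡ eval b f n ℤ.+ eval b g n
  eval-⊕ b (form a₀ a₁ a₂ a₃ a₄ a₅ a₆) (form b₀ b₁ b₂ b₃ b₄ b₅ b₆) n = solve 21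
    (λ a₀ a₁ a₂ a₃ a₄ a₅ a₆ b₀ b₁ b₂ b₃ b₄ b₅ b₆ x₀ x₁ x₂ x₃ x₄ x₅ x₆ →
      (a₀ :+ b₀) :* x₀ :+ (a₁ :+ b₁) :* x₁ :+ (a₂ :+ b₂) :* x₂ :+ (a₃ :+ b₃) :* x₃ :+
        (a₄ :+ b₄) :* x₄ :+ (a₅ :+ b₅) :* x₅ :+ (a₆ :+ b₆) :* x₆ :=
      (a₀ :* x₀ :+ a₁ :* x₁ :+ a₂ :* x₂ :+ a₃ :* x₃ :+ a₄ :* x₄ :+ a₅ :* x₅ :+ a₆ :* x₆) :+
      (b₀ :* x₀ :+ b₁ :* x₁ :+ b₂ :* x₂ :+ b₃ :* x₃ :+ b₄ :* x₄ :+ b₅ :* x₅ :+ b₆ :* x₆))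
    refl a₀ a₁ a₂ a₃ a₄ a₅ a₆ b₀ b₁ b₂ b₃ b₄ b₅ b₆ _ _ _ _ _ _ _

  eval-⊙ : ∀ b c f n → eval b (c ⊙ f) n ≡ c ℤ.* eval b f n
  eval-⊙ b c (form a₀ a₁ a₂ a₃ a₄ a₅ a₆) n = solve 15
    (λ c a₀ a₁ a₂ a₃ a₄ a₅ a₆ x₀ x₁ x₂ x₃ x₄ x₅ x₆ →
      (c :* a₀) :* x₀ :+ (c :* a₁) :* x₁ :+ (c :* a₂) :* x₂ :+ (c :* a₃) :* x₃ :+
        (c :* a₄) :* x₄ :+ (c :* a₅) :* x₅ :+ (c :* a₆) :* x₆ :=
      c :* (a₀ :* x₀ :+ a₁ :* x₁ :+ a₂ :* x₂ :+ a₃ :* x₃ :+ a₄ :* x₄ :+ a₅ :* x₅ :+ a₆ :* x₆))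
    refl c a₀ a₁ a₂ a₃ a₄ a₅ a₆ _ _ _ _ _ _ _

  count-1F : ∀ n → Hexagonal.count false s1F n ≡ Hexagonal.count false s1 n
  count-1F zero    = refl
  count-1F (suc n) = refl

  private
    eval-pull-false : ∀ f n → eval false (pull false f) n ≡ eval false f (suc n)
    eval-pull-false (form a₀ a₁ a₂ a₃ a₄ a₅ a₆) n
      rewrite count-3A false n | count-1F n = solve 14
      (λ a₀ a₁ a₂ a₃ a₄ a₅ a₆ x₀ x₁ x₂ x₃ x₄ x₅ x₆ →
        (a₀ :+ a₁ :+ a₂) :* x₀ :+
        (a₀ :+ con (ℤ.+ 3) :* a₁ :+ con (ℤ.+ 3) :* a₂ :+ a₃ :+ a₄) :* x₁ :+ con ℤ.0ℤ :* x₂ :+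
        (a₁ :+ a₂ :+ con 2ℤ :* a₃ :+ con 2ℤ :* a₄) :* x₃ :+
        (a₅ :+ a₆) :* x₄ :+ a₃ :* x₅ :+ (con 2ℤ :* a₅ :+ a₆) :* x₆ :=
        a₀ :* (x₁ :+ x₀) :+ a₁ :* (x₃ :+ (x₁ :+ (x₁ :+ (x₀ :+ x₁)))) :+
        a₂ :* (x₃ :+ (x₁ :+ (x₁ :+ (x₀ :+ x₁)))) :+
        a₃ :* (x₅ :+ (x₃ :+ (x₃ :+ (x₁ :+ con ℤ.0ℤ)))) :+
        a₄ :* (x₃ :+ (x₃ :+ (x₁ :+ con ℤ.0ℤ))) :+ a₅ :* (x₆ :+ (x₆ :+ (x₄ :+ con ℤ.0ℤ))) :+
        a₆ :* (x₆ :+ (x₄ :+ con ℤ.0ℤ)))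
      refl a₀ a₁ a₂ a₃ a₄ a₅ a₆ (ℤ.+ count s0 n) (ℤ.+ count s1 n) (ℤ.+ count s1F n)
        (ℤ.+ count s2 n) (ℤ.+ count s2D n) (ℤ.+ count s3 n) (ℤ.+ count s3E n)
      where open Hexagonal false

    eval-pull-true : ∀ f n → eval true (pull true f) n ≡ eval true f (suc n)
    eval-pull-true (form a₀ a₁ a₂ a₃ a₄ a₅ a₆) n
      rewrite count-3A true n = solve 14
      (λ a₀ a₁ a₂ a₃ a₄ a₅ a₆ x₀ x₁ x₂ x₃ x₄ x₅ x₆ →
        (a₀ :+ a₁ :+ a₂) :* x₀ :+
        (a₀ :+ con 2ℤ :* a₁ :+ con 2ℤ :* a₂ :+ a₃ :+ a₄) :* x₁ :+ a₁ :* x₂ :+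
        (a₁ :+ a₂ :+ con 2ℤ :* a₃ :+ con 2ℤ :* a₄) :* x₃ :+
        (a₅ :+ a₆) :* x₄ :+ a₃ :* x₅ :+ (con 2ℤ :* a₅ :+ a₆) :* x₆ :=
        a₀ :* (x₁ :+ x₀) :+ a₁ :* (x₃ :+ (x₁ :+ (x₁ :+ (x₀ :+ x₂)))) :+
        a₂ :* (x₃ :+ (x₁ :+ (x₁ :+ (x₀ :+ con ℤ.0ℤ)))) :+
        a₃ :* (x₅ :+ (x₃ :+ (x₃ :+ (x₁ :+ con ℤ.0ℤ)))) :+
        a₄ :* (x₃ :+ (x₃ :+ (x₁ :+ con ℤ.0ℤ))) :+ a₅ :* (x₆ :+ (x₆ :+ (x₄ :+ con ℤ.0ℤ))) :+
        a₆ :* (x₆ :+ (x₄ :+ con ℤ.0ℤ)))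
      refl a₀ a₁ a₂ a₃ a₄ a₅ a₆ (ℤ.+ count s0 n) (ℤ.+ count s1 n) (ℤ.+ count s1F n)
        (ℤ.+ count s2 n) (ℤ.+ count s2D n) (ℤ.+ count s3 n) (ℤ.+ count s3E n)
      where open Hexagonal true

  -- `pull` is the transpose of the transfer matrix, acting on forms instead of counts.
  eval-pull : ∀ b f n → eval b (pull b f) n ≡ eval b f (suc n)
  eval-pull true  = eval-pull-true
  eval-pull false = eval-pull-false

pulls : Bool → ℕ → Form → Form
pulls b zero    f = f
pulls b (suc k) f = pulls b k (pull b f)

eval-pulls : ∀ b k f n → eval b (pulls b k f) n ≡ eval b f (k ℕ.+ n)
eval-pulls b zero    f n = refl
eval-pulls b (suc k) f n = trans (eval-pulls b k (pull b f) n) (eval-pull b f (k ℕ.+ n))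

-- A polynomial in `pull b` applied to `f`. The list is by increasing degree of the denominator, so
-- its head goes with the highest power of `pull b`.
convolveForm : Bool → List ℤ → Form → Form
convolveForm b []       f = zeroForm
convolveForm b (c ∷ cs) f = c ⊙ pulls b (List.length cs) f ⊕ convolveForm b cs f

eval-convolve : ∀ b c cs f n → convolve (c ∷ cs) (eval b f) (List.length cs ℕ.+ n) ≡
                               eval b (convolveForm b (c ∷ cs) f) n
eval-convolve b c cs f n = trans (go cs) (sym (eval-⊕ b (c ⊙ pulls b (List.length cs) f) _ n))
  where
  term : ∀ cs → eval b (c ⊙ pulls b (List.length cs) f) n ≡ c ℤ.* eval b f (List.length cs ℕ.+ n)
  term cs = trans (eval-⊙ b c (pulls b (List.length cs) f) n)
    (cong (c ℤ.*_) (eval-pulls b (List.length cs) f n))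
  single : ∀ n → convolve (c ∷ []) (eval b f) n ≡ c ℤ.* eval b f n ℤ.+ ℤ.0ℤ
  single zero    = sym (ℤ.+-identityʳ _)
  single (suc n) = refl
  go : ∀ cs → convolve (c ∷ cs) (eval b f) (List.length cs ℕ.+ n) ≡
       eval b (c ⊙ pulls b (List.length cs) f) n ℤ.+ eval b (convolveForm b cs f) n
  go []        = trans (single n) (cong (ℤ._+ ℤ.0ℤ) (sym (term [])))
  go (c′ ∷ cs) = cong₂ ℤ._+_ (sym (term (c′ ∷ cs))) (eval-convolve b c′ cs f n)

unit : Form
unit = form ℤ.1ℤ ℤ.0ℤ ℤ.0ℤ ℤ.0ℤ ℤ.0ℤ ℤ.0ℤ ℤ.0ℤ

module _ where
  open ℤ-Solver.+-*-Solver using (solve; _:=_; _:+_; _:*_; con)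

  eval-unit : ∀ b n → eval b unit n ≡ ℤ.+ Hexagonal.count b s0 n
  eval-unit b n = solve 7 (λ x₀ x₁ x₂ x₃ x₄ x₅ x₆ →
    con ℤ.1ℤ :* x₀ :+ con ℤ.0ℤ :* x₁ :+ con ℤ.0ℤ :* x₂ :+ con ℤ.0ℤ :* x₃ :+
    con ℤ.0ℤ :* x₄ :+ con ℤ.0ℤ :* x₅ :+ con ℤ.0ℤ :* x₆ := x₀) refl (x s0) (x s1) (x s1F) (x s2) (x s2D) (x s3) (x s3E)
    where
    x : State → ℤ
    x q = ℤ.+ Hexagonal.count b q n

  eval-zeroForm : ∀ b n → eval b zeroForm n ≡ ℤ.0ℤ
  eval-zeroForm b n = solve 7 (λ x₀ x₁ x₂ x₃ x₄ x₅ x₆ →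
    con ℤ.0ℤ :* x₀ :+ con ℤ.0ℤ :* x₁ :+ con ℤ.0ℤ :* x₂ :+ con ℤ.0ℤ :* x₃ :+
    con ℤ.0ℤ :* x₄ :+ con ℤ.0ℤ :* x₅ :+ con ℤ.0ℤ :* x₆ := con ℤ.0ℤ) refl (x s0) (x s1) (x s1F) (x s2) (x s2D) (x s3) (x s3E)
    where
    x : State → ℤ
    x q = ℤ.+ Hexagonal.count b q n

-- That convolveForm vanishes is the Cayley–Hamilton relation of the
-- transfer matrix on the counts from s0; it is checked by computation.
recurrence : ∀ b c cs → convolveForm b (c ∷ cs) (pull b unit) ≡ zeroForm → ∀ n →
             convolve (c ∷ cs) (λ n → ℤ.+ Hexagonal.count b s0 (suc n)) (List.length cs ℕ.+ n) ≡ ℤ.0ℤ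
recurrence b c cs vanish n = begin
  convolve (c ∷ cs) (λ n → ℤ.+ Hexagonal.count b s0 (suc n)) (List.length cs ℕ.+ n)
    ≡⟨ convolve-cong (c ∷ cs)
         (λ i → trans (eval-pull b unit i) (eval-unit b (suc i))) (List.length cs ℕ.+ n) ⟨
  convolve (c ∷ cs) (eval b (pull b unit)) (List.length cs ℕ.+ n)
    ≡⟨ eval-convolve b c cs (pull b unit) n ⟩
  eval b (convolveForm b (c ∷ cs) (pull b unit)) n
    ≡⟨ cong (λ f → eval b f n) vanish ⟩
  eval b zeroForm n
    ≡⟨ eval-zeroForm b n ⟩
  ℤ.0ℤ ∎
  where open ≡-Reasoning

-- The solver calls above do not typecheck once literals are overloaded.
open import Agda.Builtin.FromNat using (fromNat)
open import Agda.Builtin.FromNeg using (fromNeg)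

-- Power series

-- The definition splits off `f 0`. Splitting off `g 0` gives commutativity, and both together
-- isolate the outer terms of a square.
*-suc : ∀ f g n → (f * g) (suc n) ≡ (f * tail g) n ℚ.+ f (suc n) ℚ.* g 0
*-suc f g zero    = refl
*-suc f g (suc n) = trans
  (cong (f 0 ℚ.* g (suc (suc n)) ℚ.+_) (*-suc (tail f) g n))
  (sym (ℚ.+-assoc (f 0 ℚ.* g (suc (suc n))) ((tail f * tail g) n) (f (suc (suc n)) ℚ.* g 0)))

*-comm : ∀ f g → f * g ≗ g * f
*-comm f g zero    = ℚ.*-comm (f 0) (g 0)
*-comm f g (suc n) = begin
  f 0 ℚ.* g (suc n) ℚ.+ (tail f * g) n  ≡⟨ cong₂ ℚ._+_ (ℚ.*-comm (f 0) (g (suc n))) (*-comm (tail f) g n) ⟩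
  g (suc n) ℚ.* f 0 ℚ.+ (g * tail f) n  ≡⟨ ℚ.+-comm (g (suc n) ℚ.* f 0) ((g * tail f) n) ⟩
  (g * tail f) n ℚ.+ g (suc n) ℚ.* f 0  ≡⟨ *-suc g f n ⟨
  (g * f) (suc n)                       ∎
  where open ≡-Reasoning

scale : ℚ → PowerSeries → PowerSeries
scale c f n = c ℚ.* f n

scale-* : ∀ c f g → scale c f * g ≗ scale c (f * g)
scale-* c f g zero    = ℚ.*-assoc c (f 0) (g 0)
scale-* c f g (suc n) = trans
  (cong₂ ℚ._+_ (ℚ.*-assoc c (f 0) (g (suc n))) (scale-* c (tail f) g n))
  (sym (ℚ.*-distribˡ-+ c (f 0 ℚ.* g (suc n)) ((tail f * g) n)))

*-assoc : ∀ f g h → (f * g) * h ≗ f * (g * h)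
*-assoc f g h zero    = ℚ.*-assoc (f 0) (g 0) (h 0)
-- By definition `tail (f * g)` is `scale (f 0) (tail g) + tail f * g`.
*-assoc f g h (suc n) = begin
  (f 0 ℚ.* g 0) ℚ.* h (suc n) ℚ.+ ((scale (f 0) (tail g) + (tail f * g)) * h) n
    ≡⟨ cong₂ ℚ._+_ (ℚ.*-assoc (f 0) (g 0) (h (suc n)))
         (trans (*-distribʳ-+ (scale (f 0) (tail g)) (tail f * g) h n)
           (cong₂ ℚ._+_ (scale-* (f 0) (tail g) h n) (*-assoc (tail f) g h n))) ⟩
  f 0 ℚ.* (g 0 ℚ.* h (suc n)) ℚ.+ (f 0 ℚ.* (tail g * h) n ℚ.+ (tail f * (g * h)) n)
    ≡⟨ ℚ.+-assoc (f 0 ℚ.* (g 0 ℚ.* h (suc n))) (f 0 ℚ.* (tail g * h) n) ((tail f * (g * h)) n) ⟨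
  f 0 ℚ.* (g 0 ℚ.* h (suc n)) ℚ.+ f 0 ℚ.* (tail g * h) n ℚ.+ (tail f * (g * h)) n
    ≡⟨ cong (ℚ._+ (tail f * (g * h)) n)
         (ℚ.*-distribˡ-+ (f 0) (g 0 ℚ.* h (suc n)) ((tail g * h) n)) ⟨
  (f * (g * h)) (suc n)  ∎
  where open ≡-Reasoning

zero-* : ∀ {f} → (∀ n → f n ≡ 0ℚ) → ∀ g n → (f * g) n ≡ 0ℚ
zero-* z g zero    = trans (cong (ℚ._* g 0) (z 0)) (ℚ.*-zeroˡ (g 0))
zero-* z g (suc n) = trans
  (cong₂ ℚ._+_ (trans (cong (ℚ._* g (suc n)) (z 0)) (ℚ.*-zeroˡ (g (suc n)))) (zero-* (z ∘ suc) g n))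
  (ℚ.+-identityˡ 0ℚ)

*-identityˡ : ∀ f → const 1ℚ * f ≗ f
*-identityˡ f zero    = ℚ.*-identityˡ (f 0)
*-identityˡ f (suc n) = trans
  (cong₂ ℚ._+_ (ℚ.*-identityˡ (f (suc n))) (zero-* (λ _ → refl) f n)) (ℚ.+-identityʳ (f (suc n)))

-- With h⁻¹ the inverse, f = f (h h⁻¹) = (h f) h⁻¹ = g h⁻¹; the shift by the order of h clears the
-- pole.
*⇒/ : ∀ {f g h} {{_ : NonZero ⟦ h ⟧}} → h * f ≗ g → ⟦ f ⟧ ≈ ⟦ g ⟧ / ⟦ h ⟧
*⇒/ {f} {g} {h} {{h≢0}} hf≗g n = begin
  shift k f n                 ≡⟨ shift-cong k (λ i → trans (*-comm f (const 1ℚ) i) (*-identityˡ f i)) n ⟨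
  shift k (f * const 1ℚ) n    ≡⟨ shift-*ʳ k f (const 1ℚ) n ⟨
  (f * shift k (const 1ℚ)) n  ≡⟨ *-cong {f} (λ _ → refl) (λ i → sym (⁻¹-inverse ⟦ h ⟧ i)) n ⟩
  (f * (h * h⁻¹)) n             ≡⟨ *-assoc f h h⁻¹ n ⟨
  ((f * h) * h⁻¹) n             ≡⟨ *-cong {g = h⁻¹} (λ i → trans (*-comm f h i) (hf≗g i)) (λ _ → refl) n ⟩
  (g * h⁻¹) n                   ∎
  where
  open ≡-Reasoning
  k : ℕ
  k = NonZero.order h≢0
  h⁻¹ : PowerSeries
  h⁻¹ = Laurent.series (⟦ h ⟧ ⁻¹)

-- Integer sequences as power series

fromℤ-+ : ∀ i j → fromℤ (i ℤ.+ j) ≡ fromℤ i ℚ.+ fromℤ j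
fromℤ-+ i j = ℚ.toℚᵘ-injective (ℚᵘ.≃-trans
  (ℚᵘ.*≡* (solve (suc (suc zero)) (λ i j → (i :+ j) :* (con ℤ.1ℤ :* con ℤ.1ℤ) :=
             (i :* con ℤ.1ℤ :+ j :* con ℤ.1ℤ) :* con ℤ.1ℤ) refl i j))
  (ℚᵘ.≃-sym (ℚ.toℚᵘ-homo-+ (fromℤ i) (fromℤ j))))
  where open ℤ-Solver.+-*-Solver using (solve; _:=_; _:+_; _:*_; con)

fromℤ-* : ∀ i j → fromℤ (i ℤ.* j) ≡ fromℤ i ℚ.* fromℤ j
fromℤ-* i j = ℚ.toℚᵘ-injective (ℚᵘ.≃-trans (ℚᵘ.*≡* refl)
  (ℚᵘ.≃-sym (ℚ.toℚᵘ-homo-* (fromℤ i) (fromℤ j))))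

poly-* : ∀ cs f → poly cs * (fromℤ ∘ f) ≗ fromℤ ∘ convolve cs f
poly-* []       f n       = zero-* (λ _ → refl) (fromℤ ∘ f) n
poly-* (c ∷ cs) f zero    = sym (fromℤ-* c (f 0))
poly-* (c ∷ cs) f (suc n) = trans
  (cong₂ ℚ._+_ (sym (fromℤ-* c (f (suc n)))) (poly-* cs f n))
  (sym (fromℤ-+ (c ℤ.* f (suc n)) (convolve cs f n)))

-- Maximally clustered counts

√[1-4x] : PowerSeries
√[1-4x] = √ (poly (1 ∷ -4 ∷ []))

two : ℚ
two = 1ℚ ℚ.+ 1ℚ

catalan : PowerSeries
catalan n = ℚ.- ½ ℚ.* √[1-4x] (suc n)

module _ where
  open ≡-Reasoning
  open ℚ-Solver.+-*-Solver using (solve; _:=_; _:+_; _:*_; :-_; _:-_; con)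

  private
    S C : PowerSeries
    S = √[1-4x]
    C = catalan

    tail-S : tail S ≗ scale (ℚ.- two) C
    tail-S n = solve (suc zero) (λ s → s := con (ℚ.- two) :* (con (ℚ.- ½) :* s)) refl (S (suc n))

    tail-S² : tail S * tail S ≗ scale (ℚ.- two) (scale (ℚ.- two) (C * C))
    tail-S² n = begin
      (tail S * tail S) n                     ≡⟨ *-cong {g = tail S} tail-S (λ _ → refl) n ⟩
      (scale (ℚ.- two) C * tail S) n          ≡⟨ scale-* (ℚ.- two) C (tail S) n ⟩
      ℚ.- two ℚ.* (C * tail S) n              ≡⟨ cong (ℚ.- two ℚ.*_) (*-comm C (tail S) n) ⟩
      ℚ.- two ℚ.* (tail S * C) n              ≡⟨ cong (ℚ.- two ℚ.*_) (*-cong {g = C} tail-S (λ _ → refl) n) ⟩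
      ℚ.- two ℚ.* (scale (ℚ.- two) C * C) n   ≡⟨ cong (ℚ.- two ℚ.*_) (scale-* (ℚ.- two) C C n) ⟩
      ℚ.- two ℚ.* (ℚ.- two ℚ.* (C * C) n)     ∎

  -- The coefficient of xⁿ⁺² in S² = 1 - 4x, where S = 1 - 2xC.
  catalan-square : tail catalan ≗ catalan * catalan
  catalan-square n = begin
    ℚ.- ½ ℚ.* s
      -- The bracket is the vanishing coefficient of xⁿ⁺² in S², namely 2s + 4p with p that of xⁿ in
      -- C²; a quarter of it is subtracted.
      ≡⟨ solve (suc (suc zero)) (λ s p → con (ℚ.- ½) :* s := p :- con (½ ℚ.* ½) :*
           (con 1ℚ :* s :+ (con (ℚ.- two) :* (con (ℚ.- two) :* p) :+ s :* con 1ℚ))) refl s ((C * C) n) ⟩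
    (C * C) n ℚ.- ½ ℚ.* ½ ℚ.* (1ℚ ℚ.* s ℚ.+ (ℚ.- two ℚ.* (ℚ.- two ℚ.* (C * C) n) ℚ.+ s ℚ.* 1ℚ))
      ≡⟨ cong (λ t → (C * C) n ℚ.- ½ ℚ.* ½ ℚ.* t) vanish ⟩
    (C * C) n ℚ.- ½ ℚ.* ½ ℚ.* 0ℚ
      ≡⟨ solve (suc zero) (λ p → p :- con (½ ℚ.* ½) :* con 0ℚ := p) refl ((C * C) n) ⟩
    (C * C) n ∎
    where
    s : ℚ
    s = S (suc (suc n))
    vanish : 1ℚ ℚ.* s ℚ.+ (ℚ.- two ℚ.* (ℚ.- two ℚ.* (C * C) n) ℚ.+ s ℚ.* 1ℚ) ≡ 0ℚ
    vanish = begin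
      1ℚ ℚ.* s ℚ.+ (ℚ.- two ℚ.* (ℚ.- two ℚ.* (C * C) n) ℚ.+ s ℚ.* 1ℚ)
        ≡⟨ cong (λ t → 1ℚ ℚ.* s ℚ.+ (t ℚ.+ s ℚ.* 1ℚ)) (tail-S² n) ⟨
      1ℚ ℚ.* s ℚ.+ ((tail S * tail S) n ℚ.+ s ℚ.* 1ℚ)
        ≡⟨ cong (1ℚ ℚ.* s ℚ.+_) (*-suc (tail S) S n) ⟨
      (S * S) (suc (suc n))
        ≡⟨ √-square (poly (1 ∷ -4 ∷ [])) refl (suc (suc n)) ⟩
      0ℚ ∎

  module _ (V : ℕ → PowerSeries)
           (V-zero : ∀ l → V (suc l) 0 ≡ 0ℚ)
           (V-suc : ∀ l n → V (suc l) (suc n) ≡ V l n ℚ.+ (V (suc l) n ℚ.+ (V (suc l) n ℚ.+ V (suc (suc l)) n)))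
           (V-head : V 0 0 ≡ 1ℚ)
           (V-tail : ∀ n → V 0 (suc n) ≡ V 1 (suc n) ℚ.+ V 0 n) where

    private
      Shifts : ℕ → Set
      Shifts n = ∀ l → (C * V l) n ≡ V l n ℚ.+ V (suc l) n

      -- Since `tail C` is C², the hypothesis applies twice and yields V l + 2 V (l+1) + V (l+2),
      -- which is the recurrence for V (l+1).
      catalan-shift′ : ∀ n → (∀ i → i ℕ.≤ n → Shifts i) → Shifts (suc n)
      catalan-shift′ n ih l = begin
        1ℚ ℚ.* V l (suc n) ℚ.+ (tail C * V l) n
          ≡⟨ cong₂ ℚ._+_ (ℚ.*-identityˡ (V l (suc n))) (begin
            (tail C * V l) n             ≡⟨ *-cong {g = V l} catalan-square (λ _ → refl) n ⟩
            ((C * C) * V l) n            ≡⟨ *-assoc C C (V l) n ⟩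
            (C * (C * V l)) n            ≡⟨ agree-* n {C} (λ _ _ → refl) (λ i i≤n → ih i i≤n l) ⟩
            (C * (V l + V (suc l))) n    ≡⟨ *-distribˡ-+ C (V l) (V (suc l)) n ⟩
            (C * V l) n ℚ.+ (C * V (suc l)) n
              ≡⟨ cong₂ ℚ._+_ (ih n ℕ.≤-refl l) (ih n ℕ.≤-refl (suc l)) ⟩
            (V l n ℚ.+ V (suc l) n) ℚ.+ (V (suc l) n ℚ.+ V (suc (suc l)) n)
              ≡⟨ ℚ.+-assoc (V l n) (V (suc l) n) (V (suc l) n ℚ.+ V (suc (suc l)) n) ⟩
            V l n ℚ.+ (V (suc l) n ℚ.+ (V (suc l) n ℚ.+ V (suc (suc l)) n))
              ≡⟨ V-suc l n ⟨
            V (suc l) (suc n)            ∎) ⟩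
        V l (suc n) ℚ.+ V (suc l) (suc n) ∎

      below : ∀ n i → i ℕ.≤ n → Shifts i
      below n       zero    _         l = trans (ℚ.*-identityˡ (V l 0))
        (sym (trans (cong (V l 0 ℚ.+_) (V-zero l)) (ℚ.+-identityʳ (V l 0))))
      below (suc n) (suc i) (s≤s i≤n) =
        catalan-shift′ i (λ k k≤i → below n k (ℕ.≤-trans k≤i i≤n))

    catalan-shift : ∀ l → C * V l ≗ V l + V (suc l)
    catalan-shift l n = below n n ℕ.≤-refl l

    -- With S = 1 - 2xC and C V₀ = V₀ + V₁ the product becomes 2x (V₀ - x V₀ - V₁), and the last
    -- factor is 1.
    clustered-series : (poly (-1 ∷ 4 ∷ -2 ∷ []) + √[1-4x]) * V 0 ≗ poly (0 ∷ 2 ∷ [])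
    clustered-series zero    = ℚ.*-zeroˡ (V 0 0)
    clustered-series (suc n) = begin
      0ℚ ℚ.* V 0 (suc n) ℚ.+ ((q + tail S) * V 0) n
        ≡⟨ trans (cong (ℚ._+ ((q + tail S) * V 0) n) (ℚ.*-zeroˡ (V 0 (suc n)))) (ℚ.+-identityˡ _) ⟩
      ((q + tail S) * V 0) n
        ≡⟨ *-distribʳ-+ q (tail S) (V 0) n ⟩
      (q * V 0) n ℚ.+ (tail S * V 0) n
        ≡⟨ cong ((q * V 0) n ℚ.+_) (begin
          (tail S * V 0) n                  ≡⟨ *-cong {g = V 0} tail-S (λ _ → refl) n ⟩
          (scale (ℚ.- two) C * V 0) n       ≡⟨ scale-* (ℚ.- two) C (V 0) n ⟩
          ℚ.- two ℚ.* (C * V 0) n           ≡⟨ cong (ℚ.- two ℚ.*_) (catalan-shift 0 n) ⟩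
          ℚ.- two ℚ.* (V 0 n ℚ.+ V 1 n)     ∎) ⟩
      (q * V 0) n ℚ.+ ℚ.- two ℚ.* (V 0 n ℚ.+ V 1 n)
        ≡⟨ final n ⟩
      poly (2 ∷ []) n ∎
      where
      q : PowerSeries
      q = poly (4 ∷ -2 ∷ [])
      final : ∀ n → (q * V 0) n ℚ.+ ℚ.- two ℚ.* (V 0 n ℚ.+ V 1 n) ≡ poly (2 ∷ []) n
      final zero    rewrite V-head | V-zero 0 = refl
      final (suc n) = begin
        (fromℤ 4 ℚ.* V 0 (suc n) ℚ.+ (poly (-2 ∷ []) * V 0) n) ℚ.+ ℚ.- two ℚ.* (V 0 (suc n) ℚ.+ V 1 (suc n))
          ≡⟨ cong₂ (λ t u → (fromℤ 4 ℚ.* t ℚ.+ u) ℚ.+ ℚ.- two ℚ.* (t ℚ.+ V 1 (suc n))) (V-tail n) (linear n) ⟩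
        (fromℤ 4 ℚ.* (V 1 (suc n) ℚ.+ V 0 n) ℚ.+ ℚ.- two ℚ.* V 0 n) ℚ.+
          ℚ.- two ℚ.* ((V 1 (suc n) ℚ.+ V 0 n) ℚ.+ V 1 (suc n))
          ≡⟨ solve (suc (suc zero)) (λ a b → (con (fromℤ 4) :* (b :+ a) :+ con (ℚ.- two) :* a) :+
               con (ℚ.- two) :* ((b :+ a) :+ b) := con 0ℚ) refl (V 0 n) (V 1 (suc n)) ⟩
        0ℚ ∎
        where
        linear : ∀ n → (poly (-2 ∷ []) * V 0) n ≡ ℚ.- two ℚ.* V 0 n
        linear zero    = refl
        linear (suc n) = trans (cong (ℚ.- two ℚ.* V 0 (suc n) ℚ.+_) (zero-* (λ _ → refl) (V 0) n))
          (ℚ.+-identityʳ _)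

-- Generating functions of the hexagonal counts

hexagonSeries : Bool → PowerSeries
hexagonSeries b = ogf (λ n → Hexagonal.count b s0 (suc n))

-- The coefficients below the degree 7 of the denominator are evaluated and give the numerator; from
-- there on `recurrence` makes them vanish.
braid-series : poly (-1 ∷ 6 ∷ -9 ∷ 3 ∷ 1 ∷ -8 ∷ -1 ∷ 1 ∷ []) * hexagonSeries true ≗
               poly (-1 ∷ 4 ∷ -3 ∷ 1 ∷ 2 ∷ -2 ∷ -1 ∷ [])
braid-series n = trans (poly-* (-1 ∷ 6 ∷ -9 ∷ 3 ∷ 1 ∷ -8 ∷ -1 ∷ 1 ∷ [])
  (λ n → ℤ.+ Hexagonal.count true s0 (suc n)) n) (go n)
  where
  go : ∀ n → fromℤ (convolve (-1 ∷ 6 ∷ -9 ∷ 3 ∷ 1 ∷ -8 ∷ -1 ∷ 1 ∷ [])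
         (λ n → ℤ.+ Hexagonal.count true s0 (suc n)) n) ≡ poly (-1 ∷ 4 ∷ -3 ∷ 1 ∷ 2 ∷ -2 ∷ -1 ∷ []) n
  go 0 = refl
  go 1 = refl
  go 2 = refl
  go 3 = refl
  go 4 = refl
  go 5 = refl
  go 6 = refl
  go (suc (suc (suc (suc (suc (suc (suc n))))))) = cong fromℤ
    (recurrence true -1 (6 ∷ -9 ∷ 3 ∷ 1 ∷ -8 ∷ -1 ∷ 1 ∷ []) refl n)

hexagon-series : poly (1 ∷ -7 ∷ 15 ∷ -14 ∷ 8 ∷ 4 ∷ -3 ∷ []) * hexagonSeries false ≗
                 poly (1 ∷ -5 ∷ 7 ∷ -5 ∷ 1 ∷ 3 ∷ [])
hexagon-series n = trans (poly-* (1 ∷ -7 ∷ 15 ∷ -14 ∷ 8 ∷ 4 ∷ -3 ∷ [])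
  (λ n → ℤ.+ Hexagonal.count false s0 (suc n)) n) (go n)
  where
  go : ∀ n → fromℤ (convolve (1 ∷ -7 ∷ 15 ∷ -14 ∷ 8 ∷ 4 ∷ -3 ∷ [])
         (λ n → ℤ.+ Hexagonal.count false s0 (suc n)) n) ≡ poly (1 ∷ -5 ∷ 7 ∷ -5 ∷ 1 ∷ 3 ∷ []) n
  go 0 = refl
  go 1 = refl
  go 2 = refl
  go 3 = refl
  go 4 = refl
  go 5 = refl
  go (suc (suc (suc (suc (suc (suc n)))))) = cong fromℤ
    (recurrence false 1 (-7 ∷ 15 ∷ -14 ∷ 8 ∷ 4 ∷ -3 ∷ []) refl n)

-- Counting avoiders by accepted words

module _ {n m k ps} {P : Vec Step n → Set}
         (P-irrelevant : ∀ w (a b : P w) → a ≡ b)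
         (parses : ∀ (σ : Permutation′ n) → σ Avoids ps → ∃ λ w → Run 0 σ w × P w)
         (realises : ∀ w → P w → Realised 0 w)
         (avoids : ∀ {σ : Permutation′ n} {w} → Run 0 σ w → P w → σ Avoids ps)
         (words : Fin k ↔ ∃ P) (size : m IsSizeOf Avoiders n ps) where

  private
    module W = Inverse words
    module S = Inverse size

    word : (x : Fin m) → ∃ λ w → Run 0 (proj₁ (S.to x)) w × P w
    word x = parses (proj₁ (S.to x)) (proj₂ (S.to x))

    index : Fin m → Fin k
    index x = W.from (proj₁ (word x) , proj₂ (proj₂ (word x)))

    index-injective : ∀ {x y} → index x ≡ index y → x ≡ y
    index-injective {x} {y} eq = trans (sym (S.strictlyInverseʳ x)) (trans
      (S.from-cong (run-unique
        (subst (Run 0 (proj₁ (S.to x))) w≡ (proj₁ (proj₂ (word x)))) (proj₁ (proj₂ (word y)))))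
      (S.strictlyInverseʳ y))
      where
      w≡ : proj₁ (word x) ≡ proj₁ (word y)
      w≡ = cong proj₁ (trans (sym (W.strictlyInverseˡ _)) (trans (cong W.to eq) (W.strictlyInverseˡ _)))

    realised : ∀ {w} → Realised 0 w → Σ (Permutation′ n) λ σ → Run 0 σ w
    realised (N , σ , r) = subst (λ N → Σ (Permutation′ N) λ σ → Run 0 σ _)
      (trans (run-size r) (ℕ.+-identityʳ n)) (σ , r)

    run : (x : Fin k) → Σ (Permutation′ n) λ σ → Run 0 σ (proj₁ (W.to x))
    run x = realised (realises _ (proj₂ (W.to x)))

    avoider : Fin k → Σ (Permutation′ n) (_Avoids ps)
    avoider x = proj₁ (run x) , avoids (proj₂ (run x)) (proj₂ (W.to x))

    avoider-injective : ∀ {x y} → S.from (avoider x) ≡ S.from (avoider y) → x ≡ y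
    avoider-injective {x} {y} eq =
      trans (sym (W.strictlyInverseʳ x)) (trans (cong W.from (pair w≡)) (W.strictlyInverseʳ y))
      where
      σ≗ : proj₁ (run x) ⟨$⟩ʳ_ ≗ proj₁ (run y) ⟨$⟩ʳ_
      σ≗ i = trans (sym (S.strictlyInverseˡ (avoider x) i))
        (trans (cong (λ z → proj₁ (S.to z) ⟨$⟩ʳ i) eq) (S.strictlyInverseˡ (avoider y) i))
      w≡ : proj₁ (W.to x) ≡ proj₁ (W.to y)
      w≡ = run-deterministic σ≗ (proj₂ (run x)) (proj₂ (run y))
      pair : proj₁ (W.to x) ≡ proj₁ (W.to y) → W.to x ≡ W.to y
      pair = pair′ _ _
        where
        pair′ : ∀ (u v : ∃ P) → proj₁ u ≡ proj₁ v → u ≡ v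
        pair′ (w , a) (_ , b) refl = cong (w ,_) (P-irrelevant w a b)

  -- Two injections between finite sets suffice: `run-unique` makes the map to words injective,
  -- `run-deterministic` the map back.
  size≡count : m ≡ k
  size≡count = Fin.cantor-schröder-bernstein index-injective avoider-injective

-- Sizes of the three classes

parse-clustered : ∀ (σ : Permutation′ n) → Clustered σ → ∃ λ (w : Vec Step n) → Run 0 σ w
parse-clustered {n} σ cl = parse n 0 σ (sym (ℕ.+-identityʳ n)) ((λ _ ()) , (λ _ ())) cl

clustered-count : ∀ {m} → m IsSizeOf Avoiders n maximallyClusteredPatterns → m ≡ Level.count 0 n
clustered-count {n} = size≡count (Level.Accepts-irrelevant 0)
  (λ σ a → let w , r = parse-clustered σ (avoids⇒clustered {σ = σ} a) in w , r , run⇒level r)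
  (realise 0) (λ {σ} r _ → clustered⇒avoids {σ = σ} (run-clustered r)) (Level.count-↔ 0 n)

module _ (b : Bool) where
  open Hexagonal b

  hexagonal-count : ∀ {ps m} →
    (∀ {σ : Permutation′ n} → σ Avoids ps → Clustered σ × ¬ Hexagon σ × (T b → ¬ Braid σ)) →
    (∀ {σ : Permutation′ n} → Clustered σ → ¬ Hexagon σ → (T b → ¬ Braid σ) → σ Avoids ps) →
    m IsSizeOf Avoiders n ps → m ≡ count s0 n
  hexagonal-count {n} split join = size≡count (Accepts-irrelevant s0)
    (λ σ a → let cl , ¬h , ¬b = split a ; w , r = parse-clustered σ cl in
      w , r , run⇒accepts b s0 r ¬h ¬b tt)
    (λ w a → realise 0 w (accepts⇒level b s0 w a))
    (λ r a → join (run-clustered r) (accepts⇒¬Hexagon b s0 a r) (¬braid b r a))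
    (count-↔ s0 n)
    where
    ¬braid : ∀ b {σ : Permutation′ n} {w : Vec Step n} → Run 0 σ w → Hexagonal.Accepts b s0 w →
             T b → ¬ Braid σ
    ¬braid true r a _ = accepts⇒¬Braid s0 a r

clustered-hexagonal-count : ∀ {m} → m IsSizeOf Avoiders n (maximallyClusteredPatterns ++ hexagonPatterns) →
                            m ≡ Hexagonal.count false s0 n
clustered-hexagonal-count = hexagonal-count false
  (λ {σ} a → let c , h = All.++⁻ maximallyClusteredPatterns a in
    avoids⇒clustered {σ = σ} c , avoids⇒¬Hexagon h , λ ())
  (λ {σ} cl ¬h _ → All.++⁺ (clustered⇒avoids {σ = σ} cl) (¬Hexagon⇒avoids ¬h))

braided-hexagonal-count : ∀ {m} → m IsSizeOf Avoiders n (freelyBraidedPatterns ++ hexagonPatterns) →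
                          m ≡ Hexagonal.count true s0 n
braided-hexagonal-count = hexagonal-count true
  -- `freelyBraidedPatterns` is 4231 followed by `maximallyClusteredPatterns`.
  (λ { {σ} (¬b ∷ a) → let c , h = All.++⁻ maximallyClusteredPatterns a in
    avoids⇒clustered {σ = σ} c , avoids⇒¬Hexagon h , λ _ o → ¬b (occurrence⇒contains _ o) })
  (λ {σ} cl ¬h ¬b → (¬b tt ∘ contains⇒occurrence _) ∷
    All.++⁺ (clustered⇒avoids {σ = σ} cl) (¬Hexagon⇒avoids ¬h))

-- The series of the level counts

cast : ℕ → ℚ
cast n = fromℤ (ℤ.+ n)

cast-+ : ∀ m n → cast (m ℕ.+ n) ≡ cast m ℚ.+ cast n
cast-+ m n = fromℤ-+ (ℤ.+ m) (ℤ.+ n)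

-- Counting words of length n + 1 at level 0 makes the recurrence for
-- level 1 the same as for all higher levels: the fixed points at level 1
-- are absorbed in the shift.
levelCount : ℕ → ℕ → ℕ
levelCount zero    n = Level.count 0 (suc n)
levelCount (suc l) n = Level.count (suc l) n

levelCount-suc : ∀ l n → levelCount (suc l) (suc n) ≡
  levelCount l n ℕ.+ (levelCount (suc l) n ℕ.+ (levelCount (suc l) n ℕ.+ levelCount (suc (suc l)) n))
levelCount-suc zero n = solve (suc (suc (suc zero)))
  (λ x y z → z :+ (y :+ (y :+ (x :+ y))) := (y :+ x) :+ (y :+ (y :+ z)))
  refl (Level.count 0 n) (Level.count 1 n) (Level.count 2 n)
  where open ℕ-Solver.+-*-Solver using (solve; _:=_; _:+_)
levelCount-suc (suc l) n = solve (suc (suc (suc zero)))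
  (λ x y z → z :+ (y :+ (y :+ (x :+ con 0))) := x :+ (y :+ (y :+ z)))
  refl (Level.count (suc l) n) (Level.count (suc (suc l)) n) (Level.count (suc (suc (suc l))) n)
  where open ℕ-Solver.+-*-Solver using (solve; _:=_; _:+_; con)

levelSeries : ℕ → PowerSeries
levelSeries l n = cast (levelCount l n)

levelSeries-suc : ∀ l n → levelSeries (suc l) (suc n) ≡
  levelSeries l n ℚ.+ (levelSeries (suc l) n ℚ.+ (levelSeries (suc l) n ℚ.+ levelSeries (suc (suc l)) n))
levelSeries-suc l n = trans (cong cast (levelCount-suc l n)) (trans (cast-+ (levelCount l n) _)
  (cong (levelSeries l n ℚ.+_) (trans (cast-+ (levelCount (suc l) n) _)
    (cong (levelSeries (suc l) n ℚ.+_) (cast-+ (levelCount (suc l) n) _)))))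

series-/ : ∀ {a c : ℕ → ℕ} {g h} {{_ : NonZero ⟦ h ⟧}} → (∀ n → a n ≡ c n) →
           h * ogf (λ n → c (suc n)) ≗ g → ⟦ ogf (λ n → a (suc n)) ⟧ ≈ ⟦ g ⟧ / ⟦ h ⟧
series-/ {h = h} a≡c eq = *⇒/ λ n → trans
  (*-cong {h} (λ _ → refl) (λ i → cong cast (a≡c (suc i))) n) (eq n)
  where open PowerSeriesProperties using (*-cong)

mainTheorem4 : ((a : ℕ → ℕ) →
    (∀ n → a n IsSizeOf Avoiders n maximallyClusteredPatterns) →
    ⟦ ogf (λ n → a (suc n)) ⟧ ≈
    ⟦ poly (0 ∷ 2 ∷ []) ⟧
    / ⟦ poly (-1 ∷ 4 ∷ -2 ∷ []) + √ (poly (1 ∷ -4 ∷ [])) ⟧)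
    ×
    ((b : ℕ → ℕ) →
    (∀ n → b n IsSizeOf Avoiders n (freelyBraidedPatterns ++ hexagonPatterns)) →
    ⟦ ogf (λ n → b (suc n)) ⟧ ≈
    ⟦ poly (-1 ∷ 4 ∷ -3 ∷ 1 ∷ 2 ∷ -2 ∷ -1 ∷ []) ⟧
    / ⟦ poly (-1 ∷ 6 ∷ -9 ∷ 3 ∷ 1 ∷ -8 ∷ -1 ∷ 1 ∷ []) ⟧)
    ×
    ((m : ℕ → ℕ) →
    (∀ n → m n IsSizeOf Avoiders n (maximallyClusteredPatterns ++ hexagonPatterns)) →
    ⟦ ogf (λ n → m (suc n)) ⟧ ≈
    ⟦ poly (1 ∷ -5 ∷ 7 ∷ -5 ∷ 1 ∷ 3 ∷ []) ⟧
    / ⟦ poly (1 ∷ -7 ∷ 15 ∷ -14 ∷ 8 ∷ 4 ∷ -3 ∷ []) ⟧)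
mainTheorem4 =
  (λ a size → series-/ {c = Level.count 0} (λ n → clustered-count (size n))
    (clustered-series levelSeries (λ _ → refl) levelSeries-suc refl
      -- A word of length n + 2 from level 0 starts with U or F.
      (λ n → cast-+ (Level.count 1 (suc n)) (Level.count 0 (suc n))))) ,
  (λ b size → series-/ {c = Hexagonal.count true s0} (λ n → braided-hexagonal-count (size n)) braid-series) ,
  (λ m size → series-/ {c = Hexagonal.count false s0} (λ n → clustered-hexagonal-count (size n)) hexagon-series)
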